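{- For every $\ell\ge1$, $\mathsf{RT}^2_2$ does not imply $(\forall k)\,\mathsf{RG}^2_{k,\ell}$ over $\mathsf{RCA}_0$.
   Context: $\mathsf{RT}^2_2$: every $f:[\mathbb N]^2\to2$ has an infinite $H$ with $f$ constant on $[H]^2$. A graph $(G,E)$ is a Rado graph if for every two disjoint finite sets of vertices $F_0,F_1$ there is a vertex adjacent to all of $F_0$ and to none of $F_1$. Fix a computable Rado graph $\mathcal R$. $(\forall k)\mathsf{RG}^2_{k,\ell}$: for every $k\ge1$ and every coloring $f:[\mathcal R]^2\to k$ of the $2$-element vertex sets of $\mathcal R$, there is an induced subgraph $\mathcal R'$ of $\mathcal R$ isomorphic to $\mathcal R$ with $|f([\mathcal R']^2)|\le\ell$. -}

module Defs where

open import Data.Bool using (Bool; T)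
open import Data.Empty using (⊥)
open import Data.Fin using (Fin; zero; suc; lift; _↑ˡ_; _↑ʳ_)
open import Data.List using (List; []; _∷_; map)
open import Data.List.Membership.Propositional using (_∈_)
open import Data.List.Relation.Binary.Disjoint.Propositional using (Disjoint)
open import Data.List.Relation.Unary.All using (All)
open import Data.Nat using (ℕ; zero; suc; _+_; _*_; _<_)
open import Data.Product using (_×_; ∃-syntax)
open import Data.Sum using (_⊎_)
open import Data.Vec using (Vec; []; _∷_; lookup)
open import Function using (id; _∘_)
open import Function.Bundles using (_⇔_)
open import Level using (0ℓ)
open import Relation.Binary using (Rel)
open import Relation.Binary.PropositionalEquality using (_≡_)
open import Relation.Nullary using (¬_; Dec)
open import Relation.Unary using (Pred)

------------------------------------------------------------------------
-- The language L₂ of second-order arithmetic, well-scoped de Bruijn: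
-- n free number variables, m free set variables.

infixl 7 _·̇_
infixl 6 _+̇_
infix  5 _≐_ _<̇_ _∈̇_
infixr 4 _∧̇_
infixr 3 _∨̇_
infixr 2 _⇒_
infix  1 _⇔̇_

data Term (n : ℕ) : Set where
  var       : Fin n → Term n
  0̇ 1̇       : Term n
  _+̇_ _·̇_   : Term n → Term n → Term n

data Formula (n m : ℕ) : Set where
  _≐_ _<̇_        : Term n → Term n → Formula n m
  _∈̇_            : Term n → Fin m → Formula n m
  ⊥̇              : Formula n m
  _∧̇_ _∨̇_ _⇒_    : Formula n m → Formula n m → Formula n m
  ∀₁_ ∃₁_        : Formula (suc n) m → Formula n m
  ∀₂_ ∃₂_        : Formula n (suc m) → Formula n m

¬̇_ : ∀ {n m} → Formula n m → Formula n m
¬̇ φ = φ ⇒ ⊥̇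

_⇔̇_ : ∀ {n m} → Formula n m → Formula n m → Formula n m
φ ⇔̇ ψ = (φ ⇒ ψ) ∧̇ (ψ ⇒ φ)

pattern x₀ = var zero
pattern x₁ = var (suc zero)
pattern x₂ = var (suc (suc zero))
pattern x₃ = var (suc (suc (suc zero)))

pattern X₀ = zero
pattern X₁ = suc zero
pattern X₂ = suc (suc zero)

------------------------------------------------------------------------
-- Substitution: terms for number variables, variables for set variables.

subᵗ : ∀ {n n′} → (Fin n → Term n′) → Term n → Term n′
subᵗ σ (var i) = σ i
subᵗ σ 0̇       = 0̇
subᵗ σ 1̇       = 1̇
subᵗ σ (t +̇ u) = subᵗ σ t +̇ subᵗ σ u
subᵗ σ (t ·̇ u) = subᵗ σ t ·̇ subᵗ σ u

wkᵗ : ∀ {n} → Term n → Term (suc n)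
wkᵗ = subᵗ (var ∘ suc)

infixr 5 _,ₛ_
_,ₛ_ : ∀ {n} {A : Set} → A → (Fin n → A) → Fin (suc n) → A
(a ,ₛ σ) zero    = a
(a ,ₛ σ) (suc i) = σ i

sub : ∀ {n n′ m m′} → (Fin n → Term n′) → (Fin m → Fin m′) →
      Formula n m → Formula n′ m′
sub σ τ (t ≐ u)  = subᵗ σ t ≐ subᵗ σ u
sub σ τ (t <̇ u)  = subᵗ σ t <̇ subᵗ σ u
sub σ τ (t ∈̇ X)  = subᵗ σ t ∈̇ τ X
sub σ τ ⊥̇        = ⊥̇
sub σ τ (φ ∧̇ ψ)  = sub σ τ φ ∧̇ sub σ τ ψ
sub σ τ (φ ∨̇ ψ)  = sub σ τ φ ∨̇ sub σ τ ψ
sub σ τ (φ ⇒ ψ)  = sub σ τ φ ⇒ sub σ τ ψ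
sub σ τ (∀₁ φ)   = ∀₁ sub (x₀ ,ₛ (wkᵗ ∘ σ)) τ φ
sub σ τ (∃₁ φ)   = ∃₁ sub (x₀ ,ₛ (wkᵗ ∘ σ)) τ φ
sub σ τ (∀₂ φ)   = ∀₂ sub σ (lift 1 τ) φ
sub σ τ (∃₂ φ)   = ∃₂ sub σ (lift 1 τ) φ

wk₁ : ∀ {n m} → Formula n m → Formula (suc n) m
wk₁ = sub (var ∘ suc) id

wk₂ : ∀ {n m} → Formula n m → Formula n (suc m)
wk₂ = sub var suc

_[_]₁ : ∀ {n m} → Formula (suc n) m → Term n → Formula n m
φ [ t ]₁ = sub (t ,ₛ var) id φ

_[_]₂ : ∀ {n m} → Formula n (suc m) → Fin m → Formula n m
φ [ X ]₂ = sub var (X ,ₛ id) φ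

-- φ is a class {x₀ : φ} in scope n, used under j further number quantifiers.
_at[_]_ : ∀ {n m} → Formula (suc n) m → (j : ℕ) → Term (j + n) → Formula (j + n) m
φ at[ j ] t = sub (t ,ₛ (λ i → var (j ↑ʳ i))) id φ

------------------------------------------------------------------------
-- Classical two-sorted natural deduction with equality on numbers.

-- A formula with free variables is an axiom in every scope, hence so is its
-- universal closure (by ∀₁I and ∀₂I).
Theory : Set₁
Theory = ∀ {n m} → Formula n m → Set

infix 0 _∣_⊢_
data _∣_⊢_ (𝕋 : Theory) {n m : ℕ} (Γ : List (Formula n m)) : Formula n m → Set where
  ax  : ∀ {φ} → 𝕋 φ → 𝕋 ∣ Γ ⊢ φ
  hyp : ∀ {φ} → φ ∈ Γ → 𝕋 ∣ Γ ⊢ φ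
  raa : ∀ {φ} → 𝕋 ∣ (¬̇ φ) ∷ Γ ⊢ ⊥̇ → 𝕋 ∣ Γ ⊢ φ
  ⇒I  : ∀ {φ ψ} → 𝕋 ∣ φ ∷ Γ ⊢ ψ → 𝕋 ∣ Γ ⊢ φ ⇒ ψ
  ⇒E  : ∀ {φ ψ} → 𝕋 ∣ Γ ⊢ φ ⇒ ψ → 𝕋 ∣ Γ ⊢ φ → 𝕋 ∣ Γ ⊢ ψ
  ∧I  : ∀ {φ ψ} → 𝕋 ∣ Γ ⊢ φ → 𝕋 ∣ Γ ⊢ ψ → 𝕋 ∣ Γ ⊢ φ ∧̇ ψ
  ∧E₁ : ∀ {φ ψ} → 𝕋 ∣ Γ ⊢ φ ∧̇ ψ → 𝕋 ∣ Γ ⊢ φ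
  ∧E₂ : ∀ {φ ψ} → 𝕋 ∣ Γ ⊢ φ ∧̇ ψ → 𝕋 ∣ Γ ⊢ ψ
  ∨I₁ : ∀ {φ ψ} → 𝕋 ∣ Γ ⊢ φ → 𝕋 ∣ Γ ⊢ φ ∨̇ ψ
  ∨I₂ : ∀ {φ ψ} → 𝕋 ∣ Γ ⊢ ψ → 𝕋 ∣ Γ ⊢ φ ∨̇ ψ
  ∨E  : ∀ {φ ψ χ} → 𝕋 ∣ Γ ⊢ φ ∨̇ ψ → 𝕋 ∣ φ ∷ Γ ⊢ χ → 𝕋 ∣ ψ ∷ Γ ⊢ χ → 𝕋 ∣ Γ ⊢ χ
  ∀₁I : ∀ {φ} → 𝕋 ∣ map wk₁ Γ ⊢ φ → 𝕋 ∣ Γ ⊢ ∀₁ φ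
  ∀₁E : ∀ {φ} → 𝕋 ∣ Γ ⊢ ∀₁ φ → (t : Term n) → 𝕋 ∣ Γ ⊢ φ [ t ]₁
  ∃₁I : ∀ {φ} (t : Term n) → 𝕋 ∣ Γ ⊢ φ [ t ]₁ → 𝕋 ∣ Γ ⊢ ∃₁ φ
  ∃₁E : ∀ {φ ψ} → 𝕋 ∣ Γ ⊢ ∃₁ φ → 𝕋 ∣ φ ∷ map wk₁ Γ ⊢ wk₁ ψ → 𝕋 ∣ Γ ⊢ ψ
  ∀₂I : ∀ {φ} → 𝕋 ∣ map wk₂ Γ ⊢ φ → 𝕋 ∣ Γ ⊢ ∀₂ φ
  ∀₂E : ∀ {φ} → 𝕋 ∣ Γ ⊢ ∀₂ φ → (X : Fin m) → 𝕋 ∣ Γ ⊢ φ [ X ]₂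
  ∃₂I : ∀ {φ} (X : Fin m) → 𝕋 ∣ Γ ⊢ φ [ X ]₂ → 𝕋 ∣ Γ ⊢ ∃₂ φ
  ∃₂E : ∀ {φ ψ} → 𝕋 ∣ Γ ⊢ ∃₂ φ → 𝕋 ∣ φ ∷ map wk₂ Γ ⊢ wk₂ ψ → 𝕋 ∣ Γ ⊢ ψ
  ≐I  : ∀ {t} → 𝕋 ∣ Γ ⊢ t ≐ t
  ≐E  : ∀ (φ : Formula (suc n) m) {t u} → 𝕋 ∣ Γ ⊢ t ≐ u → 𝕋 ∣ Γ ⊢ φ [ t ]₁ → 𝕋 ∣ Γ ⊢ φ [ u ]₁

------------------------------------------------------------------------
-- RCA₀: basic axioms, Σ⁰₁ induction, Δ⁰₁ comprehension.

data Bounded {n m : ℕ} : Formula n m → Set where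
  eq  : ∀ {t u} → Bounded (t ≐ u)
  lt  : ∀ {t u} → Bounded (t <̇ u)
  mem : ∀ {t X} → Bounded (t ∈̇ X)
  bot : Bounded ⊥̇
  and : ∀ {φ ψ} → Bounded φ → Bounded ψ → Bounded (φ ∧̇ ψ)
  or  : ∀ {φ ψ} → Bounded φ → Bounded ψ → Bounded (φ ∨̇ ψ)
  imp : ∀ {φ ψ} → Bounded φ → Bounded ψ → Bounded (φ ⇒ ψ)
  all : ∀ {φ} (t : Term n) → Bounded φ → Bounded (∀₁ (x₀ <̇ wkᵗ t ⇒ φ))
  ex  : ∀ {φ} (t : Term n) → Bounded φ → Bounded (∃₁ (x₀ <̇ wkᵗ t ∧̇ φ))

data Σ⁰₁ {n m : ℕ} : Formula n m → Set where
  ex : ∀ {θ} → Bounded θ → Σ⁰₁ (∃₁ θ)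

data Π⁰₁ {n m : ℕ} : Formula n m → Set where
  all : ∀ {θ} → Bounded θ → Π⁰₁ (∀₁ θ)

data RCA₀ {n m : ℕ} : Formula n m → Set where
  suc≢0   : ∀ t   → RCA₀ (¬̇ (t +̇ 1̇ ≐ 0̇))
  suc-inj : ∀ t u → RCA₀ (t +̇ 1̇ ≐ u +̇ 1̇ ⇒ t ≐ u)
  +-zero  : ∀ t   → RCA₀ (t +̇ 0̇ ≐ t)
  +-suc   : ∀ t u → RCA₀ (t +̇ (u +̇ 1̇) ≐ (t +̇ u) +̇ 1̇)
  ·-zero  : ∀ t   → RCA₀ (t ·̇ 0̇ ≐ 0̇)
  ·-suc   : ∀ t u → RCA₀ (t ·̇ (u +̇ 1̇) ≐ t ·̇ u +̇ t)
  ≮0      : ∀ t   → RCA₀ (¬̇ (t <̇ 0̇))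
  <-suc   : ∀ t u → RCA₀ (t <̇ u +̇ 1̇ ⇔̇ t <̇ u ∨̇ t ≐ u)
  Σ⁰₁-IND : ∀ {φ : Formula (suc n) m} → Σ⁰₁ φ →
            RCA₀ (φ [ 0̇ ]₁ ∧̇ ∀₁ (φ ⇒ φ at[ 1 ] (x₀ +̇ 1̇)) ⇒ ∀₁ φ)
  Δ⁰₁-CA  : ∀ {φ ψ : Formula (suc n) m} → Σ⁰₁ φ → Π⁰₁ ψ →
            RCA₀ (∀₁ (φ ⇔̇ ψ) ⇒ ∃₂ ∀₁ (x₀ ∈̇ X₀ ⇔̇ wk₂ φ))

------------------------------------------------------------------------
-- Truth in the standard model, and computable relations on ℕ.

⟦_⟧ᵗ : ∀ {n} → Term n → Vec ℕ n → ℕ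
⟦ var i ⟧ᵗ  ρ = lookup ρ i
⟦ 0̇ ⟧ᵗ      ρ = 0
⟦ 1̇ ⟧ᵗ      ρ = 1
⟦ t +̇ u ⟧ᵗ  ρ = ⟦ t ⟧ᵗ ρ + ⟦ u ⟧ᵗ ρ
⟦ t ·̇ u ⟧ᵗ  ρ = ⟦ t ⟧ᵗ ρ * ⟦ u ⟧ᵗ ρ

-- Below this is applied only to formulas without set variables, so the choice
-- of Bool-valued functions as the range of set quantifiers plays no role.
⟦_⟧ : ∀ {n m} → Formula n m → Vec ℕ n → Vec (ℕ → Bool) m → Set
⟦ t ≐ u ⟧  ρ ξ = ⟦ t ⟧ᵗ ρ ≡ ⟦ u ⟧ᵗ ρ
⟦ t <̇ u ⟧  ρ ξ = ⟦ t ⟧ᵗ ρ < ⟦ u ⟧ᵗ ρ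
⟦ t ∈̇ X ⟧  ρ ξ = T (lookup ξ X (⟦ t ⟧ᵗ ρ))
⟦ ⊥̇ ⟧      ρ ξ = ⊥
⟦ φ ∧̇ ψ ⟧  ρ ξ = ⟦ φ ⟧ ρ ξ × ⟦ ψ ⟧ ρ ξ
⟦ φ ∨̇ ψ ⟧  ρ ξ = ⟦ φ ⟧ ρ ξ ⊎ ⟦ ψ ⟧ ρ ξ
⟦ φ ⇒ ψ ⟧  ρ ξ = ⟦ φ ⟧ ρ ξ → ⟦ ψ ⟧ ρ ξ
⟦ ∀₁ φ ⟧   ρ ξ = ∀ x → ⟦ φ ⟧ (x ∷ ρ) ξ
⟦ ∃₁ φ ⟧   ρ ξ = ∃[ x ] ⟦ φ ⟧ (x ∷ ρ) ξ
⟦ ∀₂ φ ⟧   ρ ξ = ∀ X → ⟦ φ ⟧ ρ (X ∷ ξ)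
⟦ ∃₂ φ ⟧   ρ ξ = ∃[ X ] ⟦ φ ⟧ ρ (X ∷ ξ)

-- A computable relation, presented by a Δ⁰₁ definition without parameters.
-- Classically dec is redundant; constructively it does not follow from σ⇔π.
record ComputableRelation (n : ℕ) : Set where
  field
    σ π : Formula n 0
    σ-Σ : Σ⁰₁ σ
    π-Π : Π⁰₁ π
    σ⇔π : ∀ ρ → ⟦ σ ⟧ ρ [] ⇔ ⟦ π ⟧ ρ []
    dec : ∀ ρ → Dec (⟦ σ ⟧ ρ [])

  Holds : Vec ℕ n → Set
  Holds ρ = ⟦ σ ⟧ ρ []

  infix 6 ⌜_⌝
  ⌜_⌝ : ∀ {n′ m} → Vec (Term n′) n → Formula n′ m
  ⌜ ts ⌝ = sub (lookup ts) (λ ()) σ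

record IsGraph (G : Pred ℕ 0ℓ) (E : Rel ℕ 0ℓ) : Set where
  field
    vertices    : ∀ {x y} → E x y → G x × G y
    symmetric   : ∀ {x y} → E x y → E y x
    irreflexive : ∀ {x} → ¬ E x x

IsRado : Pred ℕ 0ℓ → Rel ℕ 0ℓ → Set
IsRado G E = ∀ (F₀ F₁ : List ℕ) → All G F₀ → All G F₁ → Disjoint F₀ F₁ →
  ∃[ x ] (G x × All (E x) F₀ × All (λ y → ¬ E x y) F₁)

record ComputableRadoGraph : Set where
  field
    vertex : ComputableRelation 1
    edge   : ComputableRelation 2

  Vertex : Pred ℕ 0ℓ
  Vertex x = ComputableRelation.Holds vertex (x ∷ [])

  Edge : Rel ℕ 0ℓ
  Edge x y = ComputableRelation.Holds edge (x ∷ y ∷ [])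

  field
    isGraph : IsGraph Vertex Edge
    isRado  : IsRado Vertex Edge

  vertexᶠ : ∀ {n m} → Term n → Formula n m
  vertexᶠ t = ComputableRelation.⌜_⌝ vertex (t ∷ [])

  edgeᶠ : ∀ {n m} → Term n → Term n → Formula n m
  edgeᶠ t u = ComputableRelation.⌜_⌝ edge (t ∷ u ∷ [])

------------------------------------------------------------------------
-- Functions and colorings inside second-order arithmetic.  A class is a
-- formula with distinguished variable x₀.

-- The usual pairing (i , j) = (i + j)² + i of second-order arithmetic.
⟨_,_⟩ : ∀ {n} → Term n → Term n → Term n
⟨ t , u ⟩ = (t +̇ u) ·̇ (t +̇ u) +̇ t

Everything : ∀ {n m} → Formula (suc n) m
Everything = x₀ ≐ x₀

Below : ∀ {n m} → Term n → Formula (suc n) m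
Below t = x₀ <̇ wkᵗ t

Elements : ∀ {n m} → Fin m → Formula (suc n) m
Elements X = x₀ ∈̇ X

-- [D]², the set {a , b} with a < b being coded by ⟨ a , b ⟩.
[_]² : ∀ {n m} → Formula (suc n) m → Formula (suc n) m
[ D ]² = ∃₁ ∃₁ (x₁ <̇ x₀ ∧̇ D at[ 3 ] x₁ ∧̇ D at[ 3 ] x₀ ∧̇ x₂ ≐ ⟨ x₁ , x₀ ⟩)

-- F is (the graph of) a function D → C.
Function : ∀ {n m} (F : Fin m) (D C : Formula (suc n) m) → Formula n m
Function F D C =
  ∀₁ (x₀ ∈̇ F ⇒ ∃₁ ∃₁ (D at[ 3 ] x₁ ∧̇ C at[ 3 ] x₀ ∧̇ x₂ ≐ ⟨ x₁ , x₀ ⟩)) ∧̇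
  ∀₁ (D ⇒ ∃₁ (⟨ x₁ , x₀ ⟩ ∈̇ F ∧̇ ∀₁ (⟨ x₂ , x₀ ⟩ ∈̇ F ⇒ x₀ ≐ x₁)))

Bijection : ∀ {n m} (F : Fin m) (D C : Formula (suc n) m) → Formula n m
Bijection F D C =
  Function F D C ∧̇
  ∀₁ ∀₁ ∀₁ (⟨ x₂ , x₀ ⟩ ∈̇ F ∧̇ ⟨ x₁ , x₀ ⟩ ∈̇ F ⇒ x₂ ≐ x₁) ∧̇
  ∀₁ (C ⇒ ∃₁ (⟨ x₀ , x₁ ⟩ ∈̇ F))

Infinite : ∀ {n m} → Fin m → Formula n m
Infinite H = ∀₁ ∃₁ (x₁ <̇ x₀ ∧̇ x₀ ∈̇ H)

-- Under the binders: x₂ = c, x₁ < x₀ the elements of a pair in [H]².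
ConstantOn : ∀ {n m} (F H : Fin m) → Formula n m
ConstantOn F H =
  ∃₁ ∀₁ ∀₁ (x₁ ∈̇ H ∧̇ x₀ ∈̇ H ∧̇ x₁ <̇ x₀ ⇒ ⟨ ⟨ x₁ , x₀ ⟩ , x₂ ⟩ ∈̇ F)

∃^ : ∀ {n m} (ℓ : ℕ) → Formula (ℓ + n) m → Formula n m
∃^ zero    φ = φ
∃^ (suc ℓ) φ = ∃^ ℓ (∃₁ φ)

⋁ : ∀ {n m} (ℓ : ℕ) → (Fin ℓ → Formula n m) → Formula n m
⋁ zero    φ = ⊥̇
⋁ (suc ℓ) φ = φ zero ∨̇ ⋁ ℓ (φ ∘ suc)

-- |F([H]²)| ≤ ℓ:  there are c₁ , … , c_ℓ with F([H]²) ⊆ {c₁ , … , c_ℓ}.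
AtMostColorsOn : ∀ {n m} (ℓ : ℕ) (F H : Fin m) → Formula n m
AtMostColorsOn {n} ℓ F H =
  ∃^ ℓ (∀₁ ∀₁ (x₁ ∈̇ H ∧̇ x₀ ∈̇ H ∧̇ x₁ <̇ x₀ ⇒
    ⋁ ℓ (λ i → ⟨ ⟨ x₁ , x₀ ⟩ , var (2 ↑ʳ (i ↑ˡ n)) ⟩ ∈̇ F)))

RT²₂ : Formula 0 0
RT²₂ =
  ∀₂ (Function X₀ [ Everything ]² (Below (1̇ +̇ 1̇)) ⇒
      ∃₂ (Infinite X₀ ∧̇ ConstantOn X₁ X₀))

module _ (𝓡 : ComputableRadoGraph) where
  open ComputableRadoGraph 𝓡

  -- H ⊆ 𝓡 and the subgraph of 𝓡 induced on H is isomorphic to 𝓡.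
  InducedCopy : ∀ {n m} → Fin m → Formula n m
  InducedCopy H =
    ∀₁ (x₀ ∈̇ H ⇒ vertexᶠ x₀) ∧̇
    ∃₂ (Bijection X₀ (vertexᶠ x₀) (Elements (suc H)) ∧̇
        ∀₁ ∀₁ ∀₁ ∀₁ (⟨ x₃ , x₁ ⟩ ∈̇ X₀ ∧̇ ⟨ x₂ , x₀ ⟩ ∈̇ X₀ ⇒
                     (edgeᶠ x₃ x₂ ⇔̇ edgeᶠ x₁ x₀)))

  ∀k-RG² : (ℓ : ℕ) → Formula 0 0
  ∀k-RG² ℓ =
    ∀₁ (0̇ <̇ x₀ ⇒
    ∀₂ (Function X₀ [ vertexᶠ x₀ ]² (Below x₀) ⇒
    ∃₂ (InducedCopy X₀ ∧̇ AtMostColorsOn ℓ X₁ X₀)))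

{-# OPTIONS --safe #-}
-- We build an ω-model of RCA₀ + RT²₂ containing a colouring f of the pairs of vertices
-- with k = ℓ + 1 colours such that every copy of the Rado graph in the model meets all of
-- them.
--
-- The colouring f is stable: f(x , y) tends to a limit colour P(x) as y grows, and P is
-- generic.  The cells of level L are the sets of vertices with the same adjacencies to
-- 0 , … , L − 1.  Genericity gives fairness: if W is an unbounded family of finite sets
-- enumerable from f, and m requests "meet colour cᵢ in one of the cells of rᵢ" are made,
-- each with enough cells, then some V in W answers all of them, since on distinct
-- representatives of the rᵢ the limit P is constant cᵢ on V.
--
-- Fairness (with respect to enumerability from an oracle) is preserved when a path
-- through a tree is added to the oracle (by compactness the sets listed along all paths
-- are collected into one) and when a homogeneous set is added: if both the sides of
-- colour 0 and of colour 1 violated fairness, by m₀ and by m₁ requests, the m₀ + m₁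
-- requests would be answered together, and a Seetapun disjunction would answer one of
-- the two groups on its own side.  Iterating yields the model.  A copy of the Rado graph
-- has infinitely many elements in arbitrarily many cells of one level, so it enumerates
-- an unbounded family to which fairness applies, and it meets every colour.
--
-- The metatheory is constructive: sets are arbitrary predicates, existence is proved
-- under ¬¬, and infinite constructions choose the successor with the least code.
module Submission where

open import Data.Bool using (Bool; true; false; T; not; if_then_else_)
open import Data.Bool.Properties using (T?; ¬-not) renaming (_≟_ to _≟ᵇ_)
open import Data.Empty using (⊥; ⊥-elim)
open import Data.Fin using (Fin; zero; suc; toℕ; lift; _↑ˡ_; _↑ʳ_)
open import Data.List using (List; []; _∷_; _++_; length; map; head; take; drop; concat; concatMap; upTo; applyUpTo; filter; replicate; tabulate)
open import Data.List.Membership.Propositional using (_∈_; _∉_; find; lose)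
open import Data.List.Membership.Propositional.Properties
open import Data.List.Properties using (≡-dec; length-applyUpTo; length-++; length-replicate; length-tabulate; length-take; length-upTo; take-[]; take-all; take-take)
open import Data.List.Relation.Binary.Pointwise using (Pointwise; []; _∷_; Pointwise-length)
open import Data.List.Relation.Unary.All as All using (All; []; _∷_)
import Data.List.Relation.Unary.All.Properties as All
open import Data.List.Relation.Unary.AllPairs as AllPairs using (AllPairs; []; _∷_)
open import Data.List.Relation.Unary.Any as Any using (Any; here; there)
open import Data.List.Relation.Unary.Unique.Propositional using (Unique)
import Data.List.Relation.Unary.Unique.Propositional.Properties as Unique
open import Data.Nat using (ℕ; zero; suc; _+_; _*_; _∸_; _≤_; _<_; z≤n; s≤s; _⊔_; _⊓_)
open import Data.Nat.Induction using (<-rec)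
open import Data.Nat.Properties
open import Data.List.Membership.DecPropositional _≟_ using (_∈?_)
open import Data.Product using (_×_; _,_; ∃-syntax; Σ-syntax; proj₁; proj₂)
open import Data.Sum using (_⊎_; inj₁; inj₂)
open import Data.Unit using (⊤; tt)
open import Data.Vec as Vec using (Vec; []; _∷_; lookup)
open import Data.Vec.Properties using (lookup-map)
open import Function using (_∘_; id; case_of_)
open import Relation.Binary using (tri<; tri≈; tri>)
open import Relation.Binary.PropositionalEquality using (_≡_; _≢_; refl; sym; trans; cong; cong₂; subst; subst₂)
open import Relation.Nullary using (¬_; Dec; yes; no; does; contradiction; decidable-stable; ¬¬-excluded-middle; ¬?)
open import Relation.Nullary.Decidable using (_×-dec_; _→-dec_; _⊎-dec_; map′; dec-true; dec-false)

-- The form of fairness is dictated by the homogeneous set, which is only known to exist on one of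
-- two sides. Refuting both sides must give failures that can be compared. The width N is therefore
-- fixed before the level L, and the level is demanded only cofinally often: an unfair side then
-- fails at all large levels, and two unfair sides fail at a common one, for the same N. Cofinally
-- many levels suffice in the end because a copy offers N cells at every large level. The failing
-- requests of the two sides add up, which is why arbitrarily many simultaneous requests are allowed
-- although a copy makes only one. Genericity can answer requests although the sets are listed from
-- the colouring itself: a finite part of the colouring decides what is listed, and it leaves the
-- limits of all vertices above a bound free. Stability then turns one vertex of limit colour c in a
-- copy into pairs of colour c, since the copy has later elements.

infixl 1 _>>=_

_>>=_ : ∀ {a b} {A : Set a} {B : Set b} → ¬ ¬ A → (A → ¬ ¬ B) → ¬ ¬ B
(m >>= f) k = m (λ a → f a k)

return : ∀ {a} {A : Set a} → A → ¬ ¬ A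
return a k = k a

em : ∀ {a} (A : Set a) → ¬ ¬ Dec A
em _ = ¬¬-excluded-middle

run : ¬ ¬ ⊥ → ⊥
run m = m id

∀<-¬¬ : (Q : ℕ → Set) (n : ℕ) → (∀ i → i < n → ¬ ¬ Q i) → ¬ ¬ (∀ i → i < n → Q i)
∀<-¬¬ Q zero    q = return λ _ ()
∀<-¬¬ Q (suc n) q = do
  below ← ∀<-¬¬ Q n (λ i i<n → q i (m≤n⇒m≤1+n i<n))
  top   ← q n ≤-refl
  return λ i i<1+n → case m≤n⇒m<n∨m≡n i<1+n of λ where
    (inj₁ (s≤s i<n)) → below i i<n
    (inj₂ refl)      → top

∀∈-¬¬ : ∀ {A : Set} (Q : A → Set) (xs : List A) → (∀ x → x ∈ xs → ¬ ¬ Q x) →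
        ¬ ¬ (∀ x → x ∈ xs → Q x)
∀∈-¬¬ Q []       q = return λ _ ()
∀∈-¬¬ Q (y ∷ xs) q = do
  head ← q y (here refl)
  tail ← ∀∈-¬¬ Q xs (λ x → q x ∘ there)
  return λ where
    _ (here refl) → head
    x (there x∈)  → tail x x∈

¬∀⇒∃¬ : ∀ {A : Set} {Q : A → Set} → ¬ (∀ x → Q x) → (∀ x → ¬ ¬ Q x → Q x) → ¬ ¬ (∃[ x ] ¬ Q x)
¬∀⇒∃¬ ¬all stable k = ¬all λ x → stable x λ ¬q → k (x , ¬q)

least : (Q : ℕ → Set) → ∀ n → Q n → ¬ ¬ (∃[ m ] Q m × (∀ j → Q j → m ≤ j))
least Q = <-rec _ λ n rec q → em (∃[ j ] j < n × Q j) >>= λ where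
  (yes (j , j<n , qj)) → rec j<n qj
  (no none)            → return (n , q , λ j qj → ≮⇒≥ (λ j<n → none (j , j<n , qj)))

-- Pairing and countable types.

-- s ² ≤ pair i j < (s + 1) ² for s = i + j, whence injectivity.

pair : ℕ → ℕ → ℕ
pair i j = (i + j) * (i + j) + i

private
  pair-sum-< : ∀ {a b c d} → a + b < c + d → pair a b < pair c d
  pair-sum-< {a} {b} {c} {d} lt = begin-strict
    (a + b) * (a + b) + a         ≤⟨ +-monoʳ-≤ ((a + b) * (a + b)) (m≤m+n a b) ⟩
    (a + b) * (a + b) + (a + b)   ≡⟨ +-comm ((a + b) * (a + b)) (a + b) ⟩
    suc (a + b) * (a + b)         <⟨ *-monoʳ-< (suc (a + b)) (n<1+n (a + b)) ⟩
    suc (a + b) * suc (a + b)     ≤⟨ *-mono-≤ lt lt ⟩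
    (c + d) * (c + d)             ≤⟨ m≤m+n _ c ⟩
    pair c d                      ∎
    where open ≤-Reasoning

pair-injective : ∀ {a b c d} → pair a b ≡ pair c d → a ≡ c × b ≡ d
pair-injective {a} {b} {c} {d} e with <-cmp (a + b) (c + d)
... | tri< lt _ _ = contradiction e (<⇒≢ (pair-sum-< {a} {b} {c} {d} lt))
... | tri> _ _ gt = contradiction (sym e) (<⇒≢ (pair-sum-< {c} {d} {a} {b} gt))
... | tri≈ _ s _  with +-cancelˡ-≡ ((a + b) * (a + b)) a c
                         (trans e (cong (λ r → r * r + c) (sym s)))
... | refl = refl , +-cancelˡ-≡ a b d s

pair-mono-≤ : ∀ {a b c d} → a ≤ c → b ≤ d → pair a b ≤ pair c d
pair-mono-≤ a≤c b≤d = +-mono-≤ (*-mono-≤ (+-mono-≤ a≤c b≤d) (+-mono-≤ a≤c b≤d)) a≤c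

private
  n≤n*n : ∀ n → n ≤ n * n
  n≤n*n zero    = z≤n
  n≤n*n (suc n) = m≤m*n (suc n) (suc n)

left≤pair : ∀ a b → a ≤ pair a b
left≤pair a b = m≤n+m a _

right≤pair : ∀ a b → b ≤ pair a b
right≤pair a b = ≤-trans (m≤n+m b a) (≤-trans (n≤n*n (a + b)) (m≤m+n _ a))

record Countable (A : Set) : Set where
  field
    code      : A → ℕ
    injective : ∀ {x y} → code x ≡ code y → x ≡ y

open Countable public

ℕ-countable : Countable ℕ
ℕ-countable = record { code = id ; injective = id }

Bool-countable : Countable Bool
Bool-countable = record { code = enc ; injective = λ {x} {y} → enc-inj x y }
  where
  enc : Bool → ℕ
  enc false = 0
  enc true  = 1
  enc-inj : ∀ x y → enc x ≡ enc y → x ≡ y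
  enc-inj false false _ = refl
  enc-inj true  true  _ = refl

infixr 2 _×-countable_
_×-countable_ : ∀ {A B} → Countable A → Countable B → Countable (A × B)
A ×-countable B = record
  { code      = λ (a , b) → pair (code A a) (code B b)
  ; injective = λ e → let (p , q) = pair-injective e in cong₂ _,_ (injective A p) (injective B q)
  }

List-countable : ∀ {A} → Countable A → Countable (List A)
List-countable {A} cA = record { code = enc ; injective = λ {x} {y} → enc-inj x y }
  where
  enc : List A → ℕ
  enc []       = 0
  enc (x ∷ xs) = suc (pair (code cA x) (enc xs))
  enc-inj : ∀ x y → enc x ≡ enc y → x ≡ y
  enc-inj []       []       _ = refl
  enc-inj (x ∷ xs) (y ∷ ys) e with pair-injective {code cA x} {enc xs} {code cA y} {enc ys} (suc-injective e)
  ... | p , q = cong₂ _∷_ (injective cA p) (enc-inj xs ys q)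

-- Dependent choice without choice: of all admissible successors take the one
-- with the least code, so that the sequence is a definable functional relation.
module Chain {D : Set} (cD : Countable D) (R : ℕ → D → D → Set) (d₀ : D) where

  Next : ℕ → D → D → Set
  Next n d d′ = R n d d′ × (∀ d″ → R n d d″ → code cD d′ ≤ code cD d″)

  Reached : ℕ → D → Set
  Reached zero    d  = d ≡ d₀
  Reached (suc n) d′ = ∃[ d ] Reached n d × Next n d d′

  reached-unique : ∀ n {d d′} → Reached n d → Reached n d′ → d ≡ d′
  reached-unique zero    p q = trans p (sym q)
  reached-unique (suc n) (d , r , p , min) (d′ , r′ , p′ , min′) with reached-unique n r r′
  ... | refl = injective cD (≤-antisym (min _ p′) (min′ _ p))

  module _ (_⊒_ : D → D → Set) (⊒-refl : ∀ {d} → d ⊒ d)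
           (⊒-trans : ∀ {d d′ d″} → d ⊒ d′ → d′ ⊒ d″ → d ⊒ d″)
           (step : ∀ {n d d′} → R n d d′ → d ⊒ d′) where

    private
      along-+ : ∀ i {m d d′} → Reached m d → Reached (i + m) d′ → d ⊒ d′
      along-+ zero    {m} r r′ with refl ← reached-unique m r r′ = ⊒-refl
      along-+ (suc i) r (_ , r′ , p , _) = ⊒-trans (along-+ i r r′) (step p)

    along : ∀ {m n d d′} → m ≤ n → Reached m d → Reached n d′ → d ⊒ d′
    along {m} {n} m≤n r r′ = along-+ (n ∸ m) r (subst (λ l → Reached l _) (sym (m∸n+n≡m m≤n)) r′)

  module _ (Inv : D → Set) (start : Inv d₀)
           (total : ∀ n d → Inv d → ¬ ¬ (∃[ d′ ] R n d d′))
           (preserve : ∀ {n d d′} → Inv d → R n d d′ → Inv d′) where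

    reached-step : ∀ n d → Inv d → ¬ ¬ (∃[ d′ ] Next n d d′)
    reached-step n d inv = do
      d′ , r ← total n d inv
      _ , (e , eq , r′) , min ← least (λ c → ∃[ e ] code cD e ≡ c × R n d e) _ (d′ , refl , r)
      return (e , r′ , λ f rf → subst (_≤ code cD f) (sym eq) (min _ (f , refl , rf)))

    reached-invariant : ∀ n {d} → Reached n d → Inv d
    reached-invariant zero    refl            = start
    reached-invariant (suc n) (_ , r , p , _) = preserve (reached-invariant n r) p

    reached-total : ∀ n → ¬ ¬ (∃[ d ] Reached n d)
    reached-total zero    = return (d₀ , refl)
    reached-total (suc n) = do
      d , r  ← reached-total n
      d′ , p ← reached-step n d (reached-invariant n r)
      return (d′ , d , r , p)

-- Bit strings as initial segments of sets.

Str : Set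
Str = List Bool

Pred₀ : Set₁
Pred₀ = ℕ → Set

World : Set₁
World = List Pred₀

_≟ˢ_ : (s t : Str) → Dec (s ≡ t)
_≟ˢ_ = ≡-dec _≟ᵇ_

bit : Str → ℕ → Bool
bit []      _       = false
bit (b ∷ s) zero    = b
bit (b ∷ s) (suc i) = bit s i

bit-take : ∀ {v i} s → i < v → bit (take v s) i ≡ bit s i
bit-take {suc v} {i}     []      _         = refl
bit-take {suc v} {zero}  (b ∷ s) _         = refl
bit-take {suc v} {suc i} (b ∷ s) (s≤s i<v) = bit-take s i<v

bit-++ˡ : ∀ {i} s {t} → i < length s → bit (s ++ t) i ≡ bit s i
bit-++ˡ {zero}  (b ∷ s) _         = refl
bit-++ˡ {suc i} (b ∷ s) (s≤s i<) = bit-++ˡ s i<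

bit-++ʳ : ∀ s {t} i → bit (s ++ t) (length s + i) ≡ bit t i
bit-++ʳ []      i = refl
bit-++ʳ (b ∷ s) i = bit-++ʳ s i

bit-beyond : ∀ s {i} → length s ≤ i → bit s i ≡ false
bit-beyond []      _               = refl
bit-beyond (b ∷ s) {suc i} (s≤s l) = bit-beyond s l

str-ext : ∀ s t → length s ≡ length t → (∀ i → i < length s → bit s i ≡ bit t i) → s ≡ t
str-ext []      []      _ _ = refl
str-ext (b ∷ s) (c ∷ t) l e =
  cong₂ _∷_ (e 0 (s≤s z≤n)) (str-ext s t (suc-injective l) (λ i i< → e (suc i) (s≤s i<)))

length-take-≤ : ∀ {A : Set} {v} (s : List A) → v ≤ length s → length (take v s) ≡ v
length-take-≤ {v = v} s v≤ = trans (length-take v s) (m≤n⇒m⊓n≡m v≤)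

take-take-≤ : ∀ {A : Set} {v w} (s : List A) → v ≤ w → take v (take w s) ≡ take v s
take-take-≤ {v = v} {w} s v≤w = trans (take-take v w s) (cong (λ r → take r s) (m≤n⇒m⊓n≡m v≤w))

take-++ : ∀ {A : Set} (s : List A) {t} → take (length s) (s ++ t) ≡ s
take-++ []      = refl
take-++ (b ∷ s) = cong (b ∷_) (take-++ s)

length-snoc : ∀ {A : Set} (s : List A) {a} → length (s ++ a ∷ []) ≡ suc (length s)
length-snoc s = trans (length-++ s) (+-comm (length s) 1)

bit-snoc : ∀ s {b} → bit (s ++ b ∷ []) (length s) ≡ b
bit-snoc s {b} = trans (cong (bit (s ++ b ∷ [])) (sym (+-identityʳ (length s)))) (bit-++ʳ s 0)

strings : ℕ → List Str
strings zero    = [] ∷ []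
strings (suc n) = map (true ∷_) (strings n) ++ map (false ∷_) (strings n)

∈-strings : ∀ s → s ∈ strings (length s)
∈-strings []          = here refl
∈-strings (true ∷ s)  = ∈-++⁺ˡ (∈-map⁺ (true ∷_) (∈-strings s))
∈-strings (false ∷ s) = ∈-++⁺ʳ (map (true ∷_) (strings (length s))) (∈-map⁺ (false ∷_) (∈-strings s))

strings-length : ∀ n {s} → s ∈ strings n → length s ≡ n
strings-length zero    (here refl) = refl
strings-length (suc n) s∈ with ∈-++⁻ (map (true ∷_) (strings n)) s∈
... | inj₁ p with _ , q , refl ← ∈-map⁻ (true ∷_) p  = cong suc (strings-length n q)
... | inj₂ p with _ , q , refl ← ∈-map⁻ (false ∷_) p = cong suc (strings-length n q)

-- A bit can describe membership in an arbitrary predicate only up to double negation; both cases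
-- are stable, so agreement hides no further double negation.
Agrees : Bool → Set → Set
Agrees true  A = ¬ ¬ A
Agrees false A = ¬ A

agrees-exists : ∀ A → ¬ ¬ (∃[ b ] Agrees b A)
agrees-exists A = em A >>= λ where
  (yes a) → return (true , return a)
  (no ¬a) → return (false , ¬a)

agrees-unique : ∀ b c {A} → Agrees b A → Agrees c A → b ≡ c
agrees-unique true  true  _ _ = refl
agrees-unique false false _ _ = refl
agrees-unique true  false p q = ⊥-elim (p q)
agrees-unique false true  p q = ⊥-elim (q p)

agrees-stable : ∀ b {A} → ¬ ¬ Agrees b A → Agrees b A
agrees-stable true  p k = p λ q → q k
agrees-stable false p a = p λ q → q a

agrees? : ∀ b {A} → Dec A → Dec (Agrees b A)
agrees? true  (yes a) = yes (return a)
agrees? true  (no ¬a) = no λ k → k ¬a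
agrees? false a?      = ¬? a?

agrees-T : ∀ b → Agrees b (T b)
agrees-T true  k = k tt
agrees-T false ()

agrees-to-T : ∀ b c {A} → Agrees c A → Agrees b A → Agrees b (T c)
agrees-to-T b c p q with agrees-unique b c q p
... | refl = agrees-T b

agrees-from-T : ∀ b c {A} → Agrees c A → Agrees b (T c) → Agrees b A
agrees-from-T b c p q with agrees-unique b c q (agrees-T c)
... | refl = p

agrees-resp : ∀ b {A B} → (A → ¬ ¬ B) → (B → ¬ ¬ A) → Agrees b A → Agrees b B
agrees-resp true  f g p = p >>= f
agrees-resp false f g p = λ b → g b p

infix 4 _≺_
_≺_ : Str → Pred₀ → Set
s ≺ X = ∀ i → i < length s → Agrees (bit s i) (X i)

≺-exists : ∀ X u → ¬ ¬ (∃[ s ] length s ≡ u × s ≺ X)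
≺-exists X zero    = return ([] , refl , λ _ ())
≺-exists X (suc u) = do
  s , l , p ← ≺-exists (X ∘ suc) u
  b , q     ← agrees-exists (X 0)
  return (b ∷ s , cong suc l , λ { zero _ → q ; (suc i) (s≤s i<) → p i i< })

≺-unique : ∀ {s t X} → length s ≡ length t → s ≺ X → t ≺ X → s ≡ t
≺-unique {s} {t} l p q = str-ext s t l λ i i< →
  agrees-unique (bit s i) (bit t i) (p i i<) (q i (subst (i <_) l i<))

≺-take : ∀ {s X} v → s ≺ X → take v s ≺ X
≺-take {s} {X} v p i i< = subst (λ b → Agrees b (X i)) (sym (bit-take s i<v)) (p i i<s)
  where
  lt : i < v ⊓ length s
  lt  = subst (i <_) (length-take v s) i<
  i<v : i < v
  i<v = ≤-trans lt (m⊓n≤m v (length s))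
  i<s : i < length s
  i<s = ≤-trans lt (m⊓n≤n v (length s))

infix 4 _⊑_
_⊑_ : ∀ {A : Set} → List A → List A → Set
s ⊑ t = take (length s) t ≡ s

⊑-refl : ∀ {A : Set} {s : List A} → s ⊑ s
⊑-refl {s = s} = take-all (length s) s ≤-refl

⊑-snoc : ∀ {A : Set} {s s′ : List A} {c} → s′ ≡ s ++ c ∷ [] → s ⊑ s′
⊑-snoc {s = s} refl = take-++ s

⊑-length : ∀ {A : Set} {s t : List A} → s ⊑ t → length s ≤ length t
⊑-length {s = s} {t} e = subst (_≤ length t) (trans (sym (length-take (length s) t)) (cong length e))
                       (m⊓n≤n (length s) (length t))

⊑-trans : ∀ {A : Set} {s t u : List A} → s ⊑ t → t ⊑ u → s ⊑ u
⊑-trans {s = s} {t} {u} e e′ = trans (sym (take-take-≤ u (⊑-length e))) (trans (cong (take (length s)) e′) e)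

⊑-bit : ∀ {s t i} → s ⊑ t → i < length s → bit s i ≡ bit t i
⊑-bit {s} {t} {i} e i< = trans (cong (λ r → bit r i) (sym e)) (bit-take t i<)

≺-⊑ : ∀ {s t X} → s ≺ X → t ≺ X → length s ≤ length t → s ⊑ t
≺-⊑ {s} {t} p q le = ≺-unique (length-take-≤ t le) (≺-take (length s) q) p

module Limit {D : Set} (cD : Countable D) (R : ℕ → D → D → Set) (d₀ : D) (str : D → Str)
             (grow : ∀ n d d′ → R n d d′ → str d ⊑ str d′) where
  open Chain cD R d₀

  limit : Pred₀
  limit i = ∃[ n ] ∃[ d ] Reached n d × i < length (str d) × T (bit (str d) i)

  reached-⊑ : ∀ {m n d d′} → m ≤ n → Reached m d → Reached n d′ → str d ⊑ str d′
  reached-⊑ = along (λ d d′ → str d ⊑ str d′) ⊑-refl ⊑-trans (λ {n} {d} {d′} → grow n d d′)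

  private
    same-bit : ∀ {m n d d′ i} → Reached m d → Reached n d′ →
               i < length (str d) → i < length (str d′) → bit (str d) i ≡ bit (str d′) i
    same-bit {m} {n} r r′ i< i<′ with ≤-total m n
    ... | inj₁ le = ⊑-bit (reached-⊑ le r r′) i<
    ... | inj₂ le = sym (⊑-bit (reached-⊑ le r′ r) i<′)

  -- A one is in the limit by definition; a zero is final because any two reached strings are
  -- comparable.
  reached-≺ : ∀ n {d} → Reached n d → str d ≺ limit
  reached-≺ n {d} r i i< with bit (str d) i in eq
  ... | true  = return (n , d , r , i< , subst T (sym eq) tt)
  ... | false = λ (n′ , _ , r′ , i<′ , t) → subst T (trans (sym (same-bit r r′ i< i<′)) eq) t

-- Finite approximations to a world of sets.

Approx : ℕ → List Str → World → Set
Approx u []      []      = ⊤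
Approx u (s ∷ z) (X ∷ Z) = (length s ≡ u × s ≺ X) × Approx u z Z
Approx u _       _       = ⊥

approx-exists : ∀ Z u → ¬ ¬ (∃[ z ] Approx u z Z)
approx-exists []      u = return ([] , tt)
approx-exists (X ∷ Z) u = do
  z , a     ← approx-exists Z u
  s , l , p ← ≺-exists X u
  return (s ∷ z , (l , p) , a)

-- Approximations exist only under double negation; uniqueness lets those obtained in different
-- places be identified.
approx-unique : ∀ {u} z z′ Z → Approx u z Z → Approx u z′ Z → z ≡ z′
approx-unique []      []        []      _ _ = refl
approx-unique (s ∷ z) (s′ ∷ z′) (X ∷ Z) ((l , p) , a) ((l′ , p′) , a′) =
  cong₂ _∷_ (≺-unique (trans l (sym l′)) p p′) (approx-unique z z′ Z a a′)

trunc : ℕ → List Str → List Str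
trunc v = map (take v)

approx-trunc : ∀ {u v} z Z → v ≤ u → Approx u z Z → Approx v (trunc v z) Z
approx-trunc []      []      v≤u a = tt
approx-trunc {v = v} (s ∷ z) (X ∷ Z) v≤u ((refl , p) , a) =
  (length-take-≤ s v≤u , ≺-take v p) , approx-trunc z Z v≤u a

trunc-trunc : ∀ {v w} z → v ≤ w → trunc v (trunc w z) ≡ trunc v z
trunc-trunc []      _   = refl
trunc-trunc (s ∷ z) v≤w = cong₂ _∷_ (take-take-≤ s v≤w) (trunc-trunc z v≤w)

trunc-id : ∀ {u} z Z → Approx u z Z → trunc u z ≡ z
trunc-id z Z a = approx-unique _ z Z (approx-trunc z Z ≤-refl a) a

-- Columns are counted from the bottom of a world, so that an index keeps its
-- meaning when new columns are put on top.
col : World → ℕ → Pred₀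
col []      i = λ _ → ⊥
col (X ∷ Z) i = if does (i ≟ length Z) then X else col Z i

col-cons : ∀ X Z {i} → i < length Z → col (X ∷ Z) i ≡ col Z i
col-cons X Z {i} i< = cong (λ b → if b then X else col Z i) (dec-false (i ≟ length Z) (<⇒≢ i<))

-- Strings padded with zeros: relations on worlds become decidable there, and the answer is the true
-- one as long as only positions below the length are consulted.
⟪_⟫ : List Str → World
⟪_⟫ = map (λ s i → T (bit s i))

col? : ∀ z j i → Dec (col ⟪ z ⟫ j i)
col? []      j i = no λ ()
col? (s ∷ z) j i with does (j ≟ length ⟪ z ⟫)
... | true  = T? (bit s i)
... | false = col? z j i

approx-length : ∀ {u} z Z → Approx u z Z → length ⟪ z ⟫ ≡ length Z
approx-length []      []      _       = refl
approx-length (s ∷ z) (X ∷ Z) (_ , a) = cong suc (approx-length z Z a)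

col-bit : ∀ {u i} z Z j → Approx u z Z → i < u →
          ∃[ c ] col ⟪ z ⟫ j i ≡ T c × Agrees c (col Z j i)
col-bit []      []      j a             i<u = false , refl , λ ()
col-bit {i = i} (s ∷ z) (X ∷ Z) j ((refl , p) , a) i<u
  rewrite approx-length z Z a with does (j ≟ length Z)
... | true  = bit s i , refl , p i i<u
... | false = col-bit z Z j a i<u

module _ {u i : ℕ} (b : Bool) (z : List Str) (Z : World) (j : ℕ) (a : Approx u z Z) (i<u : i < u) where

  col-agrees-to : Agrees b (col Z j i) → Agrees b (col ⟪ z ⟫ j i)
  col-agrees-to p with c , e , q ← col-bit z Z j a i<u =
    subst (Agrees b) (sym e) (agrees-to-T b c q p)

  col-agrees-from : Agrees b (col ⟪ z ⟫ j i) → Agrees b (col Z j i)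
  col-agrees-from p with c , e , q ← col-bit z Z j a i<u =
    agrees-from-T b c q (subst (Agrees b) e p)

-- Mathias forcing towards homogeneous sets.

-- A set j of numbers is read as the 2-colouring x , y ↦ [ ⟨ ⟨ x , y ⟩ , 1 ⟩ ∈ j ].
colour : World → ℕ → ℕ → ℕ → Set
colour Z j x y = col Z j (pair (pair x y) 1)

-- The top columns are the splittings added so far; each bit says which half of its column the
-- reservoir keeps.
InSides : Str → World → ℕ → Set
InSides []       Z       y = ⊤
InSides (b ∷ bs) []      y = ⊥
InSides (b ∷ bs) (X ∷ Z) y = Agrees b (X y) × InSides bs Z y

inSides? : ∀ bs z y → Dec (InSides bs ⟪ z ⟫ y)
inSides? []       z       y = yes tt
inSides? (b ∷ bs) []      y = no λ ()
inSides? (b ∷ bs) (s ∷ z) y = agrees? b (T? (bit s y)) ×-dec inSides? bs z y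

-- With `σ` a segment of the limit colours, a reservoir point already has the limit colour with
-- every smaller x recorded in `σ`, so it can join either of the two finite homogeneous sets.
InReservoir : World → Str → Str → ℕ → ℕ → Set
InReservoir Z sides σ j y =
  (∀ {x} → x < length σ → Agrees (bit σ x) (colour Z j x y)) × InSides sides Z y

-- A step of Mathias forcing, from g₀ to g, towards a homogeneous set of colour b.
record Extension (Z : World) (sides σ : Str) (j : ℕ) (b : Bool) (g₀ g : Str) : Set where
  constructor extension
  field
    prefix : g₀ ⊑ g
    inside : ∀ {y} → y < length g → length g₀ ≤ y → T (bit g y) → InReservoir Z sides σ j y
    homog  : ∀ {y} → y < length g → ∀ {x} → x < y → T (bit g x) → T (bit g y) →
             Agrees b (colour Z j x y)

extension? : ∀ z sides σ j b g₀ g → Dec (Extension ⟪ z ⟫ sides σ j b g₀ g)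
extension? z sides σ j b g₀ g =
  map′ (λ (p , q , r) → extension p (λ {y} → q {y}) λ {y} y< {x} → r {y} y< {x}) (λ (extension p q r) → p , (λ {y} → q {y}) , λ {y} y< {x} → r {y} y< {x})
    (take (length g₀) g ≟ˢ g₀
     ×-dec allUpTo? (λ y → length g₀ ≤? y →-dec T? (bit g y) →-dec
             (allUpTo? (λ x → agrees? (bit σ x) (col? z j _)) (length σ) ×-dec inSides? sides z y))
             (length g)
     ×-dec allUpTo? (λ y → allUpTo? (λ x → T? (bit g x) →-dec T? (bit g y) →-dec
             agrees? b (col? z j _)) y) (length g))

-- An oracle length covering every colour query made while checking an extension of length `v`.
queries : ℕ → ℕ
queries v = suc (pair (pair v v) 1)

query-< : ∀ {x y v} → x ≤ v → y < v → pair (pair x y) 1 < queries v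
query-< x≤v y<v = s≤s (pair-mono-≤ (pair-mono-≤ x≤v (<⇒≤ y<v)) ≤-refl)

≤queries : ∀ v → v ≤ queries v
≤queries v = m≤n⇒m≤1+n (≤-trans (left≤pair v v) (left≤pair (pair v v) 1))

inSides-to : ∀ {u y} bs z Z → Approx u z Z → y < u → InSides bs Z y → InSides bs ⟪ z ⟫ y
inSides-to []       z       Z       a y<u i = tt
inSides-to {y = y} (b ∷ bs) (s ∷ z) (X ∷ Z) ((refl , p) , a) y<u (q , i) =
  agrees-to-T b (bit s y) (p y y<u) q , inSides-to bs z Z a y<u i

inSides-from : ∀ {u y} bs z Z → Approx u z Z → y < u → InSides bs ⟪ z ⟫ y → InSides bs Z y
inSides-from []       z       Z       a y<u i = tt
inSides-from {y = y} (b ∷ bs) (s ∷ z) (X ∷ Z) ((refl , p) , a) y<u (q , i) =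
  agrees-from-T b (bit s y) (p y y<u) q , inSides-from bs z Z a y<u i

module _ {u : ℕ} {z : List Str} {Z : World} {sides σ : Str} {j : ℕ} {b : Bool} {g₀ g : Str}
         (a : Approx u z Z) (σ≤g : length σ ≤ length g) (enough : queries (length g) ≤ u) where

  private
    y<u : ∀ {y} → y < length g → y < u
    y<u y< = ≤-trans y< (≤-trans (≤queries _) enough)
    q<u : ∀ {x y} → x ≤ length g → y < length g → pair (pair x y) 1 < u
    q<u x≤ y< = ≤-trans (query-< x≤ y<) enough

  extension-to : Extension Z sides σ j b g₀ g → Extension ⟪ z ⟫ sides σ j b g₀ g
  extension-to (extension p q r) = extension p
    (λ y< l t → let (q₁ , q₂) = q y< l t in
      (λ {x} x< → col-agrees-to (bit σ x) z Z j a (q<u (≤-trans (<⇒≤ x<) σ≤g) y<) (q₁ x<)) ,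
      inSides-to sides z Z a (y<u y<) q₂)
    (λ y< {x} x< s t → col-agrees-to b z Z j a (q<u (<⇒≤ (<-trans x< y<)) y<) (r y< x< s t))

  extension-from : Extension ⟪ z ⟫ sides σ j b g₀ g → Extension Z sides σ j b g₀ g
  extension-from (extension p q r) = extension p
    (λ y< l t → let (q₁ , q₂) = q y< l t in
      (λ {x} x< → col-agrees-from (bit σ x) z Z j a (q<u (≤-trans (<⇒≤ x<) σ≤g) y<) (q₁ x<)) ,
      inSides-from sides z Z a (y<u y<) q₂)
    (λ y< {x} x< s t → col-agrees-from b z Z j a (q<u (<⇒≤ (<-trans x< y<)) y<) (r y< x< s t))

-- Enumeration operators.

module Operators (cell : ℕ → ℕ → Str) where

  data Tm : Set where
    v# c#   : ℕ → Tm
    _⊕_ _⊗_ : Tm → Tm → Tm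

  -- Only negative connectives, so that truth is stable in every world; the other bounded
  -- connectives are expressed through them classically.
  data BF : Set where
    _=ᵇ_ _<ᵇ_ : Tm → Tm → BF
    _∈ᵇ_      : Tm → ℕ → BF
    ⊥ᵇ        : BF
    _⇒ᵇ_      : BF → BF → BF
    ∀ᵇ        : Tm → BF → BF

  nth : List ℕ → ℕ → ℕ
  nth []      _       = 0
  nth (a ∷ s) zero    = a
  nth (a ∷ s) (suc i) = nth s i

  ⟦_⟧ₜ : Tm → List ℕ → ℕ
  ⟦ v# i ⟧ₜ  ρ = nth ρ i
  ⟦ c# k ⟧ₜ  ρ = k
  ⟦ t ⊕ u ⟧ₜ ρ = ⟦ t ⟧ₜ ρ + ⟦ u ⟧ₜ ρ
  ⟦ t ⊗ u ⟧ₜ ρ = ⟦ t ⟧ₜ ρ * ⟦ u ⟧ₜ ρ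

  ⟦_⟧ᵇ : BF → List ℕ → World → Set
  ⟦ t =ᵇ u ⟧ᵇ ρ Z = ⟦ t ⟧ₜ ρ ≡ ⟦ u ⟧ₜ ρ
  ⟦ t <ᵇ u ⟧ᵇ ρ Z = ⟦ t ⟧ₜ ρ < ⟦ u ⟧ₜ ρ
  ⟦ t ∈ᵇ j ⟧ᵇ ρ Z = Agrees true (col Z j (⟦ t ⟧ₜ ρ))
  ⟦ ⊥ᵇ ⟧ᵇ     ρ Z = ⊥
  ⟦ φ ⇒ᵇ ψ ⟧ᵇ ρ Z = ⟦ φ ⟧ᵇ ρ Z → ⟦ ψ ⟧ᵇ ρ Z
  ⟦ ∀ᵇ t φ ⟧ᵇ ρ Z = ∀ {x} → x < ⟦ t ⟧ₜ ρ → ⟦ φ ⟧ᵇ (x ∷ ρ) Z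

  ⟦_⟧ᵇ? : ∀ φ ρ z → Dec (⟦ φ ⟧ᵇ ρ ⟪ z ⟫)
  ⟦ t =ᵇ u ⟧ᵇ? ρ z = ⟦ t ⟧ₜ ρ ≟ ⟦ u ⟧ₜ ρ
  ⟦ t <ᵇ u ⟧ᵇ? ρ z = ⟦ t ⟧ₜ ρ <? ⟦ u ⟧ₜ ρ
  ⟦ t ∈ᵇ j ⟧ᵇ? ρ z = agrees? true (col? z j _)
  ⟦ ⊥ᵇ ⟧ᵇ?     ρ z = no λ ()
  ⟦ φ ⇒ᵇ ψ ⟧ᵇ? ρ z = ⟦ φ ⟧ᵇ? ρ z →-dec ⟦ ψ ⟧ᵇ? ρ z
  ⟦ ∀ᵇ t φ ⟧ᵇ? ρ z = allUpTo? (λ x → ⟦ φ ⟧ᵇ? (x ∷ ρ) z) (⟦ t ⟧ₜ ρ)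

  maxUpTo : ℕ → (ℕ → ℕ) → ℕ
  maxUpTo zero    f = 0
  maxUpTo (suc n) f = f n ⊔ maxUpTo n f

  ≤maxUpTo : ∀ n f {i} → i < n → f i ≤ maxUpTo n f
  ≤maxUpTo (suc n) f i<1+n with m≤n⇒m<n∨m≡n i<1+n
  ... | inj₁ (s≤s i<n) = ≤-trans (≤maxUpTo n f i<n) (m≤n⊔m (f n) _)
  ... | inj₂ refl      = m≤m⊔n (f n) _

  use : BF → List ℕ → ℕ
  use (t =ᵇ u) ρ = 0
  use (t <ᵇ u) ρ = 0
  use (t ∈ᵇ j) ρ = suc (⟦ t ⟧ₜ ρ)
  use ⊥ᵇ       ρ = 0
  use (φ ⇒ᵇ ψ) ρ = use φ ρ ⊔ use ψ ρ
  use (∀ᵇ t φ) ρ = maxUpTo (⟦ t ⟧ₜ ρ) (λ x → use φ (x ∷ ρ))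

  module _ {u : ℕ} {z : List Str} {Z : World} (a : Approx u z Z) where

    ⟦⟧ᵇ-to   : ∀ φ ρ → use φ ρ ≤ u → ⟦ φ ⟧ᵇ ρ Z → ⟦ φ ⟧ᵇ ρ ⟪ z ⟫
    ⟦⟧ᵇ-from : ∀ φ ρ → use φ ρ ≤ u → ⟦ φ ⟧ᵇ ρ ⟪ z ⟫ → ⟦ φ ⟧ᵇ ρ Z

    ⟦⟧ᵇ-to (t =ᵇ t′) ρ le p = p
    ⟦⟧ᵇ-to (t <ᵇ t′) ρ le p = p
    ⟦⟧ᵇ-to (t ∈ᵇ j)  ρ le p = col-agrees-to true z Z j a le p
    ⟦⟧ᵇ-to (φ ⇒ᵇ ψ)  ρ le p = λ q →
      ⟦⟧ᵇ-to ψ ρ (m⊔n≤o⇒n≤o (use φ ρ) _ le) (p (⟦⟧ᵇ-from φ ρ (m⊔n≤o⇒m≤o _ _ le) q))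
    ⟦⟧ᵇ-to (∀ᵇ t φ)  ρ le p = λ x< →
      ⟦⟧ᵇ-to φ _ (≤-trans (≤maxUpTo _ (λ x → use φ (x ∷ ρ)) x<) le) (p x<)

    ⟦⟧ᵇ-from (t =ᵇ t′) ρ le p = p
    ⟦⟧ᵇ-from (t <ᵇ t′) ρ le p = p
    ⟦⟧ᵇ-from (t ∈ᵇ j)  ρ le p = col-agrees-from true z Z j a le p
    ⟦⟧ᵇ-from (φ ⇒ᵇ ψ)  ρ le p = λ q →
      ⟦⟧ᵇ-from ψ ρ (m⊔n≤o⇒n≤o (use φ ρ) _ le) (p (⟦⟧ᵇ-to φ ρ (m⊔n≤o⇒m≤o _ _ le) q))
    ⟦⟧ᵇ-from (∀ᵇ t φ)  ρ le p = λ x< →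
      ⟦⟧ᵇ-from φ _ (≤-trans (≤maxUpTo _ (λ x → use φ (x ∷ ρ)) x<) le) (p x<)

  -- A countable class of enumeration operators: from the first u bits of every
  -- column of the oracle, list some finite sets.  It has to contain the operators
  -- met in the proof and to be closed under the ones derived from them.
  data Op : Set where
    none    : Op
    hit     : (j L : ℕ) (row : List Str) → Op
    beyond  : ℕ → Op
    or      : Op → Op → Op
    big     : Op → ℕ → Op
    compact : Op → Op → Str → Op
    seetapun : (sides : Str) (j : ℕ) (σ g₀ g₁ : Str) → Op → Op → Op
    delta   : BF → BF → List ℕ → Op → Op

  Operator : Set
  Operator = ℕ → List Str → List (List ℕ)

  Above : ℕ → List ℕ → Set
  Above x = All (x <_)

  above? : ∀ x V → Dec (Above x V)
  above? x = All.all? (x <?_)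

  -- An operator may list different sets at different stages; collecting the earlier stages makes
  -- the listing monotone, so that a string once off a tree stays off it.
  upto : Operator → Operator
  upto e u z = concatMap (λ v → e v (trunc v z)) (upTo (suc u))

  pick : ∀ {a} {A : Set a} → Bool → A → A → A
  pick false x y = x
  pick true  x y = y

  -- The family that a copy enumerates: elements of column `j` above `x`, listed together once they
  -- meet every cell of `row`.
  module Hit (j L : ℕ) (row : List Str) (u : ℕ) (z : List Str) where
    members : ℕ → List ℕ
    members x = filter (λ v → x <? v ×-dec col? z j v) (upTo u)
    Meets : ℕ → Set
    Meets x = All (λ τ → Any (λ v → cell L v ≡ τ) (members x)) row
    meets? : ∀ x → Dec (Meets x)
    meets? x = All.all? (λ τ → Any.any? (λ v → cell L v ≟ˢ τ) (members x)) row

  -- Along each branch either `c` lists something, which puts the branch off the tree, or `w` lists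
  -- a set above `x`. The union of the latter sets serves all paths at once.
  module Compact (c w : Operator) (b : Str) (u : ℕ) (z : List Str) where
    hits : ℕ → Str → List (List ℕ)
    hits x t = filter (above? x) (upto w u (t ∷ z))
    branches : List Str
    -- Truncating both strings expresses comparability of `t` and `b`, also while `u` is below the
    -- length of `b`.
    branches = filter (λ t → take (length b) t ≟ˢ take u b) (strings u)
    Covered : ℕ → Set
    Covered x = All (λ t → 0 < length (upto c u (t ∷ z) ++ hits x t)) branches
    covered? : ∀ x → Dec (Covered x)
    covered? x = All.all? (λ t → 0 <? length (upto c u (t ∷ z) ++ hits x t)) branches
    union : ℕ → List ℕ
    union x = concat (concatMap (hits x) branches)

  module Seetapun (sides : Str) (j : ℕ) (σ : Str) (u : ℕ) (z : List Str) where
    side : Bool → Str → Operator → ℕ → List (List ℕ)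
    -- The first column of `z` is a candidate splitting and the next ones define the reservoir. They
    -- take part in testing `g`, but `w` is run on `g` over the base world.
    side b g₀ w v = concatMap (λ g → upto w v (g ∷ trunc v (drop (suc (length sides)) z)))
                              (filter (extension? z (b ∷ sides) σ j b g₀) (strings v))

  -- A number is decided once stage `u` shows a witness for the Σ form or a refutation of the Π
  -- form. Only a fully decided segment is handed on as oracle, so it is never wrong.
  module Delta (θ θ′ : BF) (ρ : List ℕ) (u : ℕ) (z : List Str) where
    Yes No : ℕ → Set
    Yes x = ∃[ y ] y < u × use θ (y ∷ x ∷ ρ) ≤ u × ⟦ θ ⟧ᵇ (y ∷ x ∷ ρ) ⟪ z ⟫
    No x  = ∃[ y ] y < u × use θ′ (y ∷ x ∷ ρ) ≤ u × ¬ ⟦ θ′ ⟧ᵇ (y ∷ x ∷ ρ) ⟪ z ⟫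
    yes? : ∀ x → Dec (Yes x)
    yes? x = anyUpTo? (λ y → (use θ (y ∷ x ∷ ρ) ≤? u) ×-dec ⟦ θ ⟧ᵇ? _ z) u
    no? : ∀ x → Dec (No x)
    no? x = anyUpTo? (λ y → (use θ′ (y ∷ x ∷ ρ) ≤? u) ×-dec ¬? (⟦ θ′ ⟧ᵇ? _ z)) u
    Decided : ℕ → Set
    Decided v = ∀ {x} → x < v → Yes x ⊎ No x
    decided? : ∀ v → Dec (Decided v)
    decided? v = allUpTo? (λ x → yes? x ⊎-dec no? x) v
    guess : ℕ → Str
    guess v = applyUpTo (λ x → does (yes? x)) v

  eval : Op → Operator
  eval none           u z = []
  eval (hit j L row)  u z = map members (filter meets? (upTo u))
    where open Hit j L row u z
  eval (beyond b)     u []      = []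
  eval (beyond b)     u (s ∷ z) = map (λ _ → []) (filter (λ i → b ≤? i ×-dec T? (bit s i)) (upTo u))
  eval (or C D)       u z = eval C u z ++ eval D u z
  eval (big W x)      u z = filter (above? x) (eval W u z)
  eval (compact C W b) u z = map union (filter covered? (upTo u))
    where open Compact (eval C) (eval W) b u z
  eval (seetapun sides j σ g₀ g₁ W₀ W₁) u z =
    concatMap (λ v → side false g₀ (eval W₀) v ++ side true g₁ (eval W₁) v)
              (filter (λ v → queries v ≤? u) (upTo (suc u)))
    where open Seetapun sides j σ u z
  eval (delta θ θ′ ρ W) u z =
    concatMap (λ v → eval W v (guess v ∷ trunc v z)) (filter decided? (upTo (suc u)))
    where open Delta θ θ′ ρ u z

  -- Injective codes for operators.

  private
    tmTag tmLoad tmCode : Tm → ℕ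
    tmTag (v# _)  = 0
    tmTag (c# _)  = 1
    tmTag (_ ⊕ _) = 2
    tmTag (_ ⊗ _) = 3
    tmLoad (v# i)  = i
    tmLoad (c# k)  = k
    tmLoad (t ⊕ u) = pair (tmCode t) (tmCode u)
    tmLoad (t ⊗ u) = pair (tmCode t) (tmCode u)
    tmCode t = pair (tmTag t) (tmLoad t)

    -- Equal tags exclude clashing constructors, so that only the diagonal cases remain.
    tm-injective : ∀ t u → tmTag t ≡ tmTag u → tmLoad t ≡ tmLoad u → t ≡ u
    tm-code-inj  : ∀ t u → tmCode t ≡ tmCode u → t ≡ u
    tm-injective (v# i)  (v# j)    refl refl = refl
    tm-injective (c# i)  (c# j)    refl refl = refl
    tm-injective (t ⊕ u) (t′ ⊕ u′) refl e with p , q ← pair-injective {tmCode t} {tmCode u} e =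
      cong₂ _⊕_ (tm-code-inj t t′ p) (tm-code-inj u u′ q)
    tm-injective (t ⊗ u) (t′ ⊗ u′) refl e with p , q ← pair-injective {tmCode t} {tmCode u} e =
      cong₂ _⊗_ (tm-code-inj t t′ p) (tm-code-inj u u′ q)
    tm-code-inj t u e with p , q ← pair-injective {tmTag t} {tmLoad t} e = tm-injective t u p q

  private
    bfTag bfLoad bfCode : BF → ℕ
    bfTag (_ =ᵇ _) = 0
    bfTag (_ <ᵇ _) = 1
    bfTag (_ ∈ᵇ _) = 2
    bfTag ⊥ᵇ       = 3
    bfTag (_ ⇒ᵇ _) = 4
    bfTag (∀ᵇ _ _) = 5
    bfLoad (t =ᵇ u) = pair (tmCode t) (tmCode u)
    bfLoad (t <ᵇ u) = pair (tmCode t) (tmCode u)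
    bfLoad (t ∈ᵇ j) = pair (tmCode t) j
    bfLoad ⊥ᵇ       = 0
    bfLoad (φ ⇒ᵇ ψ) = pair (bfCode φ) (bfCode ψ)
    bfLoad (∀ᵇ t φ) = pair (tmCode t) (bfCode φ)
    bfCode φ = pair (bfTag φ) (bfLoad φ)

    bf-injective : ∀ φ ψ → bfTag φ ≡ bfTag ψ → bfLoad φ ≡ bfLoad ψ → φ ≡ ψ
    bf-code-inj  : ∀ φ ψ → bfCode φ ≡ bfCode ψ → φ ≡ ψ
    bf-injective (t =ᵇ u) (t′ =ᵇ u′) refl e with p , q ← pair-injective {tmCode t} {tmCode u} e =
      cong₂ _=ᵇ_ (tm-code-inj t t′ p) (tm-code-inj u u′ q)
    bf-injective (t <ᵇ u) (t′ <ᵇ u′) refl e with p , q ← pair-injective {tmCode t} {tmCode u} e =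
      cong₂ _<ᵇ_ (tm-code-inj t t′ p) (tm-code-inj u u′ q)
    bf-injective (t ∈ᵇ j) (t′ ∈ᵇ j′) refl e with p , q ← pair-injective {tmCode t} {j} e =
      cong₂ _∈ᵇ_ (tm-code-inj t t′ p) q
    bf-injective ⊥ᵇ       ⊥ᵇ         refl e = refl
    bf-injective (φ ⇒ᵇ ψ) (φ′ ⇒ᵇ ψ′) refl e with p , q ← pair-injective {bfCode φ} {bfCode ψ} e =
      cong₂ _⇒ᵇ_ (bf-code-inj φ φ′ p) (bf-code-inj ψ ψ′ q)
    bf-injective (∀ᵇ t φ) (∀ᵇ t′ φ′) refl e with p , q ← pair-injective {tmCode t} {bfCode φ} e =
      cong₂ ∀ᵇ (tm-code-inj t t′ p) (bf-code-inj φ φ′ q)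
    bf-code-inj φ ψ e with p , q ← pair-injective {bfTag φ} {bfLoad φ} e = bf-injective φ ψ p q

  BF-countable : Countable BF
  BF-countable = record { code = bfCode ; injective = λ {φ} {ψ} → bf-code-inj φ ψ }

  Str-countable : Countable Str
  Str-countable = List-countable Bool-countable

  private
    hitC : Countable (ℕ × ℕ × List Str)
    hitC = ℕ-countable ×-countable ℕ-countable ×-countable List-countable Str-countable

    seetC : Countable (Str × ℕ × Str × Str × Str)
    seetC = Str-countable ×-countable ℕ-countable ×-countable
            Str-countable ×-countable Str-countable ×-countable Str-countable

    deltaC : Countable (BF × BF × List ℕ)
    deltaC = BF-countable ×-countable BF-countable ×-countable List-countable ℕ-countable

    opTag opLoad opCode : Op → ℕ
    opTag none              = 0
    opTag (hit _ _ _)       = 1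
    opTag (beyond _)        = 2
    opTag (or _ _)          = 3
    opTag (big _ _)         = 4
    opTag (compact _ _ _)   = 5
    opTag (seetapun _ _ _ _ _ _ _) = 6
    opTag (delta _ _ _ _)   = 7
    opLoad none             = 0
    opLoad (hit j L row)    = code hitC (j , L , row)
    opLoad (beyond b)       = b
    opLoad (or C D)         = pair (opCode C) (opCode D)
    opLoad (big W x)        = pair (opCode W) x
    opLoad (compact C W b)  = pair (opCode C) (pair (opCode W) (code Str-countable b))
    opLoad (seetapun s j σ g₀ g₁ C D) = pair (code seetC (s , j , σ , g₀ , g₁)) (pair (opCode C) (opCode D))
    opLoad (delta θ θ′ ρ W) = pair (code deltaC (θ , θ′ , ρ)) (opCode W)
    opCode W = pair (opTag W) (opLoad W)

    op-injective : ∀ C D → opTag C ≡ opTag D → opLoad C ≡ opLoad D → C ≡ D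
    op-code-inj  : ∀ C D → opCode C ≡ opCode D → C ≡ D
    op-injective none none refl e = refl
    op-injective (hit j L r) (hit j′ L′ r′) refl e
      with refl ← injective hitC {j , L , r} {j′ , L′ , r′} e = refl
    op-injective (beyond b) (beyond b′) refl refl = refl
    op-injective (or C D) (or C′ D′) refl e with p , q ← pair-injective {opCode C} {opCode D} e =
      cong₂ or (op-code-inj C C′ p) (op-code-inj D D′ q)
    op-injective (big W x) (big W′ x′) refl e with p , q ← pair-injective {opCode W} {x} e =
      cong₂ big (op-code-inj W W′ p) q
    op-injective (compact C W b) (compact C′ W′ b′) refl e
      with p , q ← pair-injective {opCode C} {pair (opCode W) (code Str-countable b)} e
      with r , s ← pair-injective {opCode W} {code Str-countable b} q
      with refl ← op-code-inj C C′ p | refl ← op-code-inj W W′ r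
      with refl ← injective Str-countable {b} {b′} s = refl
    op-injective (seetapun s j σ g₀ g₁ C D) (seetapun s′ j′ σ′ g₀′ g₁′ C′ D′) refl e
      with p , q ← pair-injective {code seetC (s , j , σ , g₀ , g₁)} {pair (opCode C) (opCode D)} e
      with r , t ← pair-injective {opCode C} {opCode D} q
      with refl ← injective seetC {s , j , σ , g₀ , g₁} {s′ , j′ , σ′ , g₀′ , g₁′} p
         | refl ← op-code-inj C C′ r | refl ← op-code-inj D D′ t = refl
    op-injective (delta θ θ′ ρ W) (delta η η′ κ W′) refl e
      with p , q ← pair-injective {code deltaC (θ , θ′ , ρ)} {opCode W} e
      with refl ← injective deltaC {θ , θ′ , ρ} {η , η′ , κ} p | refl ← op-code-inj W W′ q = refl
    op-code-inj C D e with p , q ← pair-injective {opTag C} {opLoad C} e = op-injective C D p q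

  Op-countable : Countable Op
  Op-countable = record { code = opCode ; injective = λ {C} {D} → op-code-inj C D }

  -- Membership in what the operators list.

  upto⁺ : ∀ e u z {v V} → v ≤ u → V ∈ e v (trunc v z) → V ∈ upto e u z
  upto⁺ e u z v≤u V∈ = ∈-concatMap⁺ (λ v → e v (trunc v z)) (lose (∈-upTo⁺ (s≤s v≤u)) V∈)

  upto⁻ : ∀ e u z {V} → V ∈ upto e u z → ∃[ v ] v ≤ u × V ∈ e v (trunc v z)
  upto⁻ e u z V∈ with v , v∈ , p ← find (∈-concatMap⁻ (λ v → e v (trunc v z)) V∈) =
    v , ≤-pred (∈-upTo⁻ v∈) , p

  upto-mono : ∀ e {w} u z {V} → w ≤ u → V ∈ upto e w (trunc w z) → V ∈ upto e u z
  upto-mono e {w} u z {V} w≤u V∈ with v , v≤w , p ← upto⁻ e w _ V∈ =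
    upto⁺ e u z (≤-trans v≤w w≤u) (subst (λ y → V ∈ e v y) (trunc-trunc z v≤w) p)

  nonempty⇒∈ : ∀ {A : Set} {xs : List A} → 0 < length xs → ∃[ x ] x ∈ xs
  nonempty⇒∈ {xs = x ∷ _} _ = x , here refl

  ∈⇒nonempty : ∀ {A : Set} {x : A} {xs} → x ∈ xs → 0 < length xs
  ∈⇒nonempty (here _)  = s≤s z≤n
  ∈⇒nonempty (there _) = s≤s z≤n

  Compatible : Str → ℕ → Str → Set
  Compatible b u t = length t ≡ u × take (length b) t ≡ take u b

  module _ {C W : Op} {b : Str} {u : ℕ} {z : List Str} where
    open Compact (eval C) (eval W) b u z

    private
      ∈-branches : ∀ {t} → Compatible b u t → t ∈ branches
      ∈-branches {t} (refl , e) = ∈-filter⁺ (λ t → take (length b) t ≟ˢ take u b) (∈-strings t) e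

    ∈-compact⁺ : ∀ {x} → x < u →
      (∀ t → Compatible b u t → ∃[ V ] (V ∈ upto (eval C) u (t ∷ z) ⊎ V ∈ upto (eval W) u (t ∷ z) × Above x V)) →
      ∃[ V ] V ∈ eval (compact C W b) u z × Above x V
    ∈-compact⁺ {x} x<u dead = union x , ∈-map⁺ union (∈-filter⁺ covered? (∈-upTo⁺ x<u) (All.tabulate cover)) ,
      All.tabulate λ {v} v∈ → let
        V , v∈V , V∈      = ∈-concat⁻′ (concatMap (hits x) branches) v∈
        t , _ , V∈′       = find (∈-concatMap⁻ (hits x) {xs = branches} V∈)
        in All.lookup (proj₂ (∈-filter⁻ (above? x) {xs = upto (eval W) u (t ∷ z)} V∈′)) v∈V
      where
      cover : ∀ {t} → t ∈ branches → 0 < length (upto (eval C) u (t ∷ z) ++ hits x t)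
      cover {t} t∈ with t∈′ , e ← ∈-filter⁻ (λ t → take (length b) t ≟ˢ take u b) {xs = strings u} t∈
                   with dead t (strings-length u t∈′ , e)
      ... | V , inj₁ p       = ∈⇒nonempty (∈-++⁺ˡ p)
      ... | V , inj₂ (p , q) = ∈⇒nonempty (∈-++⁺ʳ (upto (eval C) u (t ∷ z)) (∈-filter⁺ (above? x) p q))

    -- A branch on which `C` lists nothing can only have been covered by `W`, and the covering set
    -- went into the union.
    ∈-compact⁻ : ∀ {U} → U ∈ eval (compact C W b) u z → ∀ t → Compatible b u t →
      (∀ V → ¬ V ∈ upto (eval C) u (t ∷ z)) →
      ∃[ V ] V ∈ upto (eval W) u (t ∷ z) × (∀ {v} → v ∈ V → v ∈ U)
    ∈-compact⁻ U∈ t ok live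
      with x , x∈ , refl ← ∈-map⁻ union U∈
      with _ , cover ← ∈-filter⁻ covered? {xs = upTo u} x∈
      with V , V∈ ← nonempty⇒∈ (All.lookup cover (∈-branches ok))
      with ∈-++⁻ (upto (eval C) u (t ∷ z)) V∈
    ... | inj₁ p = contradiction p (live V)
    ... | inj₂ p = V , proj₁ (∈-filter⁻ (above? x) {xs = upto (eval W) u (t ∷ z)} p) , λ v∈ →
      ∈-concat⁺′ v∈ (∈-concatMap⁺ (hits x) (lose (∈-branches ok) p))

  module _ {sides : Str} {j : ℕ} {σ g₀ g₁ : Str} {W₀ W₁ : Op} {u : ℕ} {z : List Str} where
    open Seetapun sides j σ u z

    private
      Found : Bool → Str → Op → List ℕ → Set
      Found b g₀ W V = ∃[ g ] queries (length g) ≤ u × Extension ⟪ z ⟫ (b ∷ sides) σ j b g₀ g ×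
        V ∈ upto (eval W) (length g) (g ∷ trunc (length g) (drop (suc (length sides)) z))

      in-side : ∀ b g₀ W {V g} → Extension ⟪ z ⟫ (b ∷ sides) σ j b g₀ g →
        V ∈ upto (eval W) (length g) (g ∷ trunc (length g) (drop (suc (length sides)) z)) →
        V ∈ side b g₀ (eval W) (length g)
      in-side b g₀ W {V} {g} ext V∈ =
        ∈-concatMap⁺ (λ h → upto (eval W) (length g) (h ∷ trunc (length g) (drop (suc (length sides)) z)))
          (lose (∈-filter⁺ (extension? z (b ∷ sides) σ j b g₀) (∈-strings g) ext) V∈)

      from-side : ∀ b g₀ W {V} v → queries v ≤ u → V ∈ side b g₀ (eval W) v → Found b g₀ W V
      from-side b g₀ W v q V∈
        with g , g∈ , p ← find (∈-concatMap⁻ (λ g → upto (eval W) v (g ∷ trunc v (drop (suc (length sides)) z))) V∈)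
        with g∈′ , ext ← ∈-filter⁻ (extension? z (b ∷ sides) σ j b g₀) {xs = strings v} g∈
        with refl ← strings-length v g∈′ = g , q , ext , p

    ∈-seetapun⁺ : ∀ b {V g} → queries (length g) ≤ u →
      Extension ⟪ z ⟫ (b ∷ sides) σ j b (pick b g₀ g₁) g →
      V ∈ upto (eval (pick b W₀ W₁)) (length g) (g ∷ trunc (length g) (drop (suc (length sides)) z)) →
      V ∈ eval (seetapun sides j σ g₀ g₁ W₀ W₁) u z
    ∈-seetapun⁺ b {V} {g} q ext V∈ =
      ∈-concatMap⁺ _ (lose (∈-filter⁺ (λ v → queries v ≤? u)
        (∈-upTo⁺ (s≤s (≤-trans (≤queries (length g)) q))) q) (half b ext V∈))
      where
      half : ∀ b → Extension ⟪ z ⟫ (b ∷ sides) σ j b (pick b g₀ g₁) g →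
        V ∈ upto (eval (pick b W₀ W₁)) (length g) (g ∷ trunc (length g) (drop (suc (length sides)) z)) →
        V ∈ side false g₀ (eval W₀) (length g) ++ side true g₁ (eval W₁) (length g)
      half false ext V∈ = ∈-++⁺ˡ (in-side false g₀ W₀ ext V∈)
      half true  ext V∈ = ∈-++⁺ʳ (side false g₀ (eval W₀) (length g)) (in-side true g₁ W₁ ext V∈)

    ∈-seetapun⁻ : ∀ {V} → V ∈ eval (seetapun sides j σ g₀ g₁ W₀ W₁) u z →
      ∃[ b ] ∃[ g ] queries (length g) ≤ u × Extension ⟪ z ⟫ (b ∷ sides) σ j b (pick b g₀ g₁) g ×
        V ∈ upto (eval (pick b W₀ W₁)) (length g) (g ∷ trunc (length g) (drop (suc (length sides)) z))
    ∈-seetapun⁻ V∈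
      with v , v∈ , p ← find (∈-concatMap⁻ (λ v → side false g₀ (eval W₀) v ++ side true g₁ (eval W₁) v) V∈)
      with _ , q ← ∈-filter⁻ (λ v → queries v ≤? u) {xs = upTo (suc u)} v∈
      with ∈-++⁻ (side false g₀ (eval W₀) v) p
    ... | inj₁ r = false , from-side false g₀ W₀ v q r
    ... | inj₂ r = true , from-side true g₁ W₁ v q r

-- Fairness of a world.

module Fairness (cell : ℕ → ℕ → Str) (k : ℕ) (P : ℕ → ℕ → Set) where
  open Operators cell

  Enumerates : Op → World → List ℕ → Set
  Enumerates W Z V = ∃[ u ] ∃[ z ] Approx u z Z × V ∈ eval W u z

  Unbounded : Op → World → Set
  Unbounded W Z = ∀ x → ¬ ¬ (∃[ V ] Enumerates W Z V × Above x V)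

  -- A row (c , r) stands for the wish that a set with elements in all cells of r
  -- meet colour c; this is certain if in one of the cells all elements of V have
  -- limit colour c.
  Rows : Set
  Rows = List (ℕ × List Str)

  Good : ℕ → Rows → List ℕ → Set
  Good L rows V = All (λ (c , r) → ∃[ τ ] τ ∈ r × (∀ v → v ∈ V → cell L v ≡ τ → P v c)) rows

  -- Shrinking a set only removes constraints on its limits; this is what lets a union stand for
  -- each of the sets merged into it.
  good-⊆ : ∀ {L rows U V} → (∀ {v} → v ∈ V → v ∈ U) → Good L rows U → Good L rows V
  good-⊆ sub = All.map λ (τ , τ∈ , f) → τ , τ∈ , λ v v∈ → f v (sub v∈)

  Wide : ℕ → ℕ → Rows → Set
  Wide m N rows = length rows ≤ m × All (λ (c , r) → c < k × Unique r × N ≤ length r) rows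

  FairAt : ℕ → ℕ → ℕ → World → Set
  FairAt m N L Z = ∀ rows → Wide m N rows → ∀ W → Unbounded W Z →
                   ¬ ¬ (∃[ V ] Enumerates W Z V × Good L rows V)

  Fair : World → Set
  Fair Z = ∀ m → ¬ ¬ (∃[ N ] ∀ L₀ → ¬ ¬ (∃[ L ] L₀ ≤ L × FairAt m N L Z))

  upto-enumerates : ∀ W u z {Z V} → Approx u z Z → V ∈ upto (eval W) u z → Enumerates W Z V
  upto-enumerates W u z {Z} a V∈ with v , v≤u , p ← upto⁻ (eval W) u z V∈ =
    v , trunc v z , approx-trunc z Z v≤u a , p

  enumerates-resp : ∀ {X Y W Z V} → (∀ y → X y → ¬ ¬ Y y) → (∀ y → Y y → ¬ ¬ X y) →
                    Enumerates W (X ∷ Z) V → Enumerates W (Y ∷ Z) V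
  enumerates-resp f g (u , (s ∷ z) , ((l , p) , a) , V∈) =
    u , s ∷ z , ((l , λ i i< → agrees-resp (bit s i) (f i) (g i) (p i i<)) , a) , V∈

  fairAt-resp : ∀ {X Y Z m N L} → (∀ y → X y → ¬ ¬ Y y) → (∀ y → Y y → ¬ ¬ X y) →
                FairAt m N L (X ∷ Z) → FairAt m N L (Y ∷ Z)
  fairAt-resp {X} {Y} {Z} f g fair rows wide W unb = do
    V , en , good ← fair rows wide W λ x → do
      V , en , above ← unb x
      return (V , enumerates-resp {Y} {X} {W} {Z} g f en , above)
    return (V , enumerates-resp {X} {Y} {W} {Z} f g en , good)

  fair-mono : ∀ {Z Z′} → (∀ m N L → FairAt m N L Z → FairAt m N L Z′) → Fair Z → Fair Z′
  fair-mono f fair m = do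
    N , h ← fair m
    return (N , λ L₀ → do
      L , le , at ← h L₀
      return (L , le , f m N L at))

  -- Weak König's lemma

  module _ (Z : World) where

    -- An operator codes a tree by what it kills: `t` is on the tree while `C` lists nothing along
    -- it.
    Alive : Op → ℕ → Str → Set
    Alive C u t = ∀ z → Approx u z Z → ∀ V → ¬ V ∈ upto (eval C) u (t ∷ z)

    InfiniteTree : Op × Str → Set
    InfiniteTree (C , b) = ∀ u → ¬ ¬ (∃[ t ] Compatible b u t × Alive C u t)

    private
      upto-or : ∀ C W x u z {V} → V ∈ upto (eval (or C (big W x))) u z →
                V ∈ upto (eval C) u z ⊎ V ∈ upto (eval W) u z × Above x V
      upto-or C W x u z V∈
        with v , v≤u , p ← upto⁻ (eval (or C (big W x))) u z V∈
        with ∈-++⁻ (eval C v (trunc v z)) p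
      ... | inj₁ q = inj₁ (upto⁺ (eval C) u z v≤u q)
      ... | inj₂ q with q′ , above ← ∈-filter⁻ (above? x) {xs = eval W v (trunc v z)} q =
        inj₂ (upto⁺ (eval W) u z v≤u q′ , above)

    compatible-take : ∀ {b u w t} → u ≤ w → Compatible b w t → Compatible b u (take u t)
    compatible-take {b} {u} {w} {t} u≤w (refl , e) = length-take-≤ t u≤w ,
      trans (take-swap (length b) u t) (trans (cong (take u) e) (take-take-≤ b u≤w))
      where
      take-swap : ∀ m n (s : Str) → take m (take n s) ≡ take n (take m s)
      take-swap m n s = trans (take-take m n s)
        (trans (cong (λ r → take r s) (⊓-comm m n)) (sym (take-take n m s)))

    -- At a level without live strings, every compatible string is killed by `C` or lists through
    -- `W` a set above `x`: exactly the covering that `compact` waits for.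
    finite-trees⇒unbounded : ∀ C W b → (∀ x → ¬ InfiniteTree (or C (big W x) , b)) →
                             Unbounded (compact C W b) Z
    finite-trees⇒unbounded C W b fin x = do
      u , absent ← ¬∀⇒∃¬ (fin x) (λ _ p k → p λ q → q k)
      -- `compact` tries only bounds below its stage, hence `suc x`.
      let w = u ⊔ suc x
      z , a ← approx-exists Z w
      dead ← ∀∈-¬¬ (λ t → Compatible b w t →
                      ∃[ V ] (V ∈ upto (eval C) w (t ∷ z) ⊎ V ∈ upto (eval W) w (t ∷ z) × Above x V))
                   (strings w) (λ t _ → kill u w z (m≤m⊔n u (suc x)) a (λ p → absent (return p)) t)
      let V , V∈ , above = ∈-compact⁺ {C} {W} {b} {w} {z} (m≤n⊔m u (suc x))
            λ t c → dead t (subst (λ n → t ∈ strings n) (proj₁ c) (∈-strings t)) c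
      return (V , (w , z , a , V∈) , above)
      where
      kill : ∀ u w z → u ≤ w → Approx w z Z →
        ¬ (∃[ t ] Compatible b u t × Alive (or C (big W x)) u t) → ∀ t →
        ¬ ¬ (Compatible b w t →
          ∃[ V ] (V ∈ upto (eval C) w (t ∷ z) ⊎ V ∈ upto (eval W) w (t ∷ z) × Above x V))
      kill u w z u≤w a absent t = em (Compatible b w t) >>= λ where
        (no ¬c) → return λ c → ⊥-elim (¬c c)
        (yes c) stop → absent (take u t , compatible-take u≤w c , λ z′ a′ V V∈ →
          let z≡ = approx-unique z′ (trunc u z) Z a′ (approx-trunc z Z u≤w a)
              V∈′ = subst (λ y → V ∈ upto (eval (or C (big W x))) u (take u t ∷ y)) z≡ V∈
          in stop λ _ → V , (case upto-or C W x u _ V∈′ of λ where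
            (inj₁ p)       → inj₁ (upto-mono (eval C) w (t ∷ z) u≤w p)
            (inj₂ (p , q)) → inj₂ (upto-mono (eval W) w (t ∷ z) u≤w p , q)))

    -- Either no surviving string lists through `W` a set above `x`, which bounds `W` on the path,
    -- or fairness of `Z` becomes applicable to the merged operator.
    Settled : Op → Op × Str → Set
    Settled W (C , b) =
      (∃[ x ] ∀ u t → Alive C u t → Alive (big W x) u t) ⊎ Unbounded (compact C W b) Z

    Step : ℕ → Op × Str → Op × Str → Set
    Step n (C , b) (C′ , b′) =
      InfiniteTree (C′ , b′) × (∃[ c ] b′ ≡ b ++ c ∷ []) × (∀ u t → Alive C′ u t → Alive C u t) ×
      (∀ W → code Op-countable W ≡ n → Settled W (C′ , b′))

    private
      alive-or : ∀ C D u t → Alive (or C D) u t → Alive C u t × Alive D u t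
      alive-or C D u t al =
        (λ z a V V∈ → let v , v≤u , p = upto⁻ (eval C) u (t ∷ z) V∈ in
          al z a V (upto⁺ (eval (or C D)) u (t ∷ z) v≤u (∈-++⁺ˡ p))) ,
        (λ z a V V∈ → let v , v≤u , p = upto⁻ (eval D) u (t ∷ z) V∈ in
          al z a V (upto⁺ (eval (or C D)) u (t ∷ z) v≤u (∈-++⁺ʳ (eval C v (trunc v (t ∷ z))) p)))

      snoc-str : ∀ s (t : Str) → length t ≡ suc (length s) → s ⊑ t → t ≡ s ++ bit t (length s) ∷ []
      snoc-str []      (c ∷ []) _ _ = refl
      snoc-str (_ ∷ s) (c ∷ t)  l e with refl ← cong head e =
        cong (c ∷_) (snoc-str s t (suc-injective l) (cong (drop 1) e))

    alive-take : ∀ C {u w t} → u ≤ w → Alive C w t → Alive C u (take u t)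
    alive-take C {u} {w} {t} u≤w al z a V V∈ = run do
      z′ , a′ ← approx-exists Z w
      let e = approx-unique z (trunc u z′) Z a (approx-trunc z′ Z u≤w a′)
      return (al z′ a′ V (upto-mono (eval C) w (t ∷ z′) u≤w
        (subst (λ y → V ∈ upto (eval C) u (take u t ∷ y)) e V∈)))

    -- If the extension by `true` dies at level u₁, every live string reaching past u₁ and past `b`
    -- continues `b` with `false`.
    add-bit : ∀ C b → InfiniteTree (C , b) → ¬ ¬ (∃[ c ] InfiniteTree (C , b ++ c ∷ []))
    add-bit C b inf = em (InfiniteTree (C , b ++ true ∷ [])) >>= λ where
        (yes i) → return (true , i)
        (no ¬i) → do
          u₁ , no₁ ← ¬∀⇒∃¬ ¬i (λ _ p k → p λ q → q k)
          return (false , λ u → do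
            let w = u ⊔ (u₁ ⊔ suc (length b))
                u₁≤w = ≤-trans (m≤m⊔n u₁ (suc (length b))) (m≤n⊔m u _)
                b<w = ≤-trans (m≤n⊔m u₁ (suc (length b))) (m≤n⊔m u _)
            t , (l , e) , al ← inf w
            let c  = bit t (length b)
                t≡ = extend t l e b<w
            case c Data.Bool.≟ true of λ where
              (yes c≡) → ⊥-elim (no₁ (return (take u₁ t ,
                compatible-take u₁≤w (l , trans t≡ (cong (λ d → take w (b ++ d ∷ [])) c≡)) , alive-take C u₁≤w al)))
              (no c≢)  → return (take u t ,
                compatible-take (m≤m⊔n u _) (l , trans t≡ (cong (λ d → take w (b ++ d ∷ [])) (¬-not c≢))) ,
                alive-take C (m≤m⊔n u _) al))
      where
      extend : ∀ {w} t → length t ≡ w → take (length b) t ≡ take w b → suc (length b) ≤ w →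
               ∀ {d} → take (length (b ++ d ∷ [])) t ≡ take w (b ++ bit t (length b) ∷ [])
      extend {w} t refl e b<w {d} = trans (cong (λ n → take n t) (length-snoc b))
        (trans (trans (snoc-str b (take (suc (length b)) t) (length-take-≤ t b<w)
          (trans (take-take-≤ t (n≤1+n _)) (trans e (take-all w b (<⇒≤ b<w)))))
          (cong (λ c → b ++ c ∷ []) (bit-take t ≤-refl)))
          (sym (take-all w _ (≤-trans (≤-reflexive (length-snoc b)) b<w))))

    step-total : ∀ n d → InfiniteTree d → ¬ ¬ (∃[ d′ ] Step n d d′)
    step-total n (C , b) inf = do
      c , inf′ ← add-bit C b inf
      let b′ = b ++ c ∷ []
      em (∃[ W ] code Op-countable W ≡ n) >>= λ where
        (no absent) → return ((C , b′) , inf′ , (c , refl) , (λ _ _ p → p) , λ W e → ⊥-elim (absent (W , e)))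
        (yes (W , eW)) → em (∃[ x ] InfiniteTree (or C (big W x) , b′)) >>= λ where
          (yes (x , i)) → return ((or C (big W x) , b′) , i , (c , refl) ,
            (λ u t → proj₁ ∘ alive-or C (big W x) u t) ,
            λ W′ e′ → case injective Op-countable {x = W′} {W} (trans e′ (sym eW)) of λ where
              refl → inj₁ (x , λ u t → proj₂ ∘ alive-or C (big W x) u t))
          (no ¬i) → return ((C , b′) , inf′ , (c , refl) , (λ _ _ p → p) ,
            λ W′ e′ → case injective Op-countable {x = W′} {W} (trans e′ (sym eW)) of λ where
              refl → inj₂ (finite-trees⇒unbounded C W b′ λ x i → ¬i (x , i)))

    step-grows : ∀ n d d′ → Step n d d′ → proj₂ d ⊑ proj₂ d′
    step-grows _ _ _ (_ , (_ , e) , _) = ⊑-snoc e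

  module PathThrough (Z : World) (C₀ : Op) where
    open Chain (Op-countable ×-countable Str-countable) (Step Z) (C₀ , [])
    open Limit (Op-countable ×-countable Str-countable) (Step Z) (C₀ , []) proj₂
      (step-grows Z) renaming (limit to path) public

    module _ (start : InfiniteTree Z (C₀ , [])) where

      private
        inv : ∀ n {d} → Reached n d → InfiniteTree Z d
        inv = reached-invariant (InfiniteTree Z) start (step-total Z) (λ _ → proj₁)

        total : ∀ n → ¬ ¬ (∃[ d ] Reached n d)
        total = reached-total (InfiniteTree Z) start (step-total Z) (λ _ → proj₁)

        length-reached : ∀ n {C b} → Reached n (C , b) → length b ≡ n
        length-reached zero    refl = refl
        length-reached (suc n) ((C , b) , r , (_ , (c , refl) , _) , _) =
          trans (length-snoc b) (cong suc (length-reached n r))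

        alive-later : ∀ {m n d d′} → m ≤ n → Reached m d → Reached n d′ →
                      ∀ u t → Alive Z (proj₁ d′) u t → Alive Z (proj₁ d) u t
        alive-later = along (λ d d′ → ∀ u t → Alive Z (proj₁ d′) u t → Alive Z (proj₁ d) u t)
          (λ _ _ p → p) (λ f g u t → f u t ∘ g u t) (proj₁ ∘ proj₂ ∘ proj₂)

      live : ∀ n C b D → Reached n (C , b) → (∀ u t → Alive Z C u t → Alive Z D u t) →
             ∀ u s z {V} → Approx u (s ∷ z) (path ∷ Z) → ¬ V ∈ upto (eval D) u (s ∷ z)
      live n C b D r sub u s z {V} ((l , s≺) , a) V∈ = run do
        let N = n ⊔ u
        (C′ , b′) , r′ ← total N
        t , (lt , e) , al ← inv N r′ N
        z′ , a′ ← approx-exists Z N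
        -- At stage N the stem has length N, so the live string compatible with it is the stem
        -- itself, and `s` is one of its initial segments.
        let lb  = length-reached N r′
            t≡b = trans (sym (take-all (length b′) t (≤-reflexive (trans lt (sym lb)))))
                        (trans e (take-all N b′ (≤-reflexive lb)))
            u≤N = m≤n⊔m n u
            s≡  = ≺-unique {t = take u b′} (trans l (sym (length-take-≤ b′ (subst (u ≤_) (sym lb) u≤N))))
                    s≺ (≺-take u (reached-≺ N r′))
            z≡  = approx-unique z (trunc u z′) Z a (approx-trunc z′ Z u≤N a′)
            V∈′ = subst₂ (λ q y → V ∈ upto (eval D) u (q ∷ y)) s≡ z≡ V∈
        return (sub N b′ (subst (Alive Z C N) t≡b (alive-later (m≤m⊔n n u) r r′ N t al)) z′ a′ V
          (upto-mono (eval D) N (b′ ∷ z′) u≤N V∈′))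

      path-avoids : ∀ u s z {V} → Approx u (s ∷ z) (path ∷ Z) → ¬ V ∈ upto (eval C₀) u (s ∷ z)
      path-avoids = live 0 C₀ [] C₀ refl (λ _ _ p → p)

      -- If the tree was thinned, `W` is bounded on the path, against its unboundedness. Otherwise a
      -- good set of the merged operator contains a set that `W` lists along the path. The
      -- parameters are unchanged, so splittings can be added one after another.
      path-fair : ∀ {m N L} → FairAt m N L Z → FairAt m N L (path ∷ Z)
      path-fair fair rows wide W unb = do
          (C , b) , r@(_ , _ , (_ , _ , _ , settled) , _) ← total (suc (code Op-countable W))
          case settled W refl of λ where
            (inj₁ (x , kills)) → do
              V , (u , (s ∷ z) , a , V∈) , above ← unb x
              ⊥-elim (live _ C b (big W x) r kills u s z a (upto⁺ (eval (big W x)) u (s ∷ z) ≤-refl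
                (subst (λ y → V ∈ eval (big W x) u y) (sym (trunc-id (s ∷ z) (path ∷ Z) a)) (∈-filter⁺ (above? x) V∈ above))))
            (inj₂ unb′) → do
              U , (u , z , a , U∈) , good ← fair rows wide (compact C W b) unb′
              s , l , s≺ ← ≺-exists path u
              let V , V∈ , V⊆U = ∈-compact⁻ {C} {W} {b} {u} {z} U∈ s (l , compat _ C b r l s≺)
                                   (λ V → live _ C b C r (λ _ _ p → p) u s z ((l , s≺) , a))
              return (V , upto-enumerates W u (s ∷ z) {path ∷ Z} ((l , s≺) , a) V∈ , good-⊆ V⊆U good)
        where
        compat : ∀ n C b {u s} → Reached n (C , b) → length s ≡ u → s ≺ path → take (length b) s ≡ take u b
        compat n C b {u} {s} r refl s≺ = ≺-unique
          (trans (length-take (length b) s) (trans (⊓-comm (length b) (length s)) (sym (length-take (length s) b))))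
          (≺-take (length b) s≺) (≺-take (length s) (reached-≺ n r))

  Unending : Pred₀ → Set
  Unending X = ∀ y₀ → ¬ ¬ (∃[ y ] y₀ < y × X y)

  -- One half has to serve all `w`. If the `true` half fails for w₁ beyond y₁, then beyond y₁ the
  -- whole of `X (w ⊔ w₁)` lies in the other half, and the sets decrease.
  unending-split : (X : ℕ → Pred₀) → (∀ {w w′ y} → w ≤ w′ → X w′ y → X w y) → (A : Pred₀) →
    (∀ w → Unending (X w)) → ¬ ¬ (∃[ b ] ∀ w → Unending (λ y → X w y × Agrees b (A y)))
  unending-split X dec A inf = em (∀ w → Unending (λ y → X w y × Agrees true (A y))) >>= λ where
    (yes p) → return (true , p)
    (no ¬p) → do
      w₁ , ¬p₁ ← ¬∀⇒∃¬ ¬p (λ _ p y₀ k → p λ q → q y₀ k)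
      y₁ , ¬p₂ ← ¬∀⇒∃¬ ¬p₁ (λ _ p k → p λ q → q k)
      return (false , λ w y₀ → do
        y , lt , x ← inf (w ⊔ w₁) (y₀ ⊔ y₁)
        return (y , ≤-trans (s≤s (m≤m⊔n y₀ y₁)) lt , dec (m≤m⊔n w w₁) x ,
          λ a → ¬p₂ (return (y , ≤-trans (s≤s (m≤n⊔m y₀ y₁)) lt , dec (m≤n⊔m w w₁) x , return a))))

  pad : ℕ → Str → Str
  pad v s = s ++ replicate (v ∸ length s) false

  length-pad : ∀ {v s} → length s ≤ v → length (pad v s) ≡ v
  length-pad {v} {s} le = trans (length-++ s)
    (trans (cong (length s +_) (length-replicate (v ∸ length s))) (m+[n∸m]≡n le))

  bit-replicate : ∀ n i → bit (replicate n false) i ≡ false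
  bit-replicate zero    i       = refl
  bit-replicate (suc n) zero    = refl
  bit-replicate (suc n) (suc i) = bit-replicate n i

  bit-pad : ∀ {v} s {i} → T (bit (pad v s) i) → i < length s × T (bit s i)
  bit-pad {v} s {i} t with i <? length s
  ... | yes i< = i< , subst T (bit-++ˡ s i<) t
  ... | no i≮  = ⊥-elim (subst T (trans (cong (bit (pad v s)) (sym (m+[n∸m]≡n (≮⇒≥ i≮))))
                   (trans (bit-++ʳ s (i ∸ length s)) (bit-replicate (v ∸ length s) (i ∸ length s)))) t)

  bit-snoc⁻ : ∀ s {b i} → T (bit (s ++ b ∷ []) i) → (i < length s × T (bit s i)) ⊎ i ≡ length s
  bit-snoc⁻ s {b} {i} t with i <? length s
  ... | yes i< = inj₁ (i< , subst T (bit-++ˡ s i<) t)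
  ... | no i≮ with i ≟ length s
  ...   | yes e = inj₂ e
  ...   | no ne = ⊥-elim (subst T (bit-beyond (s ++ b ∷ [])
                    (subst (_≤ i) (sym (length-snoc s)) (≤∧≢⇒< (≮⇒≥ i≮) (ne ∘ sym)))) t)

  -- `x` goes to side `b` and `y` to the other: one side grows while the other is only padded.
  choose : ∀ {A : Set} → Bool → A → A → Bool → A
  choose false x y c = pick c x y
  choose true  x y c = pick c y x

  -- Ramsey's theorem for pairs
  module Ramsey (Z : World) (j : ℕ) (j< : j < length Z) where

    Thin : Str → Pred₀
    Thin σ y = ∀ {x} → x < length σ → Agrees (bit σ x) (colour Z j x y)

    LimStep : ℕ → Str → Str → Set
    LimStep n σ σ′ = Unending (Thin σ′) × (∃[ c ] σ′ ≡ σ ++ c ∷ [])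

    lim-grows : ∀ n σ σ′ → LimStep n σ σ′ → σ ⊑ σ′
    lim-grows _ _ _ (_ , _ , e) = ⊑-snoc e

    private
      module C = Chain Str-countable LimStep []
      open Limit Str-countable LimStep [] id lim-grows

      lim-total : ∀ n σ → Unending (Thin σ) → ¬ ¬ (∃[ σ′ ] LimStep n σ σ′)
      lim-total n σ inf = do
        b , inf′ ← unending-split (λ _ → Thin σ) (λ _ p → p) (λ y → colour Z j (length σ) y) (λ _ → inf)
        return (σ ++ b ∷ [] , (λ y₀ → do
          y , lt , thin , ag ← inf′ 0 y₀
          return (y , lt , λ {x} x< → case m≤n⇒m<n∨m≡n (≤-pred (subst (suc x ≤_) (length-snoc σ) x<)) of λ where
            (inj₁ x<σ)  → subst (λ c → Agrees c (colour Z j x y)) (sym (bit-++ˡ σ x<σ)) (thin x<σ)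
            (inj₂ refl) → subst (λ c → Agrees c (colour Z j x y)) (sym (bit-snoc σ)) ag)) , b , refl)

      thin-start : Unending (Thin [])
      thin-start y₀ = return (suc y₀ , ≤-refl , λ ())

    -- The limit colour along one fixed descending sequence of infinite sets; reservoirs
    -- are kept positive for that filter, which makes a cohesive set unnecessary.
    p : Pred₀
    p = limit

    Along : ℕ → Pred₀
    Along w y = ∀ x → x < w → ∀ b → Agrees b (p x) → Agrees b (colour Z j x y)

    along-unending : ∀ w → Unending (Along w)
    along-unending w y₀ = do
      σ , r ← C.reached-total (Unending ∘ λ σ → Thin σ) thin-start lim-total (λ _ → proj₁) w
      y , lt , thin ← C.reached-invariant (Unending ∘ λ σ → Thin σ) thin-start lim-total (λ _ → proj₁) w r y₀
      return (y , lt , λ x x<w b ag →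
        let x<σ = subst (x <_) (sym (len w r)) x<w in
        subst (λ c → Agrees c (colour Z j x y)) (agrees-unique (bit σ x) b (reached-≺ w r x x<σ) ag) (thin x<σ))
      where
      len : ∀ n {σ} → C.Reached n σ → length σ ≡ n
      len zero    refl = refl
      len (suc n) (σ , r , (_ , c , refl) , _) = trans (length-snoc σ) (cong suc (len n r))

    -- An operator stands for the path it generates, so that conditions stay countable, as the chain
    -- requires, while `world` recovers the actual splittings. The strings are the finite parts of
    -- the two homogeneous sets and a segment of the limit colours.
    Cond : Set
    Cond = List (Op × Bool) × Str × Str × Str

    Cond-countable : Countable Cond
    Cond-countable = List-countable (Op-countable ×-countable Bool-countable) ×-countable
      Str-countable ×-countable Str-countable ×-countable Str-countable

    world : List (Op × Bool) → World
    world []            = Z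
    world ((C , _) ∷ r) = PathThrough.path (world r) C ∷ world r

    sides : List (Op × Bool) → Str
    sides = map proj₂

    stem : Cond → Str
    stem (_ , _ , _ , σ) = σ

    side : Bool → Cond → Str
    side b (_ , g₀ , g₁ , _) = pick b g₀ g₁

    Ext : Cond → Bool → Str → Set
    Ext d@(rs , _ , _ , σ) b g = Extension (world rs) (sides rs) σ j b (side b d) g

    Reservoir : Cond → Pred₀
    Reservoir (rs , _ , _ , σ) = InReservoir (world rs) (sides rs) σ j

    record Valid (d : Cond) : Set where
      field
        lengths : ∀ b → length (side b d) ≡ length (stem d)
        stem≺   : stem d ≺ p
        coloured : ∀ b {y} → T (bit (side b d) y) → Agrees b (p y)
        -- As an extension of itself a side adds no points, so this says that it is homogeneous.
        self    : ∀ b → Ext d b (side b d)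
        infinite : ∀ w → Unending (λ y → Reservoir d y × Along w y)
        fair    : ∀ m N L → FairAt m N L Z → FairAt m N L (world (proj₁ d))
    open Valid

    infix 4 _⊒_
    record _⊒_ (d d′ : Cond) : Set where
      field
        grows : ∀ b → side b d ⊑ side b d′
        -- Makes the sides of all later conditions extensions of the present one.
        ext   : ∀ b {g} → Ext d′ b g → Ext d b g
    open _⊒_

    ⊒-refl : ∀ {d} → d ⊒ d
    ⊒-refl = record { grows = λ _ → ⊑-refl ; ext = λ _ e → e }

    ⊒-trans : ∀ {d d′ d″} → d ⊒ d′ → d′ ⊒ d″ → d ⊒ d″
    ⊒-trans p q = record { grows = λ b → ⊑-trans (grows p b) (grows q b) ; ext = λ b → ext p b ∘ ext q b }

    j<world : ∀ rs → j < length (world rs)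
    j<world []       = j<
    j<world (_ ∷ rs) = m≤n⇒m≤1+n (j<world rs)

    col-world : ∀ rs → col (world rs) j ≡ col Z j
    col-world []             = refl
    col-world ((C , _) ∷ rs) = trans (col-cons _ (world rs) (j<world rs)) (col-world rs)

    drop-approx : ∀ {u} rs zs → Approx u zs (world rs) → Approx u (drop (length (sides rs)) zs) Z
    drop-approx []       zs       a       = a
    drop-approx (_ ∷ rs) (_ ∷ zs) (_ , a) = drop-approx rs zs a

    extension-tail : ∀ {X b rs σ c g₀ g} →
      Extension (X ∷ world rs) (b ∷ sides rs) σ j c g₀ g → Extension (world rs) (sides rs) σ j c g₀ g
    extension-tail {X} {rs = rs} {σ} {c} (extension pre ins hom) = extension pre
      (λ y< le t → let (q₁ , _ , q₂) = ins y< le t in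
        (λ {x} x< → subst (λ C → Agrees (bit σ x) (C (pair (pair x _) 1))) (col-cons X (world rs) (j<world rs)) (q₁ x<)) , q₂)
      (λ y< {x} x< s t → subst (λ C → Agrees c (C (pair (pair x _) 1))) (col-cons X (world rs) (j<world rs)) (hom y< x< s t))

    extension-padded : ∀ {d v b} → Valid d → length (stem d) ≤ v → Ext d b (pad v (side b d))
    extension-padded {d} {v} {b} val le = extension (take-++ (side b d))
      (λ _ l t → ⊥-elim (≤⇒≯ l (proj₁ (bit-pad (side b d) t))))
      (λ {y} y< {x} x< s t → let (y<′ , t′) = bit-pad (side b d) {y} t ; (_ , s′) = bit-pad (side b d) {x} s
        in Extension.homog (self val b) y<′ x< s′ t′)

    -- A longer `σ` asks the reservoir for finitely many more limit colours, and points of the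
    -- filter `Along` have them; this is where positivity for the filter keeps the reservoir
    -- infinite.
    enlarge : ∀ {d v} (g : Bool → Str) → Valid d → (∀ b → length (g b) ≡ v) → (∀ b → Ext d b (g b)) →
              (∀ b {y} → T (bit (g b) y) → Agrees b (p y)) →
              ¬ ¬ (∃[ σ′ ] length σ′ ≡ v × Valid (proj₁ d , g false , g true , σ′) × d ⊒ (proj₁ d , g false , g true , σ′))
    enlarge {d@(rs , g₀ , g₁ , σ)} {v} g val len exts cols = do
      σ′ , l , σ′≺ ← ≺-exists p v
      let d′ = (rs , g false , g true , σ′)
          same : ∀ b → side b d′ ≡ g b
          same = λ { false → refl ; true → refl }
          σ⊑σ′ : σ ⊑ σ′
          σ⊑σ′ = ≺-⊑ (stem≺ val) σ′≺ (subst₂ _≤_ (lengths val false) (trans (len false) (sym l)) (⊑-length (Extension.prefix (exts false))))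
          thin : ∀ {y} → InReservoir (world rs) (sides rs) σ′ j y → InReservoir (world rs) (sides rs) σ j y
          thin {y} = λ (q₁ , q₂) → (λ {x} x< → subst (λ c → Agrees c (colour (world rs) j x y)) (sym (⊑-bit σ⊑σ′ x<))
                       (q₁ (≤-trans x< (⊑-length σ⊑σ′)))) , q₂
          back : ∀ b {h} → Extension (world rs) (sides rs) σ′ j b (g b) h → Ext d b h
          back = λ b {h} (extension pre ins hom) → extension (⊑-trans (Extension.prefix (exts b)) pre)
            (λ {y} y< le t → case y <? length (g b) of λ where
              (yes y<g) → Extension.inside (exts b) y<g le (subst T (sym (⊑-bit pre y<g)) t)
              (no y≮g)  → thin (ins y< (≮⇒≥ y≮g) t))
            (λ y< → hom y<)
      return (σ′ , l , record
        { lengths  = λ b → trans (cong length (same b)) (trans (len b) (sym l))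
        ; stem≺    = σ′≺
        ; coloured = λ b {y} t → cols b (subst (λ h → T (bit h y)) (same b) t)
        ; self     = λ b → subst (λ h → Extension (world rs) (sides rs) σ′ j b h h) (sym (same b))
            (extension ⊑-refl (λ y< le _ → ⊥-elim (≤⇒≯ le y<)) (λ y< → Extension.homog (exts b) y<))
        ; infinite = λ w y₀ → do
            y , lt , (_ , in-sides) , al ← infinite val (w ⊔ v) y₀
            return (y , lt , ((λ {x} x< → subst (λ C → Agrees (bit σ′ x) (C (pair (pair x y) 1))) (sym (col-world rs))
              (al x (≤-trans (subst (x <_) l x<) (m≤n⊔m w v)) (bit σ′ x) (σ′≺ x x<))) , in-sides) ,
              λ x x< → al x (≤-trans x< (m≤m⊔n w v)))
        ; fair     = fair val
        } , record
        { grows = λ b → subst (side b d ⊑_) (sym (same b)) (Extension.prefix (exts b))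
        ; ext   = λ b {h} e → back b (subst (λ q → Extension (world rs) (sides rs) σ′ j b q h) (same b) e)
        })

    Request : Set
    Request = ℕ × (Op × Rows) × (Op × Rows)

    Request-countable : Countable Request
    Request-countable = ℕ-countable ×-countable opRows ×-countable opRows
      where
      opRows : Countable (Op × Rows)
      opRows = Op-countable ×-countable List-countable (ℕ-countable ×-countable List-countable Str-countable)

    ask : Bool → Request → Op × Rows
    ask b (_ , a₀ , a₁) = pick b a₀ a₁

    Found : Request → Cond → Bool → Set
    Found r d b = ∃[ V ] ∃[ z ] Approx (length (side b d)) z Z ×
      V ∈ upto (eval (proj₁ (ask b r))) (length (side b d)) (side b d ∷ z) × Good (proj₁ r) (proj₂ (ask b r)) V

    Bounded : Request → Cond → Bool → Set
    Bounded r d b = ∃[ x ] ∀ g → Ext d b g → ∀ z → Approx (length g) z Z → ∀ V →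
      V ∈ upto (eval (proj₁ (ask b r))) (length g) (g ∷ z) → ¬ Above x V

    Answered : Request → Cond → Set
    Answered r d = ∃[ b ] (Found r d b ⊎ Bounded r d b)

    Admissible : Request → Set
    Admissible (L , (_ , rows₀) , (_ , rows₁)) = ∃[ m ] ∃[ N ] FairAt m N L Z × Wide m N (rows₀ ++ rows₁)

    private
      good-pick : ∀ {L} (a₀ a₁ : Op × Rows) {V} → Good L (proj₂ a₀ ++ proj₂ a₁) V → ∀ b → Good L (proj₂ (pick b a₀ a₁)) V
      good-pick (_ , rows₀) (_ , rows₁) good false = All.++⁻ˡ rows₀ good
      good-pick (_ , rows₀) (_ , rows₁) good true  = All.++⁻ʳ rows₀ good

      proj-pick : ∀ {A B : Set} b {x y : A × B} → pick b (proj₁ x) (proj₁ y) ≡ proj₁ (pick b x y)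
      proj-pick false = refl
      proj-pick true  = refl

    -- The disjunctive question: does every splitting of the reservoir have, on the
    -- corresponding side, an extension listing a set above x?
    settle : ∀ r → Admissible r → ∀ d → Valid d → ¬ ¬ (∃[ d′ ] Valid d′ × d ⊒ d′ × Answered r d′)
    settle r@(L , a₀@(W₀ , rows₀) , a₁@(W₁ , rows₁)) (m , N , fairZ , wide) d@(rs , g₀ , g₁ , σ) val =
      -- The tree of splittings of the reservoir for which neither side has yet an extension listing
      -- a set above `x`.
      em (∃[ x ] InfiniteTree (world rs) (or none (big S x) , [])) >>= λ where
        (yes (x , inf)) → thin-out x inf
        (no ¬inf)       → extend (finite-trees⇒unbounded (world rs) none S [] (λ x i → ¬inf (x , i)))
      where
      S : Op
      S = seetapun (sides rs) j σ g₀ g₁ W₀ W₁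

      thin-out : ∀ x → InfiniteTree (world rs) (or none (big S x) , []) →
                 ¬ ¬ (∃[ d′ ] Valid d′ × d ⊒ d′ × Answered r d′)
      thin-out x inf = do
        -- The half of the splitting `B` that keeps the reservoir positive is retained; an extension
        -- inside it listing a set above `x` would throw `B` off the tree.
        b , inf′ ← unending-split (λ w y → Reservoir d y × Along w y)
                     (λ le (q , al) → q , λ x x< → al x (≤-trans x< le)) B (infinite val)
        let rs′ = (T-op , b) ∷ rs
            d′ = (rs′ , g₀ , g₁ , σ)
            up : ∀ c x y → Agrees c (colour (world rs) j x y) → Agrees c (colour (world rs′) j x y)
            up c x y = subst (λ C → Agrees c (C (pair (pair x y) 1))) (sym (col-cons B (world rs) (j<world rs)))
        return (d′ , record
          { lengths = lengths val ; stem≺ = stem≺ val ; coloured = coloured val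
          ; self = λ c → extension ⊑-refl (λ y< le _ → ⊥-elim (≤⇒≯ le y<))
                     (λ {y} y< {x} x< s t → up c x y (Extension.homog (self val c) y< x< s t))
          ; infinite = λ w y₀ → do
              y , lt , ((q₁ , q₂) , al) , ag ← inf′ w y₀
              return (y , lt , ((λ {x} x< → up (bit σ x) x y (q₁ x<)) , ag , q₂) , al)
          ; fair = λ m N L → PathThrough.path-fair (world rs) T-op inf ∘ fair val m N L
          } , record { grows = λ _ → ⊑-refl ; ext = λ c → extension-tail {B} {b} {rs} }
          , b , inj₂ (x , bounded b))
        where
        T-op : Op
        T-op = or none (big S x)
        B : Pred₀
        B = PathThrough.path (world rs) T-op
        bounded : ∀ b g → Ext ((T-op , b) ∷ rs , g₀ , g₁ , σ) b g → ∀ z → Approx (length g) z Z → ∀ V →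
                  V ∈ upto (eval (proj₁ (pick b a₀ a₁))) (length g) (g ∷ z) → ¬ Above x V
        bounded b g e z a V V∈ above = run do
          let u = queries (length g)
          (t ∷ zs) , at ← approx-exists (B ∷ world rs) u
          let σ≤g = subst (_≤ length g) (lengths val b) (⊑-length (Extension.prefix e))
              z≡ = approx-unique z (trunc (length g) (drop (length (sides rs)) zs)) Z a
                     (approx-trunc (drop (length (sides rs)) zs) Z (≤queries (length g)) (drop-approx rs zs (proj₂ at)))
              V∈′ = subst₂ (λ W y → V ∈ upto (eval W) (length g) (g ∷ y)) (sym (proj-pick b)) z≡ V∈
              V∈S = ∈-seetapun⁺ {sides rs} {j} {σ} {g₀} {g₁} {W₀} {W₁} {u} {t ∷ zs} b ≤-refl
                      (extension-to {z = t ∷ zs} {B ∷ world rs} at σ≤g ≤-refl e) V∈′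
          return (PathThrough.path-avoids (world rs) T-op inf u t zs at
            (upto⁺ (eval T-op) u (t ∷ zs) ≤-refl
              (subst (λ y → V ∈ eval T-op u y) (sym (trunc-id (t ∷ zs) (B ∷ world rs) at)) (∈-filter⁺ (above? x) V∈S above))))

      extend : Unbounded (compact none S []) (world rs) → ¬ ¬ (∃[ d′ ] Valid d′ × d ⊒ d′ × Answered r d′)
      extend unb = do
        -- `U` is good for the rows of both sides, since it is not known which side will list a part
        -- of it.
        U , (u , zs , at , U∈) , good ← fair val m N L fairZ (rows₀ ++ rows₁) wide (compact none S []) unb
        -- Every splitting is covered; the limit colouring itself is used, whose half `b` consists
        -- of points of limit colour `b`, as `coloured` demands.
        s , l , s≺ ← ≺-exists p u
        V , V∈S , V⊆U ← return (∈-compact⁻ {none} {S} {[]} {u} {zs} U∈ s (l , sym (take-[] u)) (λ V → upto-none u (s ∷ zs)))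
        v , v≤u , V∈v ← return (upto⁻ (eval S) u (s ∷ zs) V∈S)
        b , g , q , e , V∈g ← return (∈-seetapun⁻ {sides rs} {j} {σ} {g₀} {g₁} {W₀} {W₁} V∈v)
        let at′ : Approx v (trunc v (s ∷ zs)) (p ∷ world rs)
            at′ = approx-trunc (s ∷ zs) (p ∷ world rs) v≤u ((l , s≺) , at)
            σ≤g = subst (_≤ length g) (lengths val b) (⊑-length (Extension.prefix e))
            e′ = extension-from {z = trunc v (s ∷ zs)} {p ∷ world rs} at′ σ≤g q e
            h = choose b g (pad (length g) (side (not b) d))
        σ′ , l′ , val′ , le ← enlarge h val (h-length b g σ≤g) (h-ext b g σ≤g (extension-tail {p} {b} {rs} e′)) (h-col b g e′)
        return (_ , val′ , le , b , inj₁ (found b g v zs {σ′} {V} l′ (approx-trunc zs (world rs) v≤u at) q V∈g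
          (good-⊆ V⊆U (good-pick a₀ a₁ good b))))
        where
        upto-none : ∀ u z {V} → ¬ V ∈ upto (eval none) u z
        upto-none u z V∈ with _ , _ , () ← upto⁻ (eval none) u z V∈
        h-length : ∀ b g → length σ ≤ length g → ∀ c →
                   length (choose b g (pad (length g) (side (not b) d)) c) ≡ length g
        h-length false g le false = refl
        h-length false g le true  = length-pad {s = g₁} (subst (_≤ length g) (sym (lengths val true)) le)
        h-length true  g le false = length-pad {s = g₀} (subst (_≤ length g) (sym (lengths val false)) le)
        h-length true  g le true  = refl
        h-ext : ∀ b g → length σ ≤ length g → Ext d b g → ∀ c →
                Ext d c (choose b g (pad (length g) (side (not b) d)) c)
        h-ext false g le e false = e
        h-ext false g le e true  = extension-padded val le
        h-ext true  g le e false = extension-padded val le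
        h-ext true  g le e true  = e
        new-col : ∀ b g → Extension (p ∷ world rs) (b ∷ sides rs) σ j b (side b d) g →
                  ∀ {y} → T (bit g y) → Agrees b (p y)
        new-col b g e {y} t with y <? length (side b d) | y <? length g
        ... | yes y<₀ | _      = coloured val b (subst T (sym (⊑-bit (Extension.prefix e) y<₀)) t)
        ... | no y≮₀  | yes y< = proj₁ (proj₂ (Extension.inside e y< (≮⇒≥ y≮₀) t))
        ... | no _    | no y≮  = ⊥-elim (subst T (bit-beyond g (≮⇒≥ y≮)) t)
        h-col : ∀ b g → Extension (p ∷ world rs) (b ∷ sides rs) σ j b (side b d) g → ∀ c {y} →
                T (bit (choose b g (pad (length g) (side (not b) d)) c) y) → Agrees c (p y)
        h-col false g e false t = new-col false g e t
        h-col false g e true  t = coloured val true (proj₂ (bit-pad g₁ t))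
        h-col true  g e false t = coloured val false (proj₂ (bit-pad g₀ t))
        h-col true  g e true  t = new-col true g e t
        found : ∀ b g v zs {σ′ V} → length σ′ ≡ length g → Approx v (trunc v zs) (world rs) → queries (length g) ≤ v →
          V ∈ upto (eval (pick b W₀ W₁)) (length g) (g ∷ trunc (length g) (drop (length (sides rs)) (trunc v zs))) →
          Good L (proj₂ (pick b a₀ a₁)) V →
          let h = choose b g (pad (length g) (side (not b) d)) in
          Found r (rs , h false , h true , σ′) b
        found false g v zs {V = V} l at q V∈ good = V , _ ,
          approx-trunc (drop (length (sides rs)) (trunc v zs)) Z (≤-trans (≤queries _) q) (drop-approx rs (trunc v zs) at) , V∈ , good
        found true g v zs {V = V} l at q V∈ good = V , _ ,
          approx-trunc (drop (length (sides rs)) (trunc v zs)) Z (≤-trans (≤queries _) q) (drop-approx rs (trunc v zs) at) , V∈ , good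

    Proceed : ℕ → Cond → Cond → Set
    Proceed n d d′ = Valid d′ × d ⊒ d′ × suc (length (stem d)) ≤ length (stem d′) ×
                     (∀ r → code Request-countable r ≡ n → Admissible r → Answered r d′)

    private
      d₀ : Cond
      d₀ = [] , [] , [] , []

      valid-start : Valid d₀
      valid-start = record
        { lengths = λ { false → refl ; true → refl }
        ; stem≺ = λ _ ()
        ; coloured = λ { false () ; true () }
        ; self = λ { false → extension refl (λ ()) (λ ()) ; true → extension refl (λ ()) (λ ()) }
        ; infinite = λ w y₀ → do
            y , lt , al ← along-unending w y₀
            return (y , lt , ((λ ()) , tt) , al)
        ; fair = λ _ _ _ f → f
        }

      proceed-total : ∀ n d → Valid d → ¬ ¬ (∃[ d′ ] Proceed n d d′)
      proceed-total n d val = do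
        -- One padding bit per stage keeps the strings growing even when there is no request to
        -- answer.
        σ₁ , l₁ , val₁ , le₁ ← enlarge (λ b → pad (suc (length (stem d))) (side b d)) val
          (λ b → length-pad {s = side b d} (≤-trans (≤-reflexive (lengths val b)) (n≤1+n _)))
          (λ b → extension-padded val (n≤1+n _))
          (λ b t → coloured val b (proj₂ (bit-pad (side b d) t)))
        em (∃[ r ] code Request-countable r ≡ n × Admissible r) >>= λ where
          (no empty) → return (_ , val₁ , le₁ , ≤-reflexive (sym l₁) , λ r e ad → ⊥-elim (empty (r , e , ad)))
          (yes (r , e , ad)) → do
            d₂ , val₂ , le₂ , set ← settle r ad _ val₁
            return (d₂ , val₂ , ⊒-trans le₁ le₂ ,
              subst₂ _≤_ (trans (lengths val₁ false) l₁) (lengths val₂ false) (⊑-length (grows le₂ false)) ,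
              λ r′ e′ _ → subst (λ q → Answered q d₂) (injective Request-countable (trans e (sym e′))) set)

    open Chain Cond-countable Proceed d₀

    private
      proceed-grows : ∀ b n d d′ → Proceed n d d′ → side b d ⊑ side b d′
      proceed-grows b _ _ _ (_ , le , _) = grows le b

      module Lim (b : Bool) = Limit Cond-countable Proceed d₀ (side b) (proceed-grows b)

      valid : ∀ n {d} → Reached n d → Valid d
      valid = reached-invariant Valid valid-start proceed-total (λ _ → proj₁)

      total : ∀ n → ¬ ¬ (∃[ d ] Reached n d)
      total = reached-total Valid valid-start proceed-total (λ _ → proj₁)

      later : ∀ {m n d d′} → m ≤ n → Reached m d → Reached n d′ → d ⊒ d′
      later = along _⊒_ ⊒-refl ⊒-trans (proj₁ ∘ proj₂)

      long : ∀ n {d} b → Reached n d → n ≤ length (side b d)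
      long n {d} b r = subst (n ≤_) (sym (lengths (valid n r) b)) (go n r)
        where
        go : ∀ n {d} → Reached n d → n ≤ length (stem d)
        go zero    _                         = z≤n
        go (suc n) (_ , r , (_ , _ , l , _) , _) = ≤-trans (s≤s (go n r)) l

      later-ext : ∀ b m n d d′ → m ≤ n → Reached m d → Reached n d′ → Ext d b (side b d′)
      later-ext b m n d d′ m≤n r r′ = ext (later m≤n r r′) b (self (valid n r′) b)

    G : Bool → Pred₀
    G b = Lim.limit b

    private
      -- Unboundedness in terms of the conditions instead of `G b`, a form that contradicts
      -- `Bounded` at every stage.
      potent : Bool → Op → Set
      potent b W = ∀ n d → Reached n d → ∀ x → ¬ ¬ (∃[ g ] ∃[ z ] ∃[ V ]
        Ext d b g × Approx (length g) z Z × V ∈ upto (eval W) (length g) (g ∷ z) × Above x V)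

      Unmet : Bool → ℕ → Op → Rows → Set
      Unmet b L W rows = ∀ V → Enumerates W (G b ∷ Z) V → ¬ Good L rows V

      -- The two ways for a side to be useless, finite or unfair, are both cast as an unanswerable
      -- request, so that one request can combine the two sides.
      Fails : Bool → Set
      Fails b = ∃[ m ] ∀ N → ¬ ¬ (∃[ L₀ ] ∀ L → L₀ ≤ L →
        ¬ ¬ (∃[ W ] ∃[ rows ] Wide m N rows × potent b W × Unmet b L W rows))

      next-element : ∀ {d b y} → Valid d → length (stem d) ≤ y → Reservoir d y →
                     Ext d b (pad y (side b d) ++ true ∷ [])
      next-element {d} {b} {y} val le (thin , ins) = extension
        (⊑-trans {t = pad y (side b d)} (take-++ (side b d)) (take-++ (pad y (side b d))))
        (λ {i} _ l t → case bit-snoc⁻ (pad y (side b d)) {true} {i} t of λ where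
          (inj₁ (_ , t′)) → ⊥-elim (≤⇒≯ l (proj₁ (bit-pad (side b d) t′)))
          (inj₂ e)        → subst (Reservoir d) (sym (trans e len)) (thin , ins))
        (λ {i} _ {x} x<i s t → case bit-snoc⁻ (pad y (side b d)) {true} {x} s of λ where
          (inj₂ e)        → ⊥-elim (past i x<i e t)
          (inj₁ (_ , s′)) → hom i x x<i (bit-pad (side b d) s′) (bit-snoc⁻ (pad y (side b d)) {true} {i} t))
        where
        len : length (pad y (side b d)) ≡ y
        len = length-pad {s = side b d} (subst (_≤ y) (sym (lengths val b)) le)
        past : ∀ i {x} → x < i → x ≡ length (pad y (side b d)) → ¬ T (bit (pad y (side b d) ++ true ∷ []) i)
        past i x<i refl t = subst T (bit-beyond (pad y (side b d) ++ true ∷ [])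
          (subst (_≤ i) (sym (length-snoc (pad y (side b d)))) x<i)) t
        hom : ∀ i x → x < i → x < length (side b d) × T (bit (side b d) x) →
          ((i < length (pad y (side b d)) × T (bit (pad y (side b d)) i)) ⊎ i ≡ length (pad y (side b d))) →
          Agrees b (colour (world (proj₁ d)) j x i)
        hom i x x<i (_ , s) (inj₁ (_ , t)) with i< , t′ ← bit-pad (side b d) t =
          Extension.homog (self val b) i< x<i s t′
        hom i x x<i (x< , s) (inj₂ e) rewrite trans e len =
          subst (λ c → Agrees c (colour (world (proj₁ d)) j x y))
            (agrees-unique (bit (stem d) x) b (stem≺ val x x<σ) (coloured val b s)) (thin x<σ)
          where
          x<σ : x < length (stem d)
          x<σ = subst (x <_) (lengths val b) x<

      -- With no rows every set is good, so the request merely asks for an element above y₀: the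
      -- reservoir always offers one, while `G b` has none.
      finite-fails : ∀ b → ¬ Unending (G b) → ¬ ¬ Fails b
      finite-fails b fin = do
        y₀ , stop ← ¬∀⇒∃¬ fin (λ _ q k → q λ h → h k)
        return (0 , λ N → return (0 , λ L _ → return (beyond (suc y₀) , [] , (z≤n , []) , pot y₀ , λ V en _ → none-found y₀ stop V en)))
        where
        pot : ∀ y₀ → potent b (beyond (suc y₀))
        pot y₀ n d r x = do
          y , lt , res , _ ← infinite (valid n r) 0 (y₀ ⊔ length (stem d))
          let pd = pad y (side b d)
              g  = pd ++ true ∷ []
              len : length pd ≡ y
              len = length-pad {s = side b d} (subst (_≤ y) (sym (lengths (valid n r) b)) (<⇒≤ (≤-trans (s≤s (m≤n⊔m y₀ _)) lt)))
          z , a ← approx-exists Z (length g)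
          return (g , z , [] , next-element (valid n r) (<⇒≤ (≤-trans (s≤s (m≤n⊔m y₀ _)) lt)) res , a ,
            upto⁺ (eval (beyond (suc y₀))) (length g) (g ∷ z) ≤-refl
              (subst (λ q → [] ∈ eval (beyond (suc y₀)) (length g) (q ∷ trunc (length g) z)) (sym (take-all (length g) g ≤-refl))
                (∈-map⁺ (λ _ → []) (∈-filter⁺ (λ i → _ ≤? i ×-dec T? (bit g i)) (∈-upTo⁺ (≤-reflexive (sym (length-snoc pd))))
                  (subst (suc y₀ ≤_) (sym len) (≤-trans (s≤s (m≤m⊔n y₀ _)) lt) ,
                   subst T (sym (bit-snoc pd)) tt)))) , [])
        none-found : ∀ y₀ → ¬ ¬ ¬ (∃[ y ] y₀ < y × G b y) → ∀ V → ¬ Enumerates (beyond (suc y₀)) (G b ∷ Z) V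
        none-found y₀ stop V (u , (s ∷ z) , ((l , s≺) , _) , V∈)
          with i , i∈ , _ ← ∈-map⁻ (λ _ → []) V∈
          with i∈′ , y₀<i , t ← ∈-filter⁻ (λ i → _ ≤? i ×-dec T? (bit s i)) {xs = upTo u} i∈ =
          stop λ absent → subst (λ c → Agrees c (G b i)) (T⇒≡ t) (s≺ i (subst (i <_) (sym l) (∈-upTo⁻ i∈′)))
            λ g → absent (i , y₀<i , g)
          where
          T⇒≡ : ∀ {c} → T c → c ≡ true
          T⇒≡ {true} _ = refl

      unfair-fails : ∀ b → ¬ Fair (G b ∷ Z) → ¬ ¬ Fails b
      unfair-fails b unfair = do
        m , no-m ← ¬∀⇒∃¬ {Q = λ m → ¬ ¬ (∃[ N ] ∀ L₀ → ¬ ¬ (∃[ L ] L₀ ≤ L × FairAt m N L (G b ∷ Z)))} unfair (λ _ q k → q λ h → h k)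
        return (m , λ N → do
          L₀ , no-L ← ¬∀⇒∃¬ {Q = λ L₀ → ¬ ¬ (∃[ L ] L₀ ≤ L × FairAt m N L (G b ∷ Z))}
                        (λ all → no-m (return (N , all))) (λ _ q k → q λ h → h k)
          return (L₀ , λ L le → refute m N L (λ at → no-L (return (L , le , at)))))
        where
        -- What is listed from `G b` is listed from its side in a late enough condition, and that
        -- side is an extension for `d`.
        transfer : ∀ W n d → Reached n d → ∀ x V u s z → length s ≡ u → s ≺ G b → Approx u z Z →
          V ∈ eval W u (s ∷ z) → Above x V → ∀ d′ → Reached (n ⊔ u) d′ →
          ¬ ¬ (∃[ g ] ∃[ z ] ∃[ V ] Ext d b g × Approx (length g) z Z × V ∈ upto (eval W) (length g) (g ∷ z) × Above x V)
        transfer W n d r x V u s z l s≺ a V∈ above d′ r′ stop = approx-exists Z (length (side b d′)) λ (z′ , a′) →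
          stop (side b d′ , z′ , V , later-ext b n (n ⊔ u) d d′ (m≤m⊔n n u) r r′ , a′ ,
            upto⁺ (eval W) (length (side b d′)) (side b d′ ∷ z′) u≤g (subst₂ (λ q y → V ∈ eval W u (q ∷ y)) s≡
              (approx-unique z (trunc u z′) Z a (approx-trunc z′ Z u≤g a′)) V∈) , above)
          where
          u≤g : u ≤ length (side b d′)
          u≤g = ≤-trans (m≤n⊔m n u) (long (n ⊔ u) b r′)
          s≡ : s ≡ take u (side b d′)
          s≡ = ≺-unique {s} {take u (side b d′)} {G b} (trans l (sym (length-take-≤ (side b d′) u≤g))) s≺
                 (≺-take u (Lim.reached-≺ b (n ⊔ u) r′))
        pot : ∀ W → Unbounded W (G b ∷ Z) → potent b W
        pot W unb n d r x = unb x >>= λ where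
          (V , (u , (s ∷ z) , ((l , s≺) , a) , V∈) , above) →
            total (n ⊔ u) >>= λ (d′ , r′) → transfer W n d r x V u s z l s≺ a V∈ above d′ r′
        refute : ∀ m N L → ¬ FairAt m N L (G b ∷ Z) →
                 ¬ ¬ (∃[ W ] ∃[ rows ] Wide m N rows × potent b W × Unmet b L W rows)
        refute m N L not-fair stop = not-fair λ rows wide W unb unmet →
          stop (W , rows , wide , pot W unb , λ V en good → unmet (V , en , good))

    Solves : Bool → Set
    Solves b = Unending (G b) × Fair (G b ∷ Z)

    some-side-solves : Fair Z → ¬ ¬ (∃[ b ] Solves b)
    some-side-solves fairZ none-solves = run do
      m₀ , f₀ ← fails false
      m₁ , f₁ ← fails true
      N , h ← fairZ (m₀ + m₁)
      L₀ , g₀ ← f₀ N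
      L₁ , g₁ ← f₁ N
      -- A level at which both sides fail, while the base world is fair to the requests of both
      -- together.
      L , le , at ← h (L₀ ⊔ L₁)
      W₀ , rows₀ , (len₀ , wide₀) , pot₀ , unmet₀ ← g₀ L (≤-trans (m≤m⊔n L₀ L₁) le)
      W₁ , rows₁ , (len₁ , wide₁) , pot₁ , unmet₁ ← g₁ L (≤-trans (m≤n⊔m L₀ L₁) le)
      let r = L , (W₀ , rows₀) , (W₁ , rows₁)
          n = code Request-countable r
      d , reached@(_ , _ , (_ , _ , _ , settled) , _) ← total (suc n)
      return (conclude (suc n) r d reached (λ { false → pot₀ ; true → pot₁ }) (λ { false → unmet₀ ; true → unmet₁ })
        (settled r refl (_ , N , at ,
          subst (_≤ _) (sym (length-++ rows₀)) (+-mono-≤ len₀ len₁) , All.++⁺ wide₀ wide₁)))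
      where
      fails : ∀ b → ¬ ¬ Fails b
      fails b = em (Unending (G b)) >>= λ where
        (no ¬u) → finite-fails b ¬u
        (yes u) → unfair-fails b λ fair → none-solves (b , u , fair)
      conclude : ∀ n r d → Reached n d → (∀ b → potent b (proj₁ (ask b r))) →
                 (∀ b → Unmet b (proj₁ r) (proj₁ (ask b r)) (proj₂ (ask b r))) → ¬ Answered r d
      conclude n r d reached pot unmet (b , inj₁ (V , z , a , V∈ , good)) =
        unmet b V (upto-enumerates (proj₁ (ask b r)) (length (side b d)) (side b d ∷ z) {G b ∷ Z}
          ((refl , Lim.reached-≺ b n reached) , a) V∈) good
      conclude n r d reached pot unmet (b , inj₂ (x , bounded)) =
        pot b n d reached x λ (g , z , V , e , a , V∈ , above) → bounded g e z a V V∈ above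

    G-homogeneous : ∀ b {x y} → x < y → G b x → G b y → Agrees b (colour Z j x y)
    G-homogeneous b {x} {y} x<y (n , d , r , x< , s) (n′ , d′ , r′ , y< , t) = agrees-stable b do
      d″ , r″ ← total (n ⊔ n′)
      let e  = self (valid (n ⊔ n′) r″) b
          p₁ = Lim.reached-⊑ b (m≤m⊔n n n′) r r″
          p₂ = Lim.reached-⊑ b (m≤n⊔m n n′) r′ r″
      return (subst (λ C → Agrees b (C (pair (pair x y) 1))) (col-world (proj₁ d″))
        (Extension.homog e (≤-trans y< (⊑-length p₂)) x<y (subst T (⊑-bit p₁ x<) s) (subst T (⊑-bit p₂ y<) t)))

    -- Which side solves is known only under double negation, whereas the model needs one definite
    -- column; so the case distinction is part of the predicate.
    homogeneous : Pred₀
    homogeneous y = (Solves false × G false y) ⊎ (¬ Solves false × G true y)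

    private
      homogeneous≡side : Fair Z → ¬ ¬ (∃[ b ] Solves b × (∀ y → homogeneous y → G b y) × (∀ y → G b y → homogeneous y))
      homogeneous≡side fairZ = em (Solves false) >>= λ where
        (yes s) → return (false , s , (λ { y (inj₁ (_ , g)) → g ; y (inj₂ (¬s , _)) → ⊥-elim (¬s s) }) , λ y g → inj₁ (s , g))
        (no ¬s) → some-side-solves fairZ >>= λ where
          (false , s) → ⊥-elim (¬s s)
          (true , s)  → return (true , s , (λ { y (inj₁ (s₀ , _)) → ⊥-elim (¬s s₀) ; y (inj₂ (_ , g)) → g }) , λ y g → inj₂ (¬s , g))

    homogeneous-unending : Fair Z → Unending homogeneous
    homogeneous-unending fairZ y₀ = do
      b , (unending , _) , _ , to ← homogeneous≡side fairZ
      y , lt , g ← unending y₀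
      return (y , lt , to y g)

    homogeneous-coloured : Fair Z →
      ¬ ¬ (∃[ b ] ∀ x y → x < y → homogeneous x → homogeneous y → Agrees b (colour Z j x y))
    homogeneous-coloured fairZ = do
      b , _ , from , _ ← homogeneous≡side fairZ
      return (b , λ x y x<y hx hy → G-homogeneous b x<y (from x hx) (from y hy))

    homogeneous-fair : Fair Z → Fair (homogeneous ∷ Z)
    homogeneous-fair fairZ m = do
      b , (_ , fair) , from , to ← homogeneous≡side fairZ
      fair-mono (λ m N L → fairAt-resp {G b} {homogeneous} {Z} (λ y g → return (to y g)) (λ y h → return (from y h))) fair m

  bit-applyUpTo : ∀ f v {i} → i < v → bit (applyUpTo f v) i ≡ f i
  bit-applyUpTo f (suc v) {zero}  _         = refl
  bit-applyUpTo f (suc v) {suc i} (s≤s i<v) = bit-applyUpTo (f ∘ suc) v i<v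

  ∀<-eventually : (Q : ℕ → ℕ → Set) (n : ℕ) → (∀ i → i < n → ¬ ¬ (∃[ u₀ ] ∀ u → u₀ ≤ u → Q i u)) →
                  ¬ ¬ (∃[ u₀ ] ∀ u → u₀ ≤ u → ∀ i → i < n → Q i u)
  ∀<-eventually Q zero    q = return (0 , λ _ _ _ ())
  ∀<-eventually Q (suc n) q = do
    u₁ , p₁ ← ∀<-eventually Q n (λ i i<n → q i (m≤n⇒m≤1+n i<n))
    u₂ , p₂ ← q n ≤-refl
    return (u₁ ⊔ u₂ , λ u le i i<1+n → case m≤n⇒m<n∨m≡n i<1+n of λ where
      (inj₁ (s≤s i<n)) → p₁ u (≤-trans (m≤m⊔n u₁ u₂) le) i i<n
      (inj₂ refl)      → p₂ u (≤-trans (m≤n⊔m u₁ u₂) le))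

  -- Recursive comprehension
  module Recursive (Z : World) (θ θ′ : BF) (ρ : List ℕ)
    (σ⇒π : ∀ x y → ⟦ θ ⟧ᵇ (y ∷ x ∷ ρ) Z → ∀ y′ → ¬ ¬ ⟦ θ′ ⟧ᵇ (y′ ∷ x ∷ ρ) Z)
    (π⇒σ : ∀ x → (∀ y → ⟦ θ′ ⟧ᵇ (y ∷ x ∷ ρ) Z) → ¬ ¬ (∃[ y ] ⟦ θ ⟧ᵇ (y ∷ x ∷ ρ) Z))
    (stable : ∀ x y → ¬ ¬ ⟦ θ′ ⟧ᵇ (y ∷ x ∷ ρ) Z → ⟦ θ′ ⟧ᵇ (y ∷ x ∷ ρ) Z)
    where

    recursive : Pred₀
    recursive x = ∃[ y ] ⟦ θ ⟧ᵇ (y ∷ x ∷ ρ) Z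

    private
      open Delta θ θ′ ρ

      guess-≺ : ∀ {u v} z → Approx u z Z → Decided u z v → guess u z v ≺ recursive
      guess-≺ {u} {v} z a dec i i<
        with i<v ← subst (i <_) (length-applyUpTo (λ x → does (yes? u z x)) v) i<
        rewrite bit-applyUpTo (λ x → does (yes? u z x)) v i<v
        with yes? u z i | dec i<v
      ... | yes (y , _ , le , t) | _                   = return (y , ⟦⟧ᵇ-from a θ _ le t)
      ... | no ¬y                | inj₁ y              = ⊥-elim (¬y y)
      ... | no _                 | inj₂ (y , _ , le , ¬t) = λ (y′ , t) → σ⇒π i y′ t y (¬t ∘ ⟦⟧ᵇ-to a θ′ _ le)

      decided-eventually : ∀ x → ¬ ¬ (∃[ u₀ ] ∀ u → u₀ ≤ u → ∀ z → Approx u z Z → Yes u z x ⊎ No u z x)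
      decided-eventually x = em (recursive x) >>= λ where
        (yes (y , t)) → return (suc y ⊔ use θ (y ∷ x ∷ ρ) , λ u le z a → inj₁ (y , ≤-trans (m≤m⊔n (suc y) (use θ (y ∷ x ∷ ρ))) le ,
          ≤-trans (m≤n⊔m (suc y) (use θ (y ∷ x ∷ ρ))) le , ⟦⟧ᵇ-to a θ _ (≤-trans (m≤n⊔m (suc y) (use θ (y ∷ x ∷ ρ))) le) t))
        (no ¬r) → do
          y , ¬t ← ¬∀⇒∃¬ (λ all → π⇒σ x all ¬r) (stable x)
          return (suc y ⊔ use θ′ (y ∷ x ∷ ρ) , λ u le z a → inj₂ (y , ≤-trans (m≤m⊔n (suc y) (use θ′ (y ∷ x ∷ ρ))) le ,
            ≤-trans (m≤n⊔m (suc y) (use θ′ (y ∷ x ∷ ρ))) le , ¬t ∘ ⟦⟧ᵇ-from a θ′ _ (≤-trans (m≤n⊔m (suc y) (use θ′ (y ∷ x ∷ ρ))) le)))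

    -- Every segment of the recursive set is eventually decided, so `delta` lists from `Z` just what
    -- `W` lists from the set added to `Z`.
    recursive-fairAt : ∀ {m N L} → FairAt m N L Z → FairAt m N L (recursive ∷ Z)
    recursive-fairAt fair rows wide W unb = do
      V , (u , z , a , V∈) , good ← fair rows wide (delta θ θ′ ρ W) unb′
      return (V , pull u z a V∈ , good)
      where
      pull : ∀ u z {V} → Approx u z Z → V ∈ eval (delta θ θ′ ρ W) u z → Enumerates W (recursive ∷ Z) V
      pull u z {V} a V∈
        with v , v∈ , V∈′ ← find (∈-concatMap⁻ (λ v → eval W v (guess u z v ∷ trunc v z)) V∈)
        with v∈′ , dec ← ∈-filter⁻ (decided? u z) {xs = upTo (suc u)} v∈ =
        v , guess u z v ∷ trunc v z ,
        ((length-applyUpTo (λ x → does (yes? u z x)) v , guess-≺ z a dec) , approx-trunc z Z (≤-pred (∈-upTo⁻ v∈′)) a) , V∈′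
      push : ∀ u z v t z′ {V} → Approx u z Z → v ≤ u → Decided u z v → length t ≡ v → t ≺ recursive → Approx v z′ Z →
             V ∈ eval W v (t ∷ z′) → V ∈ eval (delta θ θ′ ρ W) u z
      push u z v t z′ {V} a v≤u dec l t≺ a′ V∈ = ∈-concatMap⁺ (λ v → eval W v (guess u z v ∷ trunc v z))
        (lose (∈-filter⁺ (decided? u z) (∈-upTo⁺ (s≤s v≤u)) dec)
          (subst₂ (λ q y → V ∈ eval W v (q ∷ y))
            (≺-unique {t} {guess u z v} {recursive} (trans l (sym (length-applyUpTo (λ x → does (yes? u z x)) v))) t≺ (guess-≺ z a dec))
            (approx-unique z′ (trunc v z) Z a′ (approx-trunc z Z v≤u a)) V∈))
      unb′ : Unbounded (delta θ θ′ ρ W) Z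
      unb′ x = do
        V , (v , (t ∷ z′) , ((l , t≺) , a′) , V∈) , above ← unb x
        u₀ , dec ← ∀<-eventually (λ x u → ∀ z → Approx u z Z → Yes u z x ⊎ No u z x) v (λ i _ → decided-eventually i)
        z , a ← approx-exists Z (u₀ ⊔ v)
        return (V , (u₀ ⊔ v , z , a , push (u₀ ⊔ v) z v t z′ a (m≤n⊔m u₀ v)
          (λ {x} x<v → dec (u₀ ⊔ v) (m≤m⊔n u₀ v) x x<v z a) l t≺ a′ V∈) , above)

-- The generic stable colouring.

module StableColouring (cell : ℕ → ℕ → Str) (ℓ : ℕ) (Vtx : ℕ → Set) where
  open Operators cell

  k : ℕ
  k = suc ℓ

  nth-++ˡ : ∀ {i} s {t} → i < length s → nth (s ++ t) i ≡ nth s i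
  nth-++ˡ {zero}  (b ∷ s) _         = refl
  nth-++ˡ {suc i} (b ∷ s) (s≤s i<) = nth-++ˡ s i<

  nth-++ʳ : ∀ s {t} i → nth (s ++ t) (length s + i) ≡ nth t i
  nth-++ʳ []      i = refl
  nth-++ʳ (b ∷ s) i = nth-++ʳ s i

  nth-take : ∀ {v i} s → i < v → nth (take v s) i ≡ nth s i
  nth-take {suc v} {i}     []      _         = refl
  nth-take {suc v} {zero}  (b ∷ s) _         = refl
  nth-take {suc v} {suc i} (b ∷ s) (s≤s i<v) = nth-take s i<v

  nth-⊑ : ∀ {s t i} → s ⊑ t → i < length s → nth t i ≡ nth s i
  nth-⊑ {s} {t} {i} e i< = trans (sym (nth-take t i<)) (cong (λ r → nth r i) e)

  nth-applyUpTo : ∀ f v {i} → i < v → nth (applyUpTo f v) i ≡ f i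
  nth-applyUpTo f (suc v) {zero}  _         = refl
  nth-applyUpTo f (suc v) {suc i} (s≤s i<v) = nth-applyUpTo (f ∘ suc) v i<v

  nth-All : ∀ {Q : ℕ → Set} {s i} → Q 0 → All Q s → Q (nth s i)
  nth-All q []               = q
  nth-All {i = zero}  q (p ∷ _)  = p
  nth-All {i = suc i} q (_ ∷ ps) = nth-All {i = i} q ps

  length-insert : ∀ {A : Set} (ys : List A) {τ zs} → length (ys ++ τ ∷ zs) ≡ suc (length (ys ++ zs))
  length-insert ys {τ} {zs} = trans (length-++ ys) (trans (+-suc (length ys) (length zs)) (cong suc (sym (length-++ ys))))

  -- On a hit one occurrence of `τ` is struck from `avoid`; what is found in the tail differs from
  -- `τ` by uniqueness, so the struck entry is avoided as well.
  escape : ∀ {A : Set} (r avoid : List A) → (∀ (x y : A) → Dec (x ≡ y)) → Unique r → length avoid < length r →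
           ∃[ τ ] τ ∈ r × τ ∉ avoid
  escape (τ ∷ r) avoid _≟_ (τ≢ ∷ uniq) lt with Any.any? (τ ≟_) avoid
  ... | no τ∉ = τ , here refl , τ∉
  ... | yes τ∈ with ys , zs , refl ← ∈-∃++ τ∈
               with τ′ , τ′∈ , τ′∉ ← escape r (ys ++ zs) _≟_ uniq (≤-pred (subst (_< suc (length r)) (length-insert ys) lt)) =
    τ′ , there τ′∈ , λ τ′∈avoid → case ∈-++⁻ ys τ′∈avoid of λ where
      (inj₁ p)           → τ′∉ (∈-++⁺ˡ p)
      (inj₂ (here refl)) → All.lookup τ≢ τ′∈ refl
      (inj₂ (there p))   → τ′∉ (∈-++⁺ʳ ys p)

  -- Greedy choice: a row at least as long as the number of remaining rows plus the cells in use
  -- always has a fresh cell, and on distinct cells different colours do not conflict. All other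
  -- cells get colour 0.
  representatives : ∀ (rows : List (ℕ × List Str)) (avoid : List Str) →
    All (λ (c , r) → c < k × Unique r × length rows + length avoid ≤ length r) rows →
    Σ[ γ ∈ (Str → ℕ) ] (∀ τ → γ τ < k) × All (λ (c , r) → ∃[ τ ] τ ∈ r × τ ∉ avoid × γ τ ≡ c) rows
  representatives [] avoid [] = (λ _ → 0) , (λ _ → s≤s z≤n) , []
  representatives ((c , r) ∷ rows) avoid ((c<k , uniq , le) ∷ wide)
    with τ , τ∈ , τ∉ ← escape r avoid _≟ˢ_ uniq (≤-trans (s≤s (m≤n+m (length avoid) (length rows))) le)
    with γ , γ<k , reps ← representatives rows (τ ∷ avoid)
           (All.map (λ {(_ , r)} (c<k , uniq , le) → c<k , uniq , subst (_≤ length r) (sym (+-suc (length rows) (length avoid))) le) wide) =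
    γ′ , γ′<k , (τ , τ∈ , τ∉ , cong (λ b → if b then c else γ τ) (dec-true (τ ≟ˢ τ) refl)) ∷
    All.map (λ (τ′ , τ′∈ , τ′∉ , e) → τ′ , τ′∈ , τ′∉ ∘ there ,
      trans (cong (λ b → if b then c else γ τ′) (dec-false (τ′ ≟ˢ τ) (τ′∉ ∘ here))) e) reps
    where
    γ′ : Str → ℕ
    γ′ σ = if does (σ ≟ˢ τ) then c else γ σ
    γ′<k : ∀ σ → γ′ σ < k
    γ′<k σ with does (σ ≟ˢ τ)
    ... | true  = c<k
    ... | false = γ<k σ

  -- A condition (e , p): e colours the pairs with code below |e|, and every
  -- later pair a < b with a < |p| must get colour p(a).
  Cond : Set
  Cond = List ℕ × List ℕ

  Cond-countable : Countable Cond
  Cond-countable = List-countable ℕ-countable ×-countable List-countable ℕ-countable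

  record _⊒_ (d d′ : Cond) : Set where
    field
      edges  : proj₁ d ⊑ proj₁ d′
      limits : proj₂ d ⊑ proj₂ d′
      obeys  : ∀ {a b} → length (proj₁ d) ≤ pair a b → pair a b < length (proj₁ d′) →
               a < length (proj₂ d) → nth (proj₁ d′) (pair a b) ≡ nth (proj₂ d) a
  open _⊒_

  ⊒-refl : ∀ {d} → d ⊒ d
  ⊒-refl = record { edges = ⊑-refl ; limits = ⊑-refl ; obeys = λ le lt → ⊥-elim (≤⇒≯ le lt) }

  ⊒-trans : ∀ {d d′ d″} → d ⊒ d′ → d′ ⊒ d″ → d ⊒ d″
  ⊒-trans {d} {d′} {d″} q r = record
    { edges  = ⊑-trans (edges q) (edges r)
    ; limits = ⊑-trans (limits q) (limits r)
    ; obeys  = λ {a} {b} le lt a< → case pair a b <? length (proj₁ d′) of λ where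
        (yes lt′) → trans (nth-⊑ (edges r) lt′) (obeys q {a} {b} le lt′ a<)
        (no nlt)  → trans (obeys r {a} {b} (≮⇒≥ nlt) lt (≤-trans a< (⊑-length (limits q)))) (nth-⊑ (limits q) a<)
    }

  Valid : Cond → Set
  Valid (e , p) = All (_< k) e × All (_< k) p

  Graph : List ℕ → Pred₀
  Graph e x = ∃[ a ] ∃[ b ] ∃[ c ] x ≡ pair (pair a b) c × a < b × Vtx a × Vtx b ×
              pair a b < length e × nth e (pair a b) ≡ c

  -- Bits below the length of `e` are settled by `e`, because the code of a pair together with its
  -- colour is at least the code of the pair.
  Lists : Op → List ℕ → List ℕ → Set
  Lists W e V = ∃[ s ] length s ≤ length e × s ≺ Graph e × V ∈ eval W (length s) (s ∷ [])

  Request : Set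
  Request = ℕ × List (ℕ × List Str) × Op

  Request-countable : Countable Request
  Request-countable = ℕ-countable ×-countable List-countable (ℕ-countable ×-countable List-countable Str-countable) ×-countable Op-countable

  Met : Request → Cond → Set
  Met (L , rows , W) (e , p) = ∃[ V ] Lists W e V ×
    All (λ (c , r) → ∃[ τ ] τ ∈ r × (∀ v → v ∈ V → cell L v ≡ τ → v < length p × nth p v ≡ c)) rows

  Refused : Request → Cond → Set
  Refused (L , rows , W) d = ∃[ x ] ∀ d′ → d ⊒ d′ → Valid d′ → ∀ V → Lists W (proj₁ d′) V → ¬ Above x V

  Admissible : Request → Set
  Admissible (L , rows , W) = All (λ (c , r) → c < k × Unique r × length rows ≤ length r) rows

  Proceed : ℕ → Cond → Cond → Set
  Proceed n d d′ = Valid d′ × d ⊒ d′ × suc (length (proj₁ d)) ≤ length (proj₁ d′) ×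
                   suc (length (proj₂ d)) ≤ length (proj₂ d′) ×
                   (∀ r → code Request-countable r ≡ n → Admissible r → Met r d′ ⊎ Refused r d′)

  private
    add-limits : ∀ {e p q} → All (_< k) q → Valid (e , p) → Valid (e , p ++ q) × (e , p) ⊒ (e , p ++ q)
    add-limits {e} {p} q<k (ve , vp) = (ve , All.++⁺ vp q<k) , record
      { edges = ⊑-refl ; limits = take-++ p ; obeys = λ le lt → ⊥-elim (≤⇒≯ le lt) }

    add-edge : ∀ {e p} → Valid (e , p) → ¬ ¬ (∃[ c ] Valid (e ++ c ∷ [] , p) × (e , p) ⊒ (e ++ c ∷ [] , p))
    add-edge {e} {p} (ve , vp) = em (∃[ a ] ∃[ b ] pair a b ≡ length e) >>= λ where
        -- Past its end `nth` yields 0, also a legal colour, which serves vertices without a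
        -- promised limit.
        (yes (a , b , eq)) → return (nth p a , (All.++⁺ ve (nth-All {s = p} {a} (s≤s z≤n) vp ∷ []) , vp) , record
          { edges = take-++ e ; limits = ⊑-refl
          ; obeys = λ {a′} {b′} le lt _ → let
              at : pair a′ b′ ≡ length e
              at = ≤-antisym (≤-pred (subst (pair a′ b′ <_) (length-snoc e) lt)) le
            in trans (trans (cong (nth (e ++ nth p a ∷ [])) at) (last e)) (cong (nth p) (proj₁ (pair-injective {a} {b} {a′} {b′} (trans eq (sym at))))) })
        (no none′) → return (0 , (All.++⁺ ve (s≤s z≤n ∷ []) , vp) , record
          { edges = take-++ e ; limits = ⊑-refl
          ; obeys = λ {a′} {b′} le lt _ → ⊥-elim (none′ (a′ , b′ , ≤-antisym (≤-pred (subst (pair a′ b′ <_) (length-snoc e) lt)) le)) })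
      where
      last : ∀ e {c} → nth (e ++ c ∷ []) (length e) ≡ c
      last e {c} = trans (cong (nth (e ++ c ∷ [])) (sym (+-identityʳ (length e)))) (nth-++ʳ e 0)

    bound : (V : List ℕ) → ∃[ M ] ∀ v → v ∈ V → v < M
    bound []      = 0 , λ _ ()
    bound (v ∷ V) with M , f ← bound V = suc v ⊔ M , λ where
      w (here refl) → m≤m⊔n (suc w) M
      w (there w∈)  → ≤-trans (f w w∈) (m≤n⊔m (suc v) M)

    -- If an extension lists a set above the length of `p`, its edges are kept and its limits
    -- discarded: listing depends on the edges alone, and the limits of the listed vertices, none of
    -- them promised by `p`, are prescribed by `γ` cell by cell.
    settle : ∀ r → Admissible r → ∀ d → Valid d → ¬ ¬ (∃[ d′ ] Valid d′ × d ⊒ d′ × (Met r d′ ⊎ Refused r d′))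
    settle r@(L , rows , W) ad d@(e , p) val =
      em (∃[ d′ ] d ⊒ d′ × Valid d′ × (∃[ V ] Lists W (proj₁ d′) V × Above (length p) V)) >>= λ where
        (no refused) → return (d , val , ⊒-refl , inj₂ (length p , λ d′ le val′ V ls ab → refused (d′ , le , val′ , V , ls , ab)))
        (yes ((e′ , p′) , le , (ve′ , _) , V , ls , above)) → return (meet e′ p′ le ve′ V ls above
          (representatives rows [] (All.map (λ {(_ , r)} (q₁ , q₂ , q₃) → q₁ , q₂ , subst (_≤ length r) (sym (+-identityʳ (length rows))) q₃) ad)))
      where
      meet : ∀ e′ p′ → d ⊒ (e′ , p′) → All (_< k) e′ → ∀ V → Lists W e′ V → Above (length p) V →
        Σ[ γ ∈ (Str → ℕ) ] (∀ τ → γ τ < k) × All (λ (c , r) → ∃[ τ ] τ ∈ r × τ ∉ [] × γ τ ≡ c) rows →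
        ∃[ d″ ] Valid d″ × d ⊒ d″ × (Met r d″ ⊎ Refused r d″)
      meet e′ p′ le ve′ V ls above (γ , γ<k , reps) with M , V<M ← bound V =
        (e′ , p ++ q) , proj₁ longer , ⊒-trans le′ (proj₂ longer) , inj₁ (V , ls ,
          All.map (λ (τ , τ∈ , _ , eq) → τ , τ∈ , λ v v∈ cell≡ → coloured v v∈ (trans (cong γ cell≡) eq)) reps)
        where
        f : ℕ → ℕ
        f i = γ (cell L (length p + i))
        q : List ℕ
        q = applyUpTo f M
        le′ : d ⊒ (e′ , p)
        le′ = record { edges = edges le ; limits = ⊑-refl ; obeys = λ {a} {b} → obeys le {a} {b} }
        longer : Valid (e′ , p ++ q) × (e′ , p) ⊒ (e′ , p ++ q)
        longer = add-limits (All.applyUpTo⁺₂ f M (λ _ → γ<k _)) (ve′ , proj₂ val)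
        coloured : ∀ v {c} → v ∈ V → γ (cell L v) ≡ c → v < length (p ++ q) × nth (p ++ q) v ≡ c
        coloured v v∈ eq = subst (v <_) (sym (length-++ p)) (subst (λ n → v < length p + n) (sym (length-applyUpTo f M))
            (≤-trans (V<M v v∈) (m≤n+m M (length p)))) ,
          trans (trans (cong (nth (p ++ q)) (sym v≡)) (trans (nth-++ʳ p (v ∸ length p))
            (nth-applyUpTo f M (≤-trans (s≤s (m∸n≤m v (length p))) (V<M v v∈))))) (trans (cong (γ ∘ cell L) v≡) eq)
          where
          v≡ : length p + (v ∸ length p) ≡ v
          v≡ = m+[n∸m]≡n (<⇒≤ (All.lookup above v∈))

    proceed-total : ∀ n d → Valid d → ¬ ¬ (∃[ d′ ] Proceed n d d′)
    proceed-total n (e , p) val = do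
      c , val₁ , le₁ ← add-edge {e} {p} val
      let val₂ , le₂ = add-limits {e ++ c ∷ []} {p} (s≤s z≤n ∷ []) val₁
          le₀ = ⊒-trans le₁ le₂
          d₁ = (e ++ c ∷ [] , p ++ 0 ∷ [])
          e< = ≤-reflexive (sym (length-snoc e))
          p< = ≤-reflexive (sym (length-snoc p))
      em (∃[ r ] code Request-countable r ≡ n × Admissible r) >>= λ where
        (no empty) → return (d₁ , val₂ , le₀ , e< , p< , λ r eq ad → ⊥-elim (empty (r , eq , ad)))
        (yes (r , eq , ad)) → do
          d₂ , val₃ , le₃ , done ← settle r ad d₁ val₂
          return (d₂ , val₃ , ⊒-trans le₀ le₃ , ≤-trans e< (⊑-length (edges le₃)) , ≤-trans p< (⊑-length (limits le₃)) ,
            λ r′ eq′ _ → subst (λ q → Met q d₂ ⊎ Refused q d₂) (injective Request-countable {r} {r′} (trans eq (sym eq′))) done)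

  open Chain Cond-countable Proceed ([] , [])

  F : Pred₀
  F x = ∃[ n ] ∃[ d ] Reached n d × Graph (proj₁ d) x

  P : ℕ → ℕ → Set
  P v c = ∃[ n ] ∃[ d ] Reached n d × v < length (proj₂ d) × nth (proj₂ d) v ≡ c

  private
    valid : ∀ n {d} → Reached n d → Valid d
    valid = reached-invariant Valid ([] , []) proceed-total (λ _ → proj₁)

    total : ∀ n → ¬ ¬ (∃[ d ] Reached n d)
    total = reached-total Valid ([] , []) proceed-total (λ _ → proj₁)

    later : ∀ {m n d d′} → m ≤ n → Reached m d → Reached n d′ → d ⊒ d′
    later = along _⊒_ ⊒-refl ⊒-trans (proj₁ ∘ proj₂)

    long : ∀ n {d} → Reached n d → n ≤ length (proj₁ d)
    long zero    _                                 = z≤n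
    long (suc n) (_ , r , (_ , _ , l , _) , _) = ≤-trans (s≤s (long n r)) l

    graph-later : ∀ {m n d d′ x} → m ≤ n → Reached m d → Reached n d′ → Graph (proj₁ d) x → Graph (proj₁ d′) x
    graph-later le r r′ (a , b , c , x≡ , a<b , va , vb , lt , eq) =
      a , b , c , x≡ , a<b , va , vb , ≤-trans lt (⊑-length (edges (later le r r′))) ,
      trans (nth-⊑ (edges (later le r r′)) lt) eq

    graph-earlier : ∀ {m n d d′ x} → m ≤ n → Reached m d → Reached n d′ → x < length (proj₁ d) →
                    Graph (proj₁ d′) x → Graph (proj₁ d) x
    graph-earlier {x = x} le r r′ x< (a , b , c , x≡ , a<b , va , vb , lt , eq) =
      a , b , c , x≡ , a<b , va , vb , lt′ , trans (sym (nth-⊑ (edges (later le r r′)) lt′)) eq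
      where lt′ = ≤-trans (s≤s (subst (pair a b ≤_) (sym x≡) (left≤pair (pair a b) c))) x<

    F⇒graph : ∀ n {d x} → Reached n d → x < length (proj₁ d) → F x → Graph (proj₁ d) x
    F⇒graph n r x< (n′ , d′ , r′ , g) with ≤-total n n′
    ... | inj₁ le = graph-earlier le r r′ x< g
    ... | inj₂ le = graph-later le r′ r g

  F-coloured : ∀ {x} → F x → ∃[ a ] ∃[ b ] ∃[ c ] x ≡ pair (pair a b) c × a < b × Vtx a × Vtx b × c < k
  F-coloured (n , d , r , a , b , c , x≡ , a<b , va , vb , _ , eq) =
    a , b , c , x≡ , a<b , va , vb , subst (_< k) eq (nth-All {s = proj₁ d} {pair a b} (s≤s z≤n) (proj₁ (valid n r)))

  F-total : ∀ {a b} → a < b → Vtx a → Vtx b → ¬ ¬ (∃[ c ] c < k × F (pair (pair a b) c))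
  F-total {a} {b} a<b va vb = do
    d , r ← total (suc (pair a b))
    return (nth (proj₁ d) (pair a b) , nth-All {s = proj₁ d} {pair a b} (s≤s z≤n) (proj₁ (valid _ r)) , suc (pair a b) , d , r , a , b , nth (proj₁ d) (pair a b) , refl , a<b , va , vb , long _ r , refl)

  F-unique : ∀ {a b c c′} → F (pair (pair a b) c) → F (pair (pair a b) c′) → c ≡ c′
  F-unique {a} {b} {c} {c′} (n , d , r , g) (n′ , d′ , r′ , g′) = go (≤-total n n′)
    where
    same : ∀ e {c c′} → Graph e (pair (pair a b) c) → Graph e (pair (pair a b) c′) → c ≡ c′
    same e {c} {c′} (a₁ , b₁ , c₁ , x≡ , _ , _ , _ , _ , eq) (a₂ , b₂ , c₂ , y≡ , _ , _ , _ , _ , eq′)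
      with p , refl ← pair-injective {pair a b} {c} {pair a₁ b₁} {c₁} x≡
      with q , refl ← pair-injective {pair a b} {c′} {pair a₂ b₂} {c₂} y≡
      with refl , refl ← pair-injective {a} {b} {a₁} {b₁} p
      with refl , refl ← pair-injective {a} {b} {a₂} {b₂} q = trans (sym eq) eq′
    go : n ≤ n′ ⊎ n′ ≤ n → c ≡ c′
    go (inj₁ le) = same (proj₁ d′) (graph-later {d = d} {d′} le r r′ g) g′
    go (inj₂ le) = same (proj₁ d) g (graph-later {d = d′} {d} le r′ r g′)

  -- A code is at least the larger vertex of its pair, so from y₀ on the pairs with `v` are coloured
  -- only after the limit of `v` was promised.
  P-limit : ∀ {v c} → P v c → ∃[ y₀ ] ∀ y → y₀ ≤ y → v < y → Vtx v → Vtx y → ¬ ¬ F (pair (pair v y) c)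
  P-limit {v} {c} (n , d , r , v< , eq) = length (proj₁ d) , λ y y₀≤y v<y vv vy → do
    d′ , r′ ← total (n ⊔ suc (pair v y))
    let lt = ≤-trans (m≤n⊔m n (suc (pair v y))) (long _ r′)
        le = later (m≤m⊔n n (suc (pair v y))) r r′
    return (n ⊔ suc (pair v y) , d′ , r′ , v , y , c , refl , v<y , vv , vy , lt ,
      trans (obeys le {v} {y} (≤-trans y₀≤y (right≤pair v y)) lt v<) eq)

  open Fairness cell k P

  -- For distinct representatives it is enough that every row is as wide as there are rows, hence N
  -- = m, at every level.
  base-fair : ∀ m L → FairAt m m L (F ∷ [])
  base-fair m L rows (len , wide′) W unb = do
    let r = L , rows , W
    d , reached@(_ , _ , (_ , _ , _ , _ , done) , _) ← total (suc (code Request-countable r))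
    finish _ d reached (done r refl (All.map (λ {(c , row)} (q₁ , q₂ , q₃) → q₁ , q₂ , ≤-trans len q₃) wide′))
    where
    finish : ∀ n d → Reached n d → Met (L , rows , W) d ⊎ Refused (L , rows , W) d →
             ¬ ¬ (∃[ V ] Enumerates W (F ∷ []) V × Good L rows V)
    finish n d reached (inj₁ (V , (s , s≤ , s≺ , V∈) , good)) = return (V ,
      (length s , s ∷ [] , ((refl , λ i i< → agrees-resp (bit s i) (λ g → return (n , d , reached , g))
        (λ f → return (F⇒graph n reached (≤-trans i< s≤) f)) (s≺ i i<)) , tt) , V∈) ,
      All.map (λ (τ , τ∈ , f) → τ , τ∈ , λ v v∈ e → let (v< , eq) = f v v∈ e in n , d , reached , v< , eq) good)
    finish n d reached (inj₂ (x , refused)) = unb x >>= λ where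
      (V , (u , (s ∷ []) , ((refl , s≺) , _) , V∈) , above) → total (n ⊔ length s) >>= λ (d′ , r′) →
        ⊥-elim (refused d′ (later (m≤m⊔n n (length s)) reached r′) (valid _ r′) V
          (s , ≤-trans (m≤n⊔m n (length s)) (long _ r′) , (λ i i< → agrees-resp (bit s i) {F i} {Graph (proj₁ d′) i}
            (λ f → return (F⇒graph _ r′ (≤-trans i< (≤-trans (m≤n⊔m n (length s)) (long _ r′))) f))
            (λ g → return (n ⊔ length s , d′ , r′ , g)) (s≺ i i<)) , V∈) above)

open import Defs

-- Truth in an ω-model and soundness.

module Semantics (S : ℕ → ℕ → Set) where

  value : ∀ {n} → Term n → (Fin n → ℕ) → ℕ
  value (var i) ρ = ρ i
  value 0̇       ρ = 0
  value 1̇       ρ = 1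
  value (t +̇ u) ρ = value t ρ + value u ρ
  value (t ·̇ u) ρ = value t ρ * value u ρ

  -- Truth in the ω-model with the sets S 0 , S 1 , …; the negative translation makes
  -- it closed under classical logic without any classical axiom.
  infix 4 _⊩_⟨_⟩
  _⊩_⟨_⟩ : ∀ {n m} → (Fin n → ℕ) → Formula n m → (Fin m → ℕ) → Set
  ρ ⊩ t ≐ u ⟨ ξ ⟩  = value t ρ ≡ value u ρ
  ρ ⊩ t <̇ u ⟨ ξ ⟩  = value t ρ < value u ρ
  ρ ⊩ t ∈̇ X ⟨ ξ ⟩  = ¬ ¬ S (ξ X) (value t ρ)
  ρ ⊩ ⊥̇ ⟨ ξ ⟩      = ⊥
  ρ ⊩ φ ∧̇ ψ ⟨ ξ ⟩  = ρ ⊩ φ ⟨ ξ ⟩ × ρ ⊩ ψ ⟨ ξ ⟩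
  ρ ⊩ φ ∨̇ ψ ⟨ ξ ⟩  = ¬ ¬ (ρ ⊩ φ ⟨ ξ ⟩ ⊎ ρ ⊩ ψ ⟨ ξ ⟩)
  ρ ⊩ φ ⇒ ψ ⟨ ξ ⟩  = ρ ⊩ φ ⟨ ξ ⟩ → ρ ⊩ ψ ⟨ ξ ⟩
  ρ ⊩ ∀₁ φ ⟨ ξ ⟩   = ∀ x → (x ,ₛ ρ) ⊩ φ ⟨ ξ ⟩
  ρ ⊩ ∃₁ φ ⟨ ξ ⟩   = ¬ ¬ (∃[ x ] (x ,ₛ ρ) ⊩ φ ⟨ ξ ⟩)
  ρ ⊩ ∀₂ φ ⟨ ξ ⟩   = ∀ X → ρ ⊩ φ ⟨ X ,ₛ ξ ⟩
  ρ ⊩ ∃₂ φ ⟨ ξ ⟩   = ¬ ¬ (∃[ X ] ρ ⊩ φ ⟨ X ,ₛ ξ ⟩)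

  stable : ∀ {n m} (φ : Formula n m) {ρ ξ} → ¬ ¬ ρ ⊩ φ ⟨ ξ ⟩ → ρ ⊩ φ ⟨ ξ ⟩
  stable (t ≐ u) p = decidable-stable (_ ≟ _) p
  stable (t <̇ u) p = decidable-stable (_ <? _) p
  stable (t ∈̇ X) p = p >>= id
  stable ⊥̇       p = run p
  stable (φ ∧̇ ψ) p = stable φ (p >>= return ∘ proj₁) , stable ψ (p >>= return ∘ proj₂)
  stable (φ ∨̇ ψ) p = p >>= id
  stable (φ ⇒ ψ) p = λ a → stable ψ (p >>= λ f → return (f a))
  stable (∀₁ φ)  p = λ x → stable φ (p >>= λ f → return (f x))
  stable (∃₁ φ)  p = p >>= id
  stable (∀₂ φ)  p = λ X → stable φ (p >>= λ f → return (f X))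
  stable (∃₂ φ)  p = p >>= id

  value-sub : ∀ {n n′} {σ : Fin n → Term n′} {ρ ρ′} → (∀ i → value (σ i) ρ′ ≡ ρ i) →
              ∀ t → value (subᵗ σ t) ρ′ ≡ value t ρ
  value-sub e (var i) = e i
  value-sub e 0̇       = refl
  value-sub e 1̇       = refl
  value-sub e (t +̇ u) = cong₂ _+_ (value-sub e t) (value-sub e u)
  value-sub e (t ·̇ u) = cong₂ _*_ (value-sub e t) (value-sub e u)

  value-wk : ∀ {n} {x} {ρ : Fin n → ℕ} t → value (wkᵗ t) (x ,ₛ ρ) ≡ value t ρ
  value-wk = value-sub λ _ → refl

  private
    under : ∀ {n n′} (σ : Fin n → Term n′) {ρ ρ′} {x} → (∀ i → value (σ i) ρ′ ≡ ρ i) →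
            ∀ i → value ((x₀ ,ₛ (wkᵗ ∘ σ)) i) (x ,ₛ ρ′) ≡ (x ,ₛ ρ) i
    under σ e zero    = refl
    under σ e (suc i) = trans (value-wk (σ i)) (e i)

    under₂ : ∀ {m m′} {τ : Fin m → Fin m′} {ξ : Fin m → ℕ} {ξ′ : Fin m′ → ℕ} {X : ℕ} → (∀ j → ξ′ (τ j) ≡ ξ j) →
             ∀ j → (X ,ₛ ξ′) (lift 1 τ j) ≡ (X ,ₛ ξ) j
    under₂ e zero    = refl
    under₂ e (suc j) = e j

  sub-to : ∀ {n n′ m m′} (φ : Formula n m) {σ : Fin n → Term n′} {τ : Fin m → Fin m′} {ρ ρ′ ξ ξ′} →
    (∀ i → value (σ i) ρ′ ≡ ρ i) → (∀ j → ξ′ (τ j) ≡ ξ j) → ρ ⊩ φ ⟨ ξ ⟩ → ρ′ ⊩ sub σ τ φ ⟨ ξ′ ⟩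
  sub-from : ∀ {n n′ m m′} (φ : Formula n m) {σ : Fin n → Term n′} {τ : Fin m → Fin m′} {ρ ρ′ ξ ξ′} →
    (∀ i → value (σ i) ρ′ ≡ ρ i) → (∀ j → ξ′ (τ j) ≡ ξ j) → ρ′ ⊩ sub σ τ φ ⟨ ξ′ ⟩ → ρ ⊩ φ ⟨ ξ ⟩

  sub-to (t ≐ u) e f p = trans (value-sub e t) (trans p (sym (value-sub e u)))
  sub-to (t <̇ u) e f p = subst₂ _<_ (sym (value-sub e t)) (sym (value-sub e u)) p
  sub-to (t ∈̇ X) e f p = p >>= return ∘ subst₂ S (sym (f X)) (sym (value-sub e t))
  sub-to (φ ∧̇ ψ) e f (p , q) = sub-to φ e f p , sub-to ψ e f q
  sub-to (φ ∨̇ ψ) e f p = p >>= λ where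
    (inj₁ q) → return (inj₁ (sub-to φ e f q))
    (inj₂ q) → return (inj₂ (sub-to ψ e f q))
  sub-to (φ ⇒ ψ) e f p = sub-to ψ e f ∘ p ∘ sub-from φ e f
  sub-to (∀₁ φ) {σ} e f p = λ x → sub-to φ (under σ e) f (p x)
  sub-to (∃₁ φ) {σ} e f p = p >>= λ (x , q) → return (x , sub-to φ (under σ e) f q)
  sub-to (∀₂ φ)  e f p = λ X → sub-to φ e (under₂ f) (p X)
  sub-to (∃₂ φ)  e f p = p >>= λ (X , q) → return (X , sub-to φ e (under₂ f) q)

  sub-from (t ≐ u) e f p = trans (sym (value-sub e t)) (trans p (value-sub e u))
  sub-from (t <̇ u) e f p = subst₂ _<_ (value-sub e t) (value-sub e u) p
  sub-from (t ∈̇ X) e f p = p >>= return ∘ subst₂ S (f X) (value-sub e t)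
  sub-from (φ ∧̇ ψ) e f (p , q) = sub-from φ e f p , sub-from ψ e f q
  sub-from (φ ∨̇ ψ) e f p = p >>= λ where
    (inj₁ q) → return (inj₁ (sub-from φ e f q))
    (inj₂ q) → return (inj₂ (sub-from ψ e f q))
  sub-from (φ ⇒ ψ) e f p = sub-from ψ e f ∘ p ∘ sub-to φ e f
  sub-from (∀₁ φ) {σ} e f p = λ x → sub-from φ (under σ e) f (p x)
  sub-from (∃₁ φ) {σ} e f p = p >>= λ (x , q) → return (x , sub-from φ (under σ e) f q)
  sub-from (∀₂ φ)  e f p = λ X → sub-from φ e (under₂ f) (p X)
  sub-from (∃₂ φ)  e f p = p >>= λ (X , q) → return (X , sub-from φ e (under₂ f) q)

  private
    instance₁ : ∀ {n} {t : Term n} {ρ} i → value ((t ,ₛ var) i) ρ ≡ (value t ρ ,ₛ ρ) i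
    instance₁ zero    = refl
    instance₁ (suc i) = refl

    instance₂ : ∀ {m} {X : Fin m} {ξ : Fin m → ℕ} j → ξ ((X ,ₛ id) j) ≡ (ξ X ,ₛ ξ) j
    instance₂ zero    = refl
    instance₂ (suc j) = refl

  []₁-to : ∀ {n m} (φ : Formula (suc n) m) {t ρ ξ} → (value t ρ ,ₛ ρ) ⊩ φ ⟨ ξ ⟩ → ρ ⊩ φ [ t ]₁ ⟨ ξ ⟩
  []₁-to φ = sub-to φ instance₁ (λ _ → refl)

  []₁-from : ∀ {n m} (φ : Formula (suc n) m) {t ρ ξ} → ρ ⊩ φ [ t ]₁ ⟨ ξ ⟩ → (value t ρ ,ₛ ρ) ⊩ φ ⟨ ξ ⟩
  []₁-from φ = sub-from φ instance₁ (λ _ → refl)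

  wk₁-to : ∀ {n m} (φ : Formula n m) {x ρ ξ} → ρ ⊩ φ ⟨ ξ ⟩ → (x ,ₛ ρ) ⊩ wk₁ φ ⟨ ξ ⟩
  wk₁-to φ = sub-to φ (λ _ → refl) (λ _ → refl)

  wk₂-to : ∀ {n m} (φ : Formula n m) {X ρ ξ} → ρ ⊩ φ ⟨ ξ ⟩ → ρ ⊩ wk₂ φ ⟨ X ,ₛ ξ ⟩
  wk₂-to φ = sub-to φ (λ _ → refl) (λ _ → refl)

  at-to : ∀ {n m} (φ : Formula (suc n) m) j {t ρ ρ′ ξ} → (∀ i → ρ′ (j ↑ʳ i) ≡ ρ i) →
          (value t ρ′ ,ₛ ρ) ⊩ φ ⟨ ξ ⟩ → ρ′ ⊩ φ at[ j ] t ⟨ ξ ⟩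
  at-to φ j e = sub-to φ (λ { zero → refl ; (suc i) → e i }) (λ _ → refl)

  at-from : ∀ {n m} (φ : Formula (suc n) m) j {t ρ ρ′ ξ} → (∀ i → ρ′ (j ↑ʳ i) ≡ ρ i) →
            ρ′ ⊩ φ at[ j ] t ⟨ ξ ⟩ → (value t ρ′ ,ₛ ρ) ⊩ φ ⟨ ξ ⟩
  at-from φ j e = sub-from φ (λ { zero → refl ; (suc i) → e i }) (λ _ → refl)

  module Soundness (𝕋 : Theory) (axioms : ∀ {n m} {φ : Formula n m} → 𝕋 φ → ∀ ρ ξ → ρ ⊩ φ ⟨ ξ ⟩) where

    _⊩*_⟨_⟩ : ∀ {n m} → (Fin n → ℕ) → List (Formula n m) → (Fin m → ℕ) → Set
    ρ ⊩* Γ ⟨ ξ ⟩ = ∀ {ψ} → ψ ∈ Γ → ρ ⊩ ψ ⟨ ξ ⟩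

    private
      cons : ∀ {n m} {Γ : List (Formula n m)} {φ ρ ξ} → ρ ⊩ φ ⟨ ξ ⟩ → ρ ⊩* Γ ⟨ ξ ⟩ → ρ ⊩* φ ∷ Γ ⟨ ξ ⟩
      cons p γ (here refl) = p
      cons p γ (there ψ∈)  = γ ψ∈

      weaken₁ : ∀ {n m} {Γ : List (Formula n m)} {x ρ ξ} → ρ ⊩* Γ ⟨ ξ ⟩ → (x ,ₛ ρ) ⊩* map wk₁ Γ ⟨ ξ ⟩
      weaken₁ γ ψ∈ with φ , φ∈ , refl ← ∈-map⁻ wk₁ ψ∈ = wk₁-to φ (γ φ∈)

      weaken₂ : ∀ {n m} {Γ : List (Formula n m)} {X ρ ξ} → ρ ⊩* Γ ⟨ ξ ⟩ → ρ ⊩* map wk₂ Γ ⟨ X ,ₛ ξ ⟩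
      weaken₂ γ ψ∈ with φ , φ∈ , refl ← ∈-map⁻ wk₂ ψ∈ = wk₂-to φ (γ φ∈)

    soundness : ∀ {n m} {Γ : List (Formula n m)} {φ} → 𝕋 ∣ Γ ⊢ φ → ∀ ρ ξ → ρ ⊩* Γ ⟨ ξ ⟩ → ρ ⊩ φ ⟨ ξ ⟩
    soundness (ax a) ρ ξ γ = axioms a ρ ξ
    soundness (hyp φ∈) ρ ξ γ = γ φ∈
    soundness (raa {φ} d) ρ ξ γ = stable φ λ k → soundness d ρ ξ (cons k γ)
    soundness (⇒I d) ρ ξ γ = λ p → soundness d ρ ξ (cons p γ)
    soundness (⇒E d e) ρ ξ γ = soundness d ρ ξ γ (soundness e ρ ξ γ)
    soundness (∧I d e) ρ ξ γ = soundness d ρ ξ γ , soundness e ρ ξ γ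
    soundness (∧E₁ d) ρ ξ γ = proj₁ (soundness d ρ ξ γ)
    soundness (∧E₂ d) ρ ξ γ = proj₂ (soundness d ρ ξ γ)
    soundness (∨I₁ d) ρ ξ γ = return (inj₁ (soundness d ρ ξ γ))
    soundness (∨I₂ d) ρ ξ γ = return (inj₂ (soundness d ρ ξ γ))
    soundness (∨E {χ = χ} d e f) ρ ξ γ = stable χ (soundness d ρ ξ γ >>= λ where
      (inj₁ p) → return (soundness e ρ ξ (cons p γ))
      (inj₂ p) → return (soundness f ρ ξ (cons p γ)))
    soundness (∀₁I d) ρ ξ γ = λ x → soundness d (x ,ₛ ρ) ξ (weaken₁ γ)
    soundness (∀₁E {φ} d t) ρ ξ γ = []₁-to φ (soundness d ρ ξ γ (value t ρ))
    soundness (∃₁I {φ} t d) ρ ξ γ = return (value t ρ , []₁-from φ (soundness d ρ ξ γ))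
    soundness (∃₁E {φ} {ψ} d e) ρ ξ γ = stable ψ (soundness d ρ ξ γ >>= λ (x , p) →
      return (sub-from ψ (λ _ → refl) (λ _ → refl) (soundness e (x ,ₛ ρ) ξ (cons p (weaken₁ γ)))))
    soundness (∀₂I d) ρ ξ γ = λ X → soundness d ρ (X ,ₛ ξ) (weaken₂ γ)
    soundness (∀₂E {φ} d X) ρ ξ γ = sub-to φ (λ _ → refl) instance₂ (soundness d ρ ξ γ (ξ X))
    soundness (∃₂I {φ} X d) ρ ξ γ = return (ξ X , sub-from φ (λ _ → refl) instance₂ (soundness d ρ ξ γ))
    soundness (∃₂E {φ} {ψ} d e) ρ ξ γ = stable ψ (soundness d ρ ξ γ >>= λ (X , p) →
      return (sub-from ψ (λ _ → refl) (λ _ → refl) (soundness e ρ (X ,ₛ ξ) (cons p (weaken₂ γ)))))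
    soundness ≐I ρ ξ γ = refl
    soundness (≐E φ {t} {u} d e) ρ ξ γ = []₁-to φ
      (subst (λ x → (x ,ₛ ρ) ⊩ φ ⟨ ξ ⟩) (soundness d ρ ξ γ) ([]₁-from φ (soundness e ρ ξ γ)))

  induction : ∀ {n m} (φ : Formula (suc n) m) ρ ξ → (0 ,ₛ ρ) ⊩ φ ⟨ ξ ⟩ →
    (∀ x → (x ,ₛ ρ) ⊩ φ ⟨ ξ ⟩ → (suc x ,ₛ ρ) ⊩ φ ⟨ ξ ⟩) → ∀ x → (x ,ₛ ρ) ⊩ φ ⟨ ξ ⟩
  induction φ ρ ξ z s zero    = z
  induction φ ρ ξ z s (suc x) = s x (induction φ ρ ξ z s x)

  -- The one axiom scheme that depends on which sets the model contains; soundness is proved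
  -- relative to it.
  Comprehension : Set
  Comprehension = ∀ {n m} {φ ψ : Formula (suc n) m} → Σ⁰₁ φ → Π⁰₁ ψ → ∀ ρ ξ →
    ρ ⊩ ∀₁ (φ ⇔̇ ψ) ⇒ ∃₂ ∀₁ (x₀ ∈̇ X₀ ⇔̇ wk₂ φ) ⟨ ξ ⟩

  RCA₀-sound : Comprehension → ∀ {n m} {φ : Formula n m} → RCA₀ φ → ∀ ρ ξ → ρ ⊩ φ ⟨ ξ ⟩
  RCA₀-sound ca (suc≢0 t) ρ ξ e = 1+n≢0 (trans (+-comm 1 (value t ρ)) e)
  RCA₀-sound ca (suc-inj t u) ρ ξ = +-cancelʳ-≡ 1 (value t ρ) (value u ρ)
  RCA₀-sound ca (+-zero t) ρ ξ = +-identityʳ (value t ρ)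
  RCA₀-sound ca (+-suc t u) ρ ξ = sym (+-assoc (value t ρ) (value u ρ) 1)
  RCA₀-sound ca (·-zero t) ρ ξ = *-zeroʳ (value t ρ)
  RCA₀-sound ca (·-suc t u) ρ ξ = trans (*-distribˡ-+ (value t ρ) (value u ρ) 1)
    (cong (value t ρ * value u ρ +_) (*-identityʳ (value t ρ)))
  RCA₀-sound ca (≮0 t) ρ ξ ()
  RCA₀-sound ca (<-suc t u) ρ ξ =
    (λ lt → return (case m≤n⇒m<n∨m≡n (≤-pred (subst (value t ρ <_) (+-comm (value u ρ) 1) lt)) of λ where
      (inj₁ p) → inj₁ p
      (inj₂ p) → inj₂ p)) ,
    (λ p → stable (t <̇ u +̇ 1̇) {ρ} {ξ} (p >>= λ where
      (inj₁ q) → return (≤-trans q (m≤m+n (value u ρ) 1))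
      (inj₂ q) → return (subst (value t ρ <_) (+-comm 1 (value u ρ)) (s≤s (≤-reflexive q)))))
  RCA₀-sound ca (Σ⁰₁-IND {φ = φ} _) ρ ξ (z , s) = induction φ ρ ξ ([]₁-from φ z) λ x p →
    subst (λ y → (y ,ₛ ρ) ⊩ φ ⟨ ξ ⟩) (+-comm x 1) (at-from φ 1 {x₀ +̇ 1̇} {ρ} {x ,ₛ ρ} (λ _ → refl) (s x p))
  RCA₀-sound ca (Δ⁰₁-CA {φ = φ} {ψ} σ π) ρ ξ = ca {φ = φ} {ψ} σ π ρ ξ

-- The iterated model.

module Model (cell : ℕ → ℕ → Str) (k : ℕ) (P : ℕ → ℕ → Set) (F : Pred₀) where
  open Operators cell
  open Fairness cell k P

  stableᵇ : ∀ φ {ρ Z} → ¬ ¬ ⟦ φ ⟧ᵇ ρ Z → ⟦ φ ⟧ᵇ ρ Z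
  stableᵇ (t =ᵇ u) p = decidable-stable (_ ≟ _) p
  stableᵇ (t <ᵇ u) p = decidable-stable (_ <? _) p
  stableᵇ (t ∈ᵇ j) p = p >>= id
  stableᵇ ⊥ᵇ       p = run p
  stableᵇ (φ ⇒ᵇ ψ) p = λ a → stableᵇ ψ (p >>= λ f → return (f a))
  stableᵇ (∀ᵇ t φ) p = λ x< → stableᵇ φ (p >>= λ f → return (f x<))

  -- A task: a lower bound on its stage, and either a colouring (the set with the
  -- given index) to be solved or a Δ⁰₁ definition to be realised.
  Task : Set
  Task = ℕ × Bool × ℕ × BF × BF × List ℕ

  Task-countable : Countable Task
  Task-countable = ℕ-countable ×-countable Bool-countable ×-countable ℕ-countable ×-countable
                   BF-countable ×-countable BF-countable ×-countable List-countable ℕ-countable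

  Provably-Δ : World → BF → BF → List ℕ → Set
  Provably-Δ Z θ θ′ ρ =
    (∀ x y → ⟦ θ ⟧ᵇ (y ∷ x ∷ ρ) Z → ∀ y′ → ¬ ¬ ⟦ θ′ ⟧ᵇ (y′ ∷ x ∷ ρ) Z) ×
    (∀ x → (∀ y → ⟦ θ′ ⟧ᵇ (y ∷ x ∷ ρ) Z) → ¬ ¬ (∃[ y ] ⟦ θ ⟧ᵇ (y ∷ x ∷ ρ) Z))

  Performs : Task → World → Pred₀
  Performs (_ , true  , j , _)          Z x = Σ[ j< ∈ j < length Z ] Ramsey.homogeneous Z j j< x
  Performs (_ , false , _ , θ , θ′ , ρ) Z x = Provably-Δ Z θ θ′ ρ × (∃[ y ] ⟦ θ ⟧ᵇ (y ∷ x ∷ ρ) Z)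

  -- Codes are injective but never decoded: the column is a union over the tasks of code `n`, of
  -- which there is at most one, and it is empty if there is none.
  newColumn : ℕ → World → Pred₀
  newColumn n Z x = ∃[ task ] code Task-countable task ≡ n × Performs task Z x

  worlds : ℕ → World
  worlds zero    = F ∷ []
  worlds (suc n) = newColumn n (worlds n) ∷ worlds n

  S : ℕ → Pred₀
  S zero    = F
  S (suc n) = newColumn n (worlds n)

  open Semantics S public

  length-worlds : ∀ n → length (worlds n) ≡ suc n
  length-worlds zero    = refl
  length-worlds (suc n) = cong suc (length-worlds n)

  col-top : ∀ X Z {i} → i ≡ length Z → col (X ∷ Z) i ≡ X
  col-top X Z {i} e = cong (λ b → if b then X else col Z i) (dec-true (i ≟ length Z) e)

  col-worlds : ∀ {n i} → i ≤ n → col (worlds n) i ≡ S i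
  col-worlds {zero}  z≤n = refl
  col-worlds {suc n} {i} i≤ with m≤n⇒m<n∨m≡n i≤
  ... | inj₁ (s≤s i≤n) = trans (col-cons _ (worlds n) (subst (i <_) (sym (length-worlds n)) (s≤s i≤n))) (col-worlds i≤n)
  ... | inj₂ refl      = col-top _ (worlds n) (sym (length-worlds n))

  performs-only : ∀ n task → code Task-countable task ≡ n → ∀ x → S (suc n) x → Performs task (worlds n) x
  performs-only n task e x (task′ , e′ , p) =
    subst (λ t → Performs t (worlds n) x) (injective Task-countable {task′} {task} (trans e′ (sym e))) p

  -- The empty set is recursive, with `⊥ᵇ` as both of its definitions.
  empty-fair : ∀ {X Z} → (∀ x → ¬ X x) → Fair Z → Fair (X ∷ Z)
  empty-fair {X} {Z} empty = fair-mono λ m N L f →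
    fairAt-resp {recursive} {X} {Z} (λ _ ()) (λ x p → ⊥-elim (empty x p)) (recursive-fairAt f)
    where
    absurd : ∀ (x y : ℕ) → ⊥ → ∀ (y′ : ℕ) → ¬ ¬ ⊥
    absurd _ _ ()
    vacuous : ∀ (x : ℕ) → (ℕ → ⊥) → ¬ ¬ (∃[ y ] ⊥)
    vacuous _ f = ⊥-elim (f 0)
    open Recursive Z ⊥ᵇ ⊥ᵇ [] absurd vacuous (λ _ _ p → run p)

  worlds-fair : Fair (F ∷ []) → ∀ n → Fair (worlds n)
  worlds-fair fair zero    = fair
  worlds-fair fair (suc n) m = em (∃[ task ] code Task-countable task ≡ n) >>= λ where
      (no absent)      → empty-fair (λ x (task , e , _) → absent (task , e)) ih m
      (yes (task , e)) → perform task e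
    where
    Z : World
    Z = worlds n
    ih : Fair Z
    ih = worlds-fair fair n
    perform : ∀ task → code Task-countable task ≡ n → ¬ ¬ (∃[ N ] ∀ L₀ → ¬ ¬ (∃[ L ] L₀ ≤ L × FairAt m N L (worlds (suc n))))
    perform task@(_ , true , j , _) e = em (j < length Z) >>= λ where
      (no j≮)  → empty-fair (λ x p → j≮ (proj₁ (performs-only n task e x p))) ih m
      (yes j<) → fair-mono (λ m N L → fairAt-resp {Ramsey.homogeneous Z j j<} {newColumn n Z} {Z}
          (λ x h → return (task , e , j< , h))
          (λ x p → let (j<′ , h) = performs-only n task e x p in
            return (subst (λ q → Ramsey.homogeneous Z j q x) (≤-irrelevant j<′ j<) h)))
        (Ramsey.homogeneous-fair Z j j< ih) m
    perform task@(_ , false , _ , θ , θ′ , ρ) e = em (Provably-Δ Z θ θ′ ρ) >>= λ where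
      (no ¬Δ) → empty-fair (λ x p → ¬Δ (proj₁ (performs-only n task e x p))) ih m
      (yes (σ⇒π , π⇒σ)) → fair-mono (λ m N L f → fairAt-resp {λ x → ∃[ y ] ⟦ θ ⟧ᵇ (y ∷ x ∷ ρ) Z} {newColumn n Z} {Z}
          (λ x h → return (task , e , (σ⇒π , π⇒σ) , h))
          (λ x p → return (proj₂ (performs-only n task e x p)))
          (Recursive.recursive-fairAt Z θ θ′ ρ σ⇒π π⇒σ (λ x y → stableᵇ θ′) f)) ih m

  private
    tr-term : ∀ {n} → Term n → Tm
    tr-term (var i) = v# (toℕ i)
    tr-term 0̇       = c# 0
    tr-term 1̇       = c# 1
    tr-term (t +̇ u) = tr-term t ⊕ tr-term u
    tr-term (t ·̇ u) = tr-term t ⊗ tr-term u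

    translate : ∀ {n m} {φ : Formula n m} → Bounded φ → (Fin m → ℕ) → BF
    translate (eq {t} {u}) ξ  = tr-term t =ᵇ tr-term u
    translate (lt {t} {u}) ξ  = tr-term t <ᵇ tr-term u
    translate (mem {t} {X}) ξ = tr-term t ∈ᵇ ξ X
    translate bot ξ           = ⊥ᵇ
    translate (and a b) ξ     = (translate a ξ ⇒ᵇ (translate b ξ ⇒ᵇ ⊥ᵇ)) ⇒ᵇ ⊥ᵇ
    translate (or a b) ξ      = (translate a ξ ⇒ᵇ ⊥ᵇ) ⇒ᵇ translate b ξ
    translate (imp a b) ξ     = translate a ξ ⇒ᵇ translate b ξ
    translate (all t a) ξ     = ∀ᵇ (tr-term t) (translate a ξ)
    translate (ex t a) ξ      = ∀ᵇ (tr-term t) (translate a ξ ⇒ᵇ ⊥ᵇ) ⇒ᵇ ⊥ᵇ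

    module _ (Z : World) where

      Matches : ∀ {n} → (Fin n → ℕ) → List ℕ → Set
      Matches ρ vs = ∀ i → nth vs (toℕ i) ≡ ρ i

      matches-cons : ∀ {n} {ρ : Fin n → ℕ} {vs x} → Matches ρ vs → Matches (x ,ₛ ρ) (x ∷ vs)
      matches-cons e zero    = refl
      matches-cons e (suc i) = e i

      term-value : ∀ {n} (t : Term n) {ρ vs} → Matches ρ vs → ⟦ tr-term t ⟧ₜ vs ≡ value t ρ
      term-value (var i) e = e i
      term-value 0̇       e = refl
      term-value 1̇       e = refl
      term-value (t +̇ u) e = cong₂ _+_ (term-value t e) (term-value u e)
      term-value (t ·̇ u) e = cong₂ _*_ (term-value t e) (term-value u e)

      translate-to : ∀ {n m} {φ : Formula n m} (b : Bounded φ) {ρ ξ vs} → Matches ρ vs →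
        (∀ X → col Z (ξ X) ≡ S (ξ X)) → ρ ⊩ φ ⟨ ξ ⟩ → ⟦ translate b ξ ⟧ᵇ vs Z
      translate-from : ∀ {n m} {φ : Formula n m} (b : Bounded φ) {ρ ξ vs} → Matches ρ vs →
        (∀ X → col Z (ξ X) ≡ S (ξ X)) → ⟦ translate b ξ ⟧ᵇ vs Z → ρ ⊩ φ ⟨ ξ ⟩

      translate-to (eq {t} {u}) e f p = trans (term-value t e) (trans p (sym (term-value u e)))
      translate-to (lt {t} {u}) e f p = subst₂ _<_ (sym (term-value t e)) (sym (term-value u e)) p
      translate-to (mem {t} {X}) e f p = p >>= λ q → return (subst₂ (λ C x → C x) (sym (f X)) (sym (term-value t e)) q)
      translate-to bot e f p = p
      translate-to (and a b) e f (p , q) = λ k → k (translate-to a e f p) (translate-to b e f q)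
      translate-to (or {ψ = ψ} a b) {ρ} {ξ} e f p = λ ¬a → stableᵇ (translate b ξ) (p >>= λ where
        (inj₁ q) → ⊥-elim (¬a (translate-to a e f q))
        (inj₂ q) → return (translate-to b e f q))
      translate-to (imp a b) e f p = translate-to b e f ∘ p ∘ translate-from a e f
      translate-to (all t a) {ρ} e f p {x} x< = translate-to a (matches-cons e) f
        (p x (subst (x <_) (trans (term-value t e) (sym (value-wk t))) x<))
      translate-to (ex t a) {ρ} e f p = λ k → p λ (x , x< , q) →
        k (subst (x <_) (trans (value-wk t) (sym (term-value t e))) x<) (translate-to a (matches-cons e) f q)

      translate-from (eq {t} {u}) e f p = trans (sym (term-value t e)) (trans p (term-value u e))
      translate-from (lt {t} {u}) e f p = subst₂ _<_ (term-value t e) (term-value u e) p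
      translate-from (mem {t} {X}) e f p = p >>= λ q → return (subst₂ (λ C x → C x) (f X) (term-value t e) q)
      translate-from bot e f p = p
      translate-from (and {φ} {ψ} a b) {ρ} {ξ} e f p =
        stable φ (λ k → p λ qa _ → k (translate-from a e f qa)) , stable ψ (λ k → p λ _ qb → k (translate-from b e f qb))
      translate-from (or {φ} a b) {ρ} {ξ} e f p = em (ρ ⊩ φ ⟨ ξ ⟩) >>= λ where
        (yes q) → return (inj₁ q)
        (no ¬q) → return (inj₂ (translate-from b e f (p (¬q ∘ translate-from a e f))))
      translate-from (imp a b) e f p = translate-from b e f ∘ p ∘ translate-to a e f
      translate-from (all t a) e f p = λ x x< → translate-from a (matches-cons e) f
        (p (subst (x <_) (trans (value-wk t) (sym (term-value t e))) x<))
      translate-from (ex t a) e f p = λ k → p λ {x} x< q →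
        k (x , subst (x <_) (trans (term-value t e) (sym (value-wk t))) x< , translate-from a (matches-cons e) f q)

    matches-tabulate : ∀ {n} (ρ : Fin n → ℕ) → Matches [] ρ (tabulate ρ)
    matches-tabulate ρ zero    = refl
    matches-tabulate ρ (suc i) = matches-tabulate (ρ ∘ suc) i

    max : ∀ {m} → (Fin m → ℕ) → ℕ
    max {zero}  ξ = 0
    max {suc m} ξ = ξ zero ⊔ max (ξ ∘ suc)

    ≤max : ∀ {m} (ξ : Fin m → ℕ) X → ξ X ≤ max ξ
    ≤max ξ zero    = m≤m⊔n (ξ zero) _
    ≤max ξ (suc X) = ≤-trans (≤max (ξ ∘ suc) X) (m≤n⊔m (ξ zero) _)

  comprehension : Comprehension
  comprehension {φ = ∃₁ θ} {∀₁ θ′} (ex b) (all b′) ρ ξ φ⇔ψ =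
    realise (code Task-countable task) refl (left≤pair (max ξ) _)
    where
    task : Task
    -- A code is at least its first entry, so at the stage of this task all set parameters are
    -- columns already.
    task = max ξ , false , 0 , translate b ξ , translate b′ ξ , tabulate ρ
    realise : ∀ n → code Task-countable task ≡ n → max ξ ≤ n →
              ρ ⊩ ∃₂ ∀₁ (x₀ ∈̇ X₀ ⇔̇ wk₂ (∃₁ θ)) ⟨ ξ ⟩
    realise n e le = return (suc n , λ x →
        (λ x∈ → wk₂-to (∃₁ θ) (λ k → x∈ λ s → let (y , p) = proj₂ (performs-only n task e x s) in k (y , from y x p))) ,
        (λ p → sub-from (∃₁ θ) {var} {suc} {x ,ₛ ρ} {x ,ₛ ρ} {ξ} {suc n ,ₛ ξ} (λ _ → refl) (λ _ → refl) p >>= λ (y , q) →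
          return (task , e , (σ⇒π , π⇒σ) , y , to y x q)))
      where
      Z : World
      Z = worlds n
      cols : ∀ X → col Z (ξ X) ≡ S (ξ X)
      cols X = col-worlds (≤-trans (≤max ξ X) le)
      env : ∀ y x → Matches Z (y ,ₛ (x ,ₛ ρ)) (y ∷ x ∷ tabulate ρ)
      env y x = matches-cons Z (matches-cons Z (matches-tabulate ρ))
      to : ∀ y x → (y ,ₛ (x ,ₛ ρ)) ⊩ θ ⟨ ξ ⟩ → ⟦ translate b ξ ⟧ᵇ (y ∷ x ∷ tabulate ρ) Z
      to y x = translate-to Z b (env y x) cols
      from : ∀ y x → ⟦ translate b ξ ⟧ᵇ (y ∷ x ∷ tabulate ρ) Z → (y ,ₛ (x ,ₛ ρ)) ⊩ θ ⟨ ξ ⟩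
      from y x = translate-from Z b (env y x) cols
      σ⇒π : ∀ x y → ⟦ translate b ξ ⟧ᵇ (y ∷ x ∷ tabulate ρ) Z → ∀ y′ → ¬ ¬ ⟦ translate b′ ξ ⟧ᵇ (y′ ∷ x ∷ tabulate ρ) Z
      σ⇒π x y p y′ = return (translate-to Z b′ (env y′ x) cols (proj₁ (φ⇔ψ x) (return (y , from y x p)) y′))
      π⇒σ : ∀ x → (∀ y → ⟦ translate b′ ξ ⟧ᵇ (y ∷ x ∷ tabulate ρ) Z) → ¬ ¬ (∃[ y ] ⟦ translate b ξ ⟧ᵇ (y ∷ x ∷ tabulate ρ) Z)
      π⇒σ x p = proj₂ (φ⇔ψ x) (λ y → translate-from Z b′ (env y x) cols (p y)) >>= λ (y , q) → return (y , to y x q)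

  RT²₂-true : Fair (F ∷ []) → ∀ {ρ ξ} → ρ ⊩ RT²₂ ⟨ ξ ⟩
  RT²₂-true fair {ρ} {ξ} i (values , total) = solve (code Task-countable task) refl (left≤pair i _)
    where
    task : Task
    task = i , true , i , ⊥ᵇ , ⊥ᵇ , []
    -- `colour` records only whether a pair has colour 1; that it otherwise has colour 0 comes from
    -- the totality and the range of the given function.
    colour-1 : ∀ {x y} → x < y → ¬ S i (pair (pair x y) 1) → ¬ ¬ S i (pair (pair x y) 0)
    colour-1 {x} {y} x<y not1 = do
      c , c∈ , _ ← total (pair x y) (return (x , return (y , x<y , refl , refl , refl)))
      c∈′ ← c∈
      a , k ← values (pair (pair x y) c) c∈
      b , _ , b< , e ← k
      let c≡b = proj₂ (pair-injective {pair x y} {c} {a} {b} e)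
      return (small c (subst (_< 2) (sym c≡b) b<) c∈′)
      where
      small : ∀ c → c < 2 → S i (pair (pair x y) c) → S i (pair (pair x y) 0)
      small 0 _ p = p
      small 1 _ p = ⊥-elim (not1 p)
      small (suc (suc _)) (s≤s (s≤s ())) _
    solve : ∀ n → code Task-countable task ≡ n → i ≤ n → ρ ⊩ ∃₂ (Infinite X₀ ∧̇ ConstantOn X₁ X₀) ⟨ i ,ₛ ξ ⟩
    solve n e i≤n = do
      b , hom ← homogeneous-coloured (worlds-fair fair n)
      return (suc n ,
        (λ x → homogeneous-unending (worlds-fair fair n) x >>= λ (y , x<y , h) →
          return (y , x<y , return (task , e , j< , h))) ,
        return ((if b then 1 else 0) , λ x y (x∈ , y∈ , x<y) → do
          x∈′ ← x∈
          y∈′ ← y∈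
          choose-colour b x<y (hom x y x<y (only x x∈′) (only y y∈′))))
      where
      j< : i < length (worlds n)
      j< = subst (i <_) (sym (length-worlds n)) (s≤s i≤n)
      open Ramsey (worlds n) i j<
      only : ∀ x → S (suc n) x → homogeneous x
      only x x∈ = let (j<′ , h) = performs-only n task e x x∈ in
        subst (λ q → Ramsey.homogeneous (worlds n) i q x) (≤-irrelevant j<′ j<) h
      choose-colour : ∀ b {x y} → x < y → Agrees b (colour (worlds n) i x y) →
                      ¬ ¬ S i (pair (pair x y) (if b then 1 else 0))
      choose-colour b {x} {y} x<y ag with agrees ← subst (λ C → Agrees b (C (pair (pair x y) 1))) (col-worlds i≤n) ag | b
      ... | true  = agrees
      ... | false = colour-1 x<y agrees

-- Copies of the Rado graph in the model.

module Separation (𝓡 : ComputableRadoGraph) (ℓ : ℕ) where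

  open ComputableRadoGraph 𝓡

  vertex? : ∀ x → Dec (Vertex x)
  vertex? x = ComputableRelation.dec vertex (x ∷ [])

  edge? : ∀ x y → Dec (Edge x y)
  edge? x y = ComputableRelation.dec edge (x ∷ y ∷ [])

  cell : ℕ → ℕ → Str
  cell L v = applyUpTo (λ i → does (edge? v i)) L

  open Operators cell
  open StableColouring cell ℓ Vertex using (k; F; P; base-fair; F-total; F-unique; F-coloured; P-limit; escape)
  open Fairness cell k P
  open Model cell k P F

  record Copy (H : Pred₀) (B : ℕ → ℕ → Set) : Set where
    field
      domain     : ∀ {x y} → B x y → Vertex x
      image      : ∀ {x} → Vertex x → ¬ ¬ (∃[ y ] B x y × H y)
      functional : ∀ {x y y′} → B x y → B x y′ → y ≡ y′
      one-one   : ∀ {x x′ y} → B x y → B x′ y → x ≡ x′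
      edge-to    : ∀ {a b c d} → B a c → B b d → Edge a b → Edge c d
      edge-from  : ∀ {a b c d} → B a c → B b d → Edge c d → Edge a b

  irrefl : ∀ {x} → ¬ Edge x x
  irrefl = IsGraph.irreflexive isGraph

  clique : ∀ n → ∃[ gs ] length gs ≡ n × All Vertex gs × AllPairs Edge gs
  clique zero = [] , refl , [] , []
  clique (suc n) with gs , len , vs , ps ← clique n
                 with x , vx , es , _ ← isRado gs [] vs [] (λ { (_ , ()) }) =
    x ∷ gs , cong suc len , vx ∷ vs , es ∷ ps

  allPairs-lookup : ∀ {gs g g′} → AllPairs Edge gs → g ∈ gs → g′ ∈ gs → g ≢ g′ → Edge g g′
  allPairs-lookup (es ∷ ps) (here refl) (here refl) ne = ⊥-elim (ne refl)
  allPairs-lookup (es ∷ ps) (here refl) (there q)   ne = All.lookup es q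
  allPairs-lookup (es ∷ ps) (there p)   (here refl) ne = IsGraph.symmetric isGraph (All.lookup es p)
  allPairs-lookup (es ∷ ps) (there p)   (there q)   ne = allPairs-lookup ps p q ne

  unending-pigeonhole : (f : ℕ → Str) (Q : Pred₀) (τs : List Str) → (∀ y → Q y → f y ∈ τs) → Unending Q →
    ¬ ¬ (∃[ τ ] Unending (λ y → Q y × f y ≡ τ))
  unending-pigeonhole f Q []       cover inf = inf 0 >>= λ (y , _ , q) → case cover y q of λ ()
  unending-pigeonhole f Q (τ ∷ τs) cover inf = em (Unending (λ y → Q y × f y ≡ τ)) >>= λ where
    (yes u) → return (τ , u)
    (no ¬u) → do
      y₁ , ¬p ← ¬∀⇒∃¬ ¬u (λ _ p k → p λ q → q k)
      τ′ , u ← unending-pigeonhole f (λ y → Q y × f y ≢ τ) τs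
        (λ y (q , ne) → case cover y q of λ where
          (here e)  → ⊥-elim (ne e)
          (there p) → p)
        (λ y₀ → do
          y , lt′ , q ← inf (y₀ ⊔ y₁)
          return (y , ≤-trans (s≤s (m≤m⊔n y₀ y₁)) lt′ , q ,
            λ e → ¬p (return (y , ≤-trans (s≤s (m≤n⊔m y₀ y₁)) lt′ , q , e))))
      return (τ′ , λ y₀ → u y₀ >>= λ (y , l , (q , _) , e) → return (y , l , q , e))

  -- A copy of the Rado graph meets infinitely often as many cells as we please:
  -- take a clique and, for each of its members, the elements adjacent to that
  -- member only.
  module _ {H : Pred₀} {B : ℕ → ℕ → Set} (copy : Copy H B) where
    open Copy copy

    private
      preimages : ∀ y₀ → ¬ ¬ (∃[ xs ] All Vertex xs × (∀ x y → B x y → y ≤ y₀ → x ∈ xs))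
      preimages y₀ = go (suc y₀) >>= λ (xs , vs , f) → return (xs , vs , λ x y bxy le → f x y bxy (s≤s le))
        where
        go : ∀ n → ¬ ¬ (∃[ xs ] All Vertex xs × (∀ x y → B x y → y < n → x ∈ xs))
        go zero    = return ([] , [] , λ _ _ _ ())
        go (suc n) = do
          xs , vs , f ← go n
          em (∃[ x ] B x n) >>= λ where
            (no absent) → return (xs , vs , λ x y bxy y<1+n → case m≤n⇒m<n∨m≡n (≤-pred y<1+n) of λ where
              (inj₁ y<n)  → f x y bxy y<n
              (inj₂ refl) → ⊥-elim (absent (x , bxy)))
            (yes (x′ , b′)) → return (x′ ∷ xs , domain b′ ∷ vs , λ x y bxy y<1+n → case m≤n⇒m<n∨m≡n (≤-pred y<1+n) of λ where
              (inj₁ y<n)  → there (f x y bxy y<n)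
              (inj₂ refl) → here (one-one bxy b′))

      module _ (gs : List ℕ) (three : 2 < length gs) (vs : All Vertex gs) (ps : AllPairs Edge gs) where

        distinct : Unique gs
        distinct = AllPairs.map (λ { e refl → irrefl e }) ps

        Only : ℕ → Pred₀
        Only g y = H y × (∀ h → B g h → Edge y h) × (∀ g′ → g′ ∈ gs → g′ ≢ g → ∀ h → B g′ h → ¬ Edge y h)

        -- Choose a vertex adjacent to g and to the preimages `xs` outside the clique, but to no
        -- other clique member. It is not in `xs`: outside the clique it would be adjacent to
        -- itself, inside it would be adjacent to a member other than itself and g. Hence its image
        -- lies beyond y₀.
        only-unending : ∀ {g} → g ∈ gs → Unending (Only g)
        only-unending {g} g∈ y₀ = do
          xs , vxs , cover ← preimages y₀
          let F₀ = g ∷ filter (λ x → ¬? (x ∈? gs)) xs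
              F₁ = filter (λ x → ¬? (x ≟ g)) gs
              x , vx , adj , nonadj = isRado F₀ F₁
                (All.lookup vs g∈ ∷ All.tabulate λ x∈ → All.lookup vxs (proj₁ (∈-filter⁻ (λ x → ¬? (x ∈? gs)) {xs = xs} x∈)))
                (All.tabulate λ x∈ → All.lookup vs (proj₁ (∈-filter⁻ (λ x → ¬? (x ≟ g)) {xs = gs} x∈)))
                (disjoint xs)
          y , bxy , hy ← image vx
          return (y , ≰⇒> (λ y≤ → fresh xs x adj nonadj (cover x y bxy y≤)) , hy ,
            (λ h bgh → edge-to bxy bgh (All.lookup adj (here refl))) ,
            λ g′ g′∈ ne h b e → All.lookup nonadj (∈-filter⁺ (λ x → ¬? (x ≟ g)) g′∈ ne) (edge-from bxy b e))
          where
          disjoint : ∀ xs {v} → ¬ (v ∈ g ∷ filter (λ x → ¬? (x ∈? gs)) xs × v ∈ filter (λ x → ¬? (x ≟ g)) gs)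
          disjoint xs (here refl , q) = proj₂ (∈-filter⁻ (λ x → ¬? (x ≟ g)) {xs = gs} q) refl
          disjoint xs (there p , q) = proj₂ (∈-filter⁻ (λ x → ¬? (x ∈? gs)) {xs = xs} p)
            (proj₁ (∈-filter⁻ (λ x → ¬? (x ≟ g)) {xs = gs} q))
          fresh : ∀ xs x → All (Edge x) (g ∷ filter (λ x → ¬? (x ∈? gs)) xs) →
                  All (λ y → ¬ Edge x y) (filter (λ x → ¬? (x ≟ g)) gs) → x ∉ xs
          fresh xs x adj nonadj x∈ with x ∈? gs
          ... | no x∉gs = irrefl (All.lookup adj (there (∈-filter⁺ (λ x → ¬? (x ∈? gs)) x∈ x∉gs)))
          ... | yes x∈gs with g″ , g″∈ , g″∉ ← escape gs (x ∷ g ∷ []) _≟_ distinct three =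
            All.lookup nonadj (∈-filter⁺ (λ x → ¬? (x ≟ g)) g″∈ (λ e → g″∉ (there (here e))))
              (allPairs-lookup ps x∈gs g″∈ (λ e → g″∉ (here (sym e))))

        -- The bits of `τ` at the images of the clique single out `g`, which makes the cells of
        -- different members distinct.
        Marks : ℕ → ℕ → Str → Set
        Marks L g τ = Unending (λ y → H y × cell L y ≡ τ) × (∀ h → B g h → bit τ h ≡ true) ×
                      (∀ g′ → g′ ∈ gs → g′ ≢ g → ∀ h → B g′ h → bit τ h ≡ false)

        Below-L : ℕ → Set
        Below-L L = ∀ g → g ∈ gs → ∀ h → B g h → h < L

        images-bounded : ¬ ¬ (∃[ L₀ ] Below-L L₀)
        images-bounded = go gs vs
          where
          go : ∀ gs → All Vertex gs → ¬ ¬ (∃[ M ] ∀ g → g ∈ gs → ∀ h → B g h → h < M)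
          go []       []        = return (0 , λ _ ())
          go (g ∷ gs) (vg ∷ vs) = do
            M , f ← go gs vs
            y , b , _ ← image vg
            return (suc y ⊔ M , λ where
              g (here refl) h b′ → subst (λ h → suc h ≤ suc y ⊔ M) (functional b b′) (m≤m⊔n (suc y) M)
              g (there g∈)  h b′ → ≤-trans (f g g∈ h b′) (m≤n⊔m (suc y) M))

        mark : ∀ L → Below-L L → ∀ {g} → g ∈ gs → ¬ ¬ (∃[ τ ] Marks L g τ)
        mark L below {g} g∈ = do
          τ , u ← unending-pigeonhole (cell L) (Only g) (strings L)
                    (λ y _ → subst (λ n → cell L y ∈ strings n) (length-applyUpTo _ L) (∈-strings (cell L y)))
                    (only-unending g∈)
          y , _ , (_ , adj , nonadj) , e ← u 0
          return (τ , (λ y₀ → u y₀ >>= λ (y , l , (hy , _) , e) → return (y , l , hy , e)) ,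
            (λ h b → trans (cong (λ s → bit s h) (sym e)) (trans (bit-applyUpTo _ L (below g g∈ h b)) (dec-true (edge? y h) (adj h b)))) ,
            λ g′ g′∈ ne h b → trans (cong (λ s → bit s h) (sym e))
              (trans (bit-applyUpTo _ L (below g′ g′∈ h b)) (dec-false (edge? y h) (nonadj g′ g′∈ ne h b))))

        marks : ∀ L → Below-L L → ∀ xs → (∀ {x} → x ∈ xs → x ∈ gs) → ¬ ¬ (∃[ row ] Pointwise (Marks L) xs row)
        marks L below []       sub = return ([] , [])
        marks L below (x ∷ xs) sub = do
          τ , m ← mark L below (sub (here refl))
          row , ms ← marks L below xs (sub ∘ there)
          return (τ ∷ row , m ∷ ms)

        marks-unending : ∀ {L xs row} → Pointwise (Marks L) xs row → ∀ τ → τ ∈ row → Unending (λ y → H y × cell L y ≡ τ)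
        marks-unending ((u , _) ∷ ms) _ (here refl) = u
        marks-unending (_ ∷ ms)       τ (there τ∈)  = marks-unending ms τ τ∈

        marks-distinct : ∀ {L xs row} → (∀ {x} → x ∈ xs → x ∈ gs) → Unique xs → Pointwise (Marks L) xs row → Unique row
        marks-distinct sub []          []       = []
        marks-distinct {L} sub (ne ∷ uniq) (_∷_ {x = x} {y = τ} m ms) = differ ms sub ne ∷ marks-distinct (sub ∘ there) uniq ms
          where
          differ : ∀ {xs row} → Pointwise (Marks L) xs row → (∀ {y} → y ∈ x ∷ xs → y ∈ gs) → All (x ≢_) xs → All (τ ≢_) row
          differ []        sub []        = []
          differ {x′ ∷ _} (m′ ∷ ms) sub (n ∷ ns) =
            (λ { refl → image (All.lookup vs (sub (here refl))) λ (h , b , _) →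
              case trans (sym (proj₁ (proj₂ m) h b)) (proj₂ (proj₂ m′) x (sub (here refl)) n h b) of λ () }) ∷
            differ ms (λ { (here e) → sub (here e) ; (there p) → sub (there (there p)) }) ns

    many-cells : ∀ N → ¬ ¬ (∃[ L₀ ] ∀ L → L₀ ≤ L →
      ¬ ¬ (∃[ row ] Unique row × N ≤ length row × (∀ τ → τ ∈ row → Unending (λ y → H y × cell L y ≡ τ))))
    -- Three extra members, since the freshness argument needs a clique of at least three even for
    -- small N.
    many-cells N with gs , len , vs , ps ← clique (3 + N) = do
      let three = subst (2 <_) (sym len) (s≤s (s≤s (s≤s z≤n)))
      L₀ , below ← images-bounded gs three vs ps
      return (L₀ , λ L le → do
        row , ms ← marks gs three vs ps L (λ g g∈ h b → ≤-trans (below g g∈ h b) le) gs id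
        return (row , marks-distinct gs three vs ps id (distinct gs three vs ps) ms ,
          subst (N ≤_) (trans (sym len) (Pointwise-length ms)) (m≤n+m N 3) , marks-unending gs three vs ps ms))

  module _ {n h : ℕ} (h≤n : h ≤ n) {B : ℕ → ℕ → Set} (copy : Copy (S h) B) where

    private
      Z : World
      Z = worlds n

      hit-unbounded : ∀ L row → (∀ τ → τ ∈ row → Unending (λ y → S h y × cell L y ≡ τ)) → Unbounded (hit h L row) Z
      hit-unbounded L row inf x = do
        M , f ← witnesses row inf
        let u = M ⊔ suc x
        z , a ← approx-exists Z u
        return (Hit.members h L row u z x , (u , z , a ,
            ∈-map⁺ (Hit.members h L row u z) (∈-filter⁺ (Hit.meets? h L row u z) (∈-upTo⁺ (m≤n⊔m M (suc x)))
              (All.tabulate λ τ∈ → met u z a (m≤m⊔n M (suc x)) (f _ τ∈)))) ,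
          All.tabulate λ v∈ → proj₁ (proj₂ (∈-filter⁻ (λ v → x <? v ×-dec col? z h v) {xs = upTo u} v∈)))
        where
        witnesses : ∀ row → (∀ τ → τ ∈ row → Unending (λ y → S h y × cell L y ≡ τ)) →
                    ¬ ¬ (∃[ M ] ∀ τ → τ ∈ row → ∃[ y ] x < y × y < M × S h y × cell L y ≡ τ)
        witnesses []        inf = return (0 , λ _ ())
        witnesses (τ ∷ row) inf = do
          M , f ← witnesses row (λ τ → inf τ ∘ there)
          y , x<y , hy , e ← inf τ (here refl) x
          return (suc y ⊔ M , λ where
            _ (here refl) → y , x<y , m≤m⊔n (suc y) M , hy , e
            τ (there τ∈)  → let (y′ , x<y′ , y′< , r) = f τ τ∈ in y′ , x<y′ , ≤-trans y′< (m≤n⊔m (suc y) M) , r)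
        met : ∀ u z → Approx u z Z → ∀ {M τ} → M ≤ u → (∃[ y ] x < y × y < M × S h y × cell L y ≡ τ) →
              Any (λ v → cell L v ≡ τ) (Hit.members h L row u z x)
        met u z a M≤u (y , x<y , y<M , hy , e) = lose
          (∈-filter⁺ (λ v → x <? v ×-dec col? z h v) (∈-upTo⁺ (≤-trans y<M M≤u))
            (x<y , decidable-stable (col? z h y) (col-agrees-to true z Z h a (≤-trans y<M M≤u)
              (return (subst (λ C → C y) (sym (col-worlds h≤n)) hy))))) e

    -- Fairness for a single request, applied to the sets in which the copy meets all cells of a
    -- row: in one of these cells all listed elements have limit c, and that cell contains a listed
    -- element.
    all-colours : ∀ {c} → c < k → ¬ ¬ (∃[ v ] S h v × P v c)
    all-colours {c} c<k = do
      N , f ← worlds-fair (λ m → return (m , λ L₀ → return (L₀ , ≤-refl , base-fair m L₀))) n 1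
      L₀ , g ← many-cells copy N
      L , le , at ← f L₀
      row , uniq , long , inf ← g L le
      V , (u , z , a , V∈) , good ← at ((c , row) ∷ []) (≤-refl , (c<k , uniq , long) ∷ []) (hit h L row) (hit-unbounded L row inf)
      pick-vertex L row u z V a V∈ good
      where
      pick-vertex : ∀ L row u z V → Approx u z Z → V ∈ eval (hit h L row) u z → Good L ((c , row) ∷ []) V →
                    ¬ ¬ (∃[ v ] S h v × P v c)
      pick-vertex L row u z V a V∈ ((τ , τ∈ , coloured) ∷ [])
        with x , x∈ , refl ← ∈-map⁻ (Hit.members h L row u z) V∈
        with _ , meets ← ∈-filter⁻ (Hit.meets? h L row u z) {xs = upTo u} x∈
        with v , v∈ , e ← find (All.lookup meets τ∈)
        with v∈′ , _ , v∈col ← ∈-filter⁻ (λ v → x <? v ×-dec col? z h v) {xs = upTo u} v∈ =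
        col-agrees-from true z Z h a (∈-upTo⁻ v∈′) (return v∈col) >>= λ v∈Z →
        return (v , subst (λ C → C v) (col-worlds h≤n) v∈Z , coloured v v∈ e)

  -- Standard truth against truth in the model.

  private
    Reflects : ∀ {n} → Vec ℕ n → (Fin n → ℕ) → Set
    Reflects v ρ = ∀ i → lookup v i ≡ ρ i

    reflects-cons : ∀ {n} {v : Vec ℕ n} {ρ x} → Reflects v ρ → Reflects (x ∷ v) (x ,ₛ ρ)
    reflects-cons e zero    = refl
    reflects-cons e (suc i) = e i

    term-std : ∀ {n} (t : Term n) {v ρ} → Reflects v ρ → ⟦ t ⟧ᵗ v ≡ value t ρ
    term-std (var i) e = e i
    term-std 0̇       e = refl
    term-std 1̇       e = refl
    term-std (t +̇ u) e = cong₂ _+_ (term-std t e) (term-std u e)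
    term-std (t ·̇ u) e = cong₂ _*_ (term-std t e) (term-std u e)

    wk-std : ∀ {n} (t : Term n) {v ρ x} → Reflects v ρ → ⟦ wkᵗ t ⟧ᵗ (x ∷ v) ≡ value t ρ
    wk-std t e = trans (term-std (wkᵗ t) (reflects-cons e)) (value-wk t)

    -- Truth in the model is negative, so standard truth comes back from it only under double
    -- negation, which `dec` removes for the vertex and edge relations.
    truth-to : ∀ {n} {φ : Formula n 0} → Bounded φ → ∀ {v ρ ξ} → Reflects v ρ → ⟦ φ ⟧ v [] → ρ ⊩ φ ⟨ ξ ⟩
    truth-from : ∀ {n} {φ : Formula n 0} → Bounded φ → ∀ {v ρ ξ} → Reflects v ρ → ρ ⊩ φ ⟨ ξ ⟩ → ¬ ¬ ⟦ φ ⟧ v []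

    truth-to (eq {t} {u}) e p = trans (sym (term-std t e)) (trans p (term-std u e))
    truth-to (lt {t} {u}) e p = subst₂ _<_ (term-std t e) (term-std u e) p
    truth-to (mem {X = ()}) e p
    truth-to bot e p = p
    truth-to (and a b) e (p , q) = truth-to a e p , truth-to b e q
    truth-to (or a b) e (inj₁ p) = return (inj₁ (truth-to a e p))
    truth-to (or a b) e (inj₂ p) = return (inj₂ (truth-to b e p))
    truth-to (imp {ψ = ψ} a b) e p = λ q → stable ψ (truth-from a e q >>= λ r → return (truth-to b e (p r)))
    truth-to (all t a) e p = λ x x< → truth-to a (reflects-cons e)
      (p x (subst (x <_) (trans (value-wk t) (sym (wk-std t e))) x<))
    truth-to (ex t a) e (x , x< , p) =
      return (x , subst (x <_) (trans (wk-std t e) (sym (value-wk t))) x< , truth-to a (reflects-cons e) p)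

    truth-from (eq {t} {u}) e p = return (trans (term-std t e) (trans p (sym (term-std u e))))
    truth-from (lt {t} {u}) e p = return (subst₂ _<_ (sym (term-std t e)) (sym (term-std u e)) p)
    truth-from (mem {X = ()}) e p
    truth-from bot e p = return p
    truth-from (and a b) e (p , q) = truth-from a e p >>= λ p′ → truth-from b e q >>= λ q′ → return (p′ , q′)
    truth-from (or a b) e p = p >>= λ where
      (inj₁ q) → truth-from a e q >>= return ∘ inj₁
      (inj₂ q) → truth-from b e q >>= return ∘ inj₂
    truth-from (imp {φ} a b) {v} e p = em (⟦ φ ⟧ v []) >>= λ where
      (yes q) → truth-from b e (p (truth-to a e q)) >>= λ r → return (λ _ → r)
      (no ¬q) → return (λ q → ⊥-elim (¬q q))
    truth-from (all {φ} t a) {v} {ρ} e p =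
      ∀<-¬¬ (λ x → ⟦ φ ⟧ (x ∷ v) []) (value t ρ) (λ x x< → truth-from a (reflects-cons e)
        (p x (subst (x <_) (sym (value-wk t)) x<))) >>= λ f →
      return (λ x x< → f x (subst (x <_) (wk-std t e) x<))
    truth-from (ex t a) e p = p >>= λ (x , x< , q) → truth-from a (reflects-cons e) q >>= λ r →
      return (x , subst (x <_) (trans (value-wk t) (sym (wk-std t e))) x< , r)

    module _ {n : ℕ} (R : ComputableRelation n) where
      open ComputableRelation R

      Σ-to : ∀ {φ : Formula n 0} → Σ⁰₁ φ → ∀ {v ρ ξ} → Reflects v ρ → ⟦ φ ⟧ v [] → ρ ⊩ φ ⟨ ξ ⟩
      Σ-to (ex b) e (x , p) = return (x , truth-to b (reflects-cons e) p)

      Σ-from : ∀ {φ : Formula n 0} → Σ⁰₁ φ → ∀ {v ρ ξ} → Reflects v ρ → ρ ⊩ φ ⟨ ξ ⟩ → ¬ ¬ ⟦ φ ⟧ v []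
      Σ-from (ex b) e p = p >>= λ (x , q) → truth-from b (reflects-cons e) q >>= λ r → return (x , r)

      module _ {n′ m : ℕ} (ts : Vec (Term n′) n) {ρ : Fin n′ → ℕ} {ξ : Fin m → ℕ} where

        holds-to : Holds (Vec.map (λ t → value t ρ) ts) → ρ ⊩ ⌜ ts ⌝ ⟨ ξ ⟩
        holds-to p = sub-to σ {ξ = λ ()} (λ i → sym (lookup-map i _ ts)) (λ ()) (Σ-to σ-Σ (λ _ → refl) p)

        holds-from : ρ ⊩ ⌜ ts ⌝ ⟨ ξ ⟩ → Holds (Vec.map (λ t → value t ρ) ts)
        holds-from p = decidable-stable (dec _) (Σ-from σ-Σ (λ _ → refl)
          (sub-from σ {ξ = λ ()} (λ i → sym (lookup-map i _ ts)) (λ ()) p))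

  module _ {n m : ℕ} {ρ : Fin n → ℕ} {ξ : Fin m → ℕ} where

    vertexᶠ-to : ∀ t → Vertex (value t ρ) → ρ ⊩ vertexᶠ t ⟨ ξ ⟩
    vertexᶠ-to t = holds-to vertex (t ∷ [])

    vertexᶠ-from : ∀ t → ρ ⊩ vertexᶠ t ⟨ ξ ⟩ → Vertex (value t ρ)
    vertexᶠ-from t = holds-from vertex (t ∷ [])

    edgeᶠ-to : ∀ t u → Edge (value t ρ) (value u ρ) → ρ ⊩ edgeᶠ t u ⟨ ξ ⟩
    edgeᶠ-to t u = holds-to edge (t ∷ u ∷ [])

    edgeᶠ-from : ∀ t u → ρ ⊩ edgeᶠ t u ⟨ ξ ⟩ → Edge (value t ρ) (value u ρ)
    edgeᶠ-from t u = holds-from edge (t ∷ u ∷ [])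

  module _ {n m : ℕ} (ρ : Fin n → ℕ) (ξ : Fin m → ℕ) where

    pairs-to : ∀ {a b} → a < b → Vertex a → Vertex b → (pair a b ,ₛ ρ) ⊩ [ vertexᶠ x₀ ]² ⟨ ξ ⟩
    pairs-to {a} {b} a<b va vb = return (a , return (b , a<b ,
      at-to (vertexᶠ x₀) 3 {x₁} {ρ} (λ _ → refl) (vertexᶠ-to x₀ va) ,
      at-to (vertexᶠ x₀) 3 {x₀} {ρ} (λ _ → refl) (vertexᶠ-to x₀ vb) , refl))

    pairs-from : ∀ {x} → (x ,ₛ ρ) ⊩ [ vertexᶠ x₀ ]² ⟨ ξ ⟩ →
                 ¬ ¬ (∃[ a ] ∃[ b ] a < b × Vertex a × Vertex b × x ≡ pair a b)
    pairs-from p = p >>= λ (a , q) → q >>= λ (b , a<b , va , vb , e) → return (a , b , a<b ,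
      vertexᶠ-from x₀ (at-from (vertexᶠ x₀) 3 {x₁} {ρ} (λ _ → refl) va) ,
      vertexᶠ-from x₀ (at-from (vertexᶠ x₀) 3 {x₀} {ρ} (λ _ → refl) vb) , e)

  ∃^-from : ∀ ℓ {n m} (φ : Formula (ℓ + n) m) {ρ ξ} → ρ ⊩ ∃^ ℓ φ ⟨ ξ ⟩ → ¬ ¬ (∃[ ρ′ ] ρ′ ⊩ φ ⟨ ξ ⟩)
  ∃^-from zero    φ {ρ} p = return (ρ , p)
  ∃^-from (suc ℓ) φ p = ∃^-from ℓ (∃₁ φ) p >>= λ (ρ , q) → q >>= λ (x , r) → return (x ,ₛ ρ , r)

  ⋁-from : ∀ ℓ {n m} (φ : Fin ℓ → Formula n m) {ρ ξ} → ρ ⊩ ⋁ ℓ φ ⟨ ξ ⟩ → ¬ ¬ (∃[ i ] ρ ⊩ φ i ⟨ ξ ⟩)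
  ⋁-from zero    φ p = ⊥-elim p
  ⋁-from (suc ℓ) φ p = p >>= λ where
    (inj₁ q) → return (zero , q)
    (inj₂ q) → ⋁-from ℓ (φ ∘ suc) q >>= λ (i , r) → return (suc i , r)

  F-function : ∀ {ρ : Fin 1 → ℕ} {ξ : Fin 1 → ℕ} → ρ zero ≡ k → ξ zero ≡ 0 →
               ρ ⊩ Function X₀ [ vertexᶠ x₀ ]² (Below x₀) ⟨ ξ ⟩
  F-function {ρ} {ξ} k≡ 0≡ =
    (λ z z∈ → z∈ >>= λ f → let (a , b , c , z≡ , a<b , va , vb , c<k) = F-coloured (subst (λ i → S i z) 0≡ f) in
      return (pair a b , return (c ,
        at-to [ vertexᶠ x₀ ]² 3 {x₁} {ρ} (λ _ → refl) (pairs-to ρ ξ a<b va vb) ,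
        subst (c <_) (sym k≡) c<k , z≡))) ,
    (λ z p → pairs-from ρ ξ p >>= λ { (a , b , a<b , va , vb , refl) → F-total a<b va vb >>= λ (c , _ , f) →
      return (c , return (subst (λ i → S i (pair (pair a b) c)) (sym 0≡) f) , λ c′ q → decidable-stable (c′ ≟ c)
        (q >>= λ f′ → return (F-unique {a} {b} {c′} {c} (subst (λ i → S i (pair (pair a b) c′)) 0≡ f′) f))) })

  copy-from : ∀ {n m} {ρ : Fin n → ℕ} {ξ : Fin m → ℕ} X → ρ ⊩ InducedCopy 𝓡 X ⟨ ξ ⟩ →
              ¬ ¬ (∃[ B ] Copy (S (ξ X)) (λ x y → ¬ ¬ S B (pair x y)))
  copy-from {ρ = ρ} {ξ} X (_ , p) = p >>= λ (B , ((values , total) , inj , _) , iso) → return (B , record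
    { domain = λ {x} {y} b → decidable-stable (vertex? x) (values _ b >>= λ (x′ , q) → q >>= λ (y′ , v , _ , e) →
        return (subst Vertex (sym (proj₁ (pair-injective {x} {y} {x′} {y′} e)))
          (vertexᶠ-from x₀ (at-from (vertexᶠ x₀) 3 {x₁} {ρ} (λ _ → refl) v))))
    ; image = λ {x} vx → total x (vertexᶠ-to x₀ vx) >>= λ (y , b , _) → values _ b >>= λ (x′ , q) →
        q >>= λ (y′ , _ , h , e) → h >>= λ h′ →
        return (y , b , subst (S (ξ X)) (sym (proj₂ (pair-injective {x} {y} {x′} {y′} e))) h′)
    ; functional = λ {x} {y} {y′} b b′ → decidable-stable (y ≟ y′)
        (vertex-of values b >>= λ vx → total x (vertexᶠ-to x₀ vx) >>= λ (y₁ , _ , only) →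
         return (trans (only y b) (sym (only y′ b′))))
    ; one-one = λ {x} {x′} {y} b b′ → inj x x′ y (b , b′)
    ; edge-to = λ {a} {b} {c} {d} p q e → edgeᶠ-from x₁ x₀ (proj₁ (iso a b c d (p , q)) (edgeᶠ-to x₃ x₂ e))
    ; edge-from = λ {a} {b} {c} {d} p q e → edgeᶠ-from x₃ x₂ (proj₂ (iso a b c d (p , q)) (edgeᶠ-to x₁ x₀ e))
    })
    where
    vertex-of : ∀ {B x y} →
      (∀ z → ¬ ¬ S B z → (z ,ₛ ρ) ⊩ ∃₁ ∃₁ (vertexᶠ x₀ at[ 3 ] x₁ ∧̇ Elements (suc X) at[ 3 ] x₀ ∧̇ x₂ ≐ ⟨ x₁ , x₀ ⟩) ⟨ B ,ₛ ξ ⟩) →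
      ¬ ¬ S B (pair x y) → ¬ ¬ Vertex x
    vertex-of {B} {x} {y} values b = values _ b >>= λ (x′ , q) → q >>= λ (y′ , v , _ , e) →
      return (subst Vertex (sym (proj₁ (pair-injective {x} {y} {x′} {y′} e)))
        (vertexᶠ-from x₀ (at-from (vertexᶠ x₀) 3 {x₁} {ρ} (λ _ → refl) v)))

  copies-unending : ∀ {H B} → Copy H B → Unending H
  copies-unending {H} copy y₀ = do
    L₀ , f ← many-cells copy 1
    row , _ , long , u ← f L₀ ≤-refl
    first L₀ row long u
    where
    first : ∀ L row → 1 ≤ length row → (∀ τ → τ ∈ row → Unending (λ y → H y × cell L y ≡ τ)) →
            ¬ ¬ (∃[ y ] y₀ < y × H y)
    first L (τ ∷ _) _ u = u τ (here refl) y₀ >>= λ (y , l , h , _) → return (y , l , h)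

  -- One of the ℓ + 1 colours is not allowed, yet it is the limit of some v in the copy; a late
  -- enough element of the copy forms with v a pair of this colour.
  every-colour-occurs : ∀ h {B} → Copy (S h) B → (cs : Fin ℓ → ℕ) →
    ¬ (∀ x y → S h x → S h y → x < y → ¬ ¬ (∃[ i ] S 0 (pair (pair x y) (cs i))))
  every-colour-occurs h copy cs few
    with c , c∈ , c∉ ← escape (upTo k) (tabulate cs) _≟_ (Unique.upTo⁺ k)
                         (subst₂ _<_ (sym (length-tabulate cs)) (sym (length-upTo k)) ≤-refl) = run do
    v , hv , pv ← all-colours (≤-refl {h}) copy (∈-upTo⁻ c∈)
    let y₀ , f = P-limit pv
    y , y₀⊔v<y , hy ← copies-unending copy (y₀ ⊔ v)
    i , fi ← few v y hv hy (≤-trans (s≤s (m≤n⊔m y₀ v)) y₀⊔v<y)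
    -- That v and y are vertices is read off from their pair being coloured.
    a , b , c′ , e , _ , va , vb , _ ← return (F-coloured fi)
    fc ← f y (≤-trans (m≤m⊔n y₀ v) (<⇒≤ y₀⊔v<y)) (≤-trans (s≤s (m≤n⊔m y₀ v)) y₀⊔v<y)
           (subst Vertex (sym (proj₁ (ends v y (cs i) a b c′ e))) va) (subst Vertex (sym (proj₂ (ends v y (cs i) a b c′ e))) vb)
    return (c∉ (subst (_∈ tabulate cs) (F-unique {v} {y} {cs i} {c} fi fc) (∈-tabulate⁺ i)))
    where
    ends : ∀ v y c a b c′ → pair (pair v y) c ≡ pair (pair a b) c′ → v ≡ a × y ≡ b
    ends v y c a b c′ e = pair-injective {v} {y} {a} {b} (proj₁ (pair-injective {pair v y} {c} {pair a b} {c′} e))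

  RG-false : ∀ {ρ ξ} → ¬ ρ ⊩ ∀k-RG² 𝓡 ℓ ⟨ ξ ⟩
  -- The refuting instance: ℓ + 1 colours and column 0, the generic colouring.
  RG-false {ρ} {ξ} rg = run (rg k (s≤s z≤n) 0 (F-function refl refl) >>= λ (h , copy , colours) →
    copy-from X₀ copy >>= λ (B , c) → ∃^-from ℓ _ colours >>= λ (ρ′ , few) →
    return (every-colour-occurs h c (λ i → ρ′ (i ↑ˡ 1)) λ x y hx hy x<y →
      ⋁-from ℓ _ (few x y (return hx , return hy , x<y)) >>= λ (i , p) → p >>= λ f → return (i , f)))

  base-world-fair : Fair (F ∷ [])
  base-world-fair m = return (m , λ L₀ → return (L₀ , ≤-refl , base-fair m L₀))

  unprovable : ¬ (RCA₀ ∣ RT²₂ ∷ [] ⊢ ∀k-RG² 𝓡 ℓ)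
  unprovable d = RG-false {λ ()} {λ ()} (soundness d (λ ()) (λ ()) λ { (here refl) → RT²₂-true base-world-fair {λ ()} {λ ()} })
    where open Soundness RCA₀ (λ a → RCA₀-sound comprehension a)

theorem6p57 : (𝓡 : ComputableRadoGraph) (ℓ : ℕ) → 1 ≤ ℓ →
    ¬ (RCA₀ ∣ RT²₂ ∷ [] ⊢ ∀k-RG² 𝓡 ℓ)
theorem6p57 𝓡 ℓ _ = Separation.unprovable 𝓡 ℓ
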